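{- Let $P$ be a finite $(3+1)$-free poset and $\lambda$ a partition. Then $$\mathfrak{J}^P_\lambda(\mathbf{u})\equiv\sum_{T\in \mathrm{SSYT}_P(\lambda)}\mathbf{u}_{\mathrm{colword}(T)}\pmod{I^P_{\mathrm{plac}}}.$$
   Context: A poset is $(3+1)$-free if it has no induced subposet isomorphic to the disjoint union of a 3-element chain and a 1-element chain. Write $a<_P b$ for strict order and $a\sim_P b$ for incomparable or equal. $\mathcal{U}_P=\mathbb{Z}\langle u_a:a\in P\rangle$ (noncommuting variables); for a word $w=w_1\cdots w_n$ in the alphabet $P$, $\mathbf{u}_w=u_{w_1}\cdots u_{w_n}$. $e^P_k(\mathbf{u})=\sum u_{a_1}\cdots u_{a_k}$ over $a_1>_P\cdots>_P a_k$ in $P$, with $e^P_0=1$ and $e^P_k=0$ for $k<0$. For a partition $\lambda$ with conjugate $\lambda'$ and $k=\lambda_1$, $\mathfrak{J}^P_\lambda(\mathbf{u})=\sum_{\pi\in S_k}\mathrm{sgn}(\pi)\,e^P_{\lambda'_1+\pi(1)-1}(\mathbf{u})\cdots e^P_{\lambda'_k+\pi(k)-k}(\mathbf{u})$. $I^P_{\mathrm{plac}}$ is the two-sided ideal generated by: $u_bu_au_c-u_bu_cu_a$ when $a<_Pb$, $c\not<_Pb$, $a<_Pc$; $u_cu_au_b-u_au_cu_b$ when $b\not<_Pa$, $b<_Pc$, $a<_Pc$; $u_cu_au_b-u_bu_cu_a$ when $a\sim_Pb$, $b\sim_Pc$, $a<_Pc$. A $P$-tableau of shape $\lambda$ is a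 map $T$ from the Young diagram $\{(r,c): 1\le c\le\lambda_r\}$ (English notation, row $r$ increasing downward) to $P$ such that each column satisfies $T(1,c)<_PT(2,c)<_P\cdots<_PT(\lambda'_c,c)$ and each row satisfies $T(r,c+1)\not<_PT(r,c)$. $\mathrm{SSYT}_P(\lambda)$ is the set of these. The column reading word $\mathrm{colword}(T)$ is obtained by reading each column from bottom to top and concatenating the columns from left to right. -}

module Defs where

open import Level using (Level; 0ℓ; _⊔_)
open import Algebra.Bundles using (Ring)
open import Data.Empty using (⊥-elim)
open import Data.Fin.Base as Fin using (Fin; toℕ)
import Data.Fin.Properties as Fin
open import Data.Integer.Base as ℤ using (ℤ; +_; -[1+_]; 0ℤ; 1ℤ; -1ℤ)
import Data.Integer.Properties as ℤ
open import Data.Integer.Tactic.RingSolver using (solve-∀)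
open import Data.List.Base using (List; []; _∷_; _++_; map; foldr; filter; length; head; drop; mapMaybe; concatMap; reverse; upTo; allFin; cartesianProductWith)
import Data.List.Properties as List
open import Data.List.Membership.Propositional using (_∈_)
open import Data.List.Relation.Unary.All as All using (All; []; _∷_)
open import Data.List.Relation.Unary.Linked using (Linked; linked?)
open import Data.List.Relation.Unary.Unique.Propositional using (Unique)
open import Data.Maybe.Base using (fromMaybe)
open import Data.Nat.Base as ℕ using (ℕ; zero; suc; NonZero)
import Data.Nat.Properties as ℕ
open import Data.Product.Base using (_×_; _,_; proj₁; proj₂; map₁; ∃)
open import Data.Sum.Base using (_⊎_)
open import Data.Sum.Relation.Binary.Pointwise using (Pointwise)
open import Data.Vec.Base as Vec using (Vec; []; _∷_)
import Data.Vec.Relation.Unary.AllPairs as Vec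
open import Function.Base using (_∘_; flip)
open import Relation.Binary.Core using (Rel)
open import Relation.Binary.Definitions using (DecidableEquality)
open import Relation.Binary.Morphism.Structures using (IsOrderMonomorphism)
open import Relation.Binary.PropositionalEquality
  using (_≡_; refl; sym; trans; cong; cong₂; module ≡-Reasoning)
open import Relation.Binary.Structures using (IsDecPartialOrder; IsDecStrictPartialOrder)
import Relation.Binary.Construct.NonStrictToStrict as ToStrict
open import Relation.Nullary using (¬_; Dec; yes; no; ¬?; _×-dec_)
open import Relation.Unary using (Pred; Decidable)

private
  variable
    a c ℓ p : Level
    A B : Set a

record FinitePoset : Set₁ where
  infix 4 _≤_
  field
    Carrier           : Set
    _≤_               : Rel Carrier 0ℓ
    isDecPartialOrder : IsDecPartialOrder _≡_ _≤_
    elements          : List Carrier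
    unique            : Unique elements
    complete          : ∀ x → x ∈ elements

  open IsDecPartialOrder isDecPartialOrder public using (_≟_; _≤?_)

  infix 4 _<_ _<?_ _∼_
  _<_ : Rel Carrier 0ℓ
  _<_ = ToStrict._<_ _≡_ _≤_

  <-isDecStrictPartialOrder : IsDecStrictPartialOrder _≡_ _<_
  <-isDecStrictPartialOrder =
    ToStrict.<-isDecStrictPartialOrder _≡_ _≤_ isDecPartialOrder

  _<?_ : ∀ x y → Dec (x < y)
  _<?_ = IsDecStrictPartialOrder._<?_ <-isDecStrictPartialOrder

  _∼_ : Rel Carrier 0ℓ
  x ∼ y = (¬ (x ≤ y) × ¬ (y ≤ x)) ⊎ x ≡ y

-- An induced subposet isomorphic to Q is the image of a map from Q that
-- preserves and reflects both order and equality; here Q is the disjoint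
-- union of the chains Fin 3 and Fin 1.
ThreePlusOneFree : FinitePoset → Set
ThreePlusOneFree P =
  ¬ ∃ λ (f : Fin 3 ⊎ Fin 1 → Carrier) →
      IsOrderMonomorphism _≡_ _≡_ (Pointwise Fin._≤_ Fin._≤_) _≤_ f
  where open FinitePoset P

module _ (R : Ring c ℓ) where
  open Ring R

  data IdealGeneratedBy (G : Pred Carrier p) : Pred Carrier (c ⊔ ℓ ⊔ p) where
    generator : ∀ {x} → G x → IdealGeneratedBy G x
    zeroᴵ     : IdealGeneratedBy G 0#
    plus      : ∀ {x y} → IdealGeneratedBy G x → IdealGeneratedBy G y →
                IdealGeneratedBy G (x + y)
    timesˡ    : ∀ r {x} → IdealGeneratedBy G x → IdealGeneratedBy G (r * x)
    timesʳ    : ∀ r {x} → IdealGeneratedBy G x → IdealGeneratedBy G (x * r)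
    resp      : ∀ {x y} → x ≈ y → IdealGeneratedBy G x → IdealGeneratedBy G y

  CongruentMod : Pred Carrier p → Rel Carrier p
  CongruentMod I x y = I (x - y)

-- An element is a formal sum of terms (coefficient , word); two formal sums
-- are equal when every word has the same total coefficient in both.

module FreeRing {A : Set} (_≟_ : DecidableEquality A) where

  Word : Set
  Word = List A

  Polynomial : Set
  Polynomial = List (ℤ × Word)

  _≟ʷ_ : DecidableEquality Word
  _≟ʷ_ = List.≡-dec _≟_

  δ : Word → Word → ℤ
  δ w v with v ≟ʷ w
  ... | yes _ = 1ℤ
  ... | no  _ = 0ℤ

  -- The ℤ-linear extension of h : Word → ℤ, evaluated at f.
  linear : (Word → ℤ) → Polynomial → ℤ
  linear h []            = 0ℤ
  linear h ((k , v) ∷ f) = k ℤ.* h v ℤ.+ linear h f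

  coeff : Polynomial → Word → ℤ
  coeff f w = linear (δ w) f

  infix  4 _≈_
  infixl 6 _+_
  infixl 7 _*_ _·_
  infix  8 -_

  record _≈_ (f g : Polynomial) : Set where
    constructor coeffwise
    field coeff-≡ : ∀ w → coeff f w ≡ coeff g w
  open _≈_ public

  0# 1# : Polynomial
  0# = []
  1# = (1ℤ , []) ∷ []

  _+_ : Polynomial → Polynomial → Polynomial
  _+_ = _++_

  mulTerm : ℤ × Word → ℤ × Word → ℤ × Word
  mulTerm (k , v) (l , w) = k ℤ.* l , v ++ w

  _*_ : Polynomial → Polynomial → Polynomial
  _*_ = cartesianProductWith mulTerm

  _·_ : ℤ → Polynomial → Polynomial
  k · f = map (map₁ (k ℤ.*_)) f

  -_ : Polynomial → Polynomial
  - f = map (map₁ λ k → ℤ.- k) f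

  𝐮 : Word → Polynomial
  𝐮 w = (1ℤ , w) ∷ []

  -- Equality of polynomials is an equality of all linear functionals; the
  -- ring laws are checked in that form.

  linear-+ : ∀ h f g → linear h (f + g) ≡ linear h f ℤ.+ linear h g
  linear-+ h []            g = sym (ℤ.+-identityˡ _)
  linear-+ h ((k , v) ∷ f) g = trans
    (cong (λ z → k ℤ.* h v ℤ.+ z) (linear-+ h f g))
    (sym (ℤ.+-assoc (k ℤ.* h v) (linear h f) (linear h g)))

  linear-neg : ∀ h f → linear h (- f) ≡ ℤ.- linear h f
  linear-neg h []            = refl
  linear-neg h ((k , v) ∷ f) = trans
    (cong (λ z → ℤ.- k ℤ.* h v ℤ.+ z) (linear-neg h f))
    (lemma k (h v) (linear h f))
    where
    lemma : ∀ k x y → ℤ.- k ℤ.* x ℤ.+ ℤ.- y ≡ ℤ.- (k ℤ.* x ℤ.+ y)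
    lemma = solve-∀

  linear-cong : ∀ {h h′} → (∀ w → h w ≡ h′ w) → ∀ f → linear h f ≡ linear h′ f
  linear-cong eq []            = refl
  linear-cong eq ((k , v) ∷ f) =
    cong₂ (λ x y → k ℤ.* x ℤ.+ y) (eq v) (linear-cong eq f)

  linear-scale : ∀ k h f → linear (λ w → k ℤ.* h w) f ≡ k ℤ.* linear h f
  linear-scale k h []            = sym (ℤ.*-zeroʳ k)
  linear-scale k h ((l , v) ∷ f) = trans
    (cong (λ z → l ℤ.* (k ℤ.* h v) ℤ.+ z) (linear-scale k h f))
    (lemma k l (h v) (linear h f))
    where
    lemma : ∀ k l x y → l ℤ.* (k ℤ.* x) ℤ.+ k ℤ.* y ≡ k ℤ.* (l ℤ.* x ℤ.+ y)
    lemma = solve-∀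

  linear-* : ∀ h f g →
             linear h (f * g) ≡ linear (λ v → linear (λ w → h (v ++ w)) g) f
  linear-* h []            g = refl
  linear-* h ((k , v) ∷ f) g = trans
    (linear-+ h (map (mulTerm (k , v)) g) (f * g))
    (cong₂ ℤ._+_ (term g) (linear-* h f g))
    where
    lemma : ∀ k l x y → k ℤ.* l ℤ.* x ℤ.+ k ℤ.* y ≡ k ℤ.* (l ℤ.* x ℤ.+ y)
    lemma = solve-∀
    term : ∀ g → linear h (map (mulTerm (k , v)) g)
                 ≡ k ℤ.* linear (λ w → h (v ++ w)) g
    term []            = sym (ℤ.*-zeroʳ k)
    term ((l , w) ∷ g) = trans
      (cong (λ z → k ℤ.* l ℤ.* h (v ++ w) ℤ.+ z) (term g))
      (lemma k l (h (v ++ w)) _)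

  private
    without : Word → Polynomial → Polynomial
    without v = filter λ t → ¬? (proj₂ t ≟ʷ v)

    linear-without : ∀ h v f →
      linear h f ≡ coeff f v ℤ.* h v ℤ.+ linear h (without v f)
    linear-without h v [] = refl
    linear-without h v ((k , w) ∷ f) with w ≟ʷ v
    ... | yes refl = trans (cong (λ z → k ℤ.* h w ℤ.+ z) (linear-without h w f))
                           (lemma k (h w) (coeff f w) _)
      where
      lemma : ∀ k x y z → k ℤ.* x ℤ.+ (y ℤ.* x ℤ.+ z)
                          ≡ (k ℤ.* 1ℤ ℤ.+ y) ℤ.* x ℤ.+ z
      lemma = solve-∀
    ... | no _ = trans (cong (λ z → k ℤ.* h w ℤ.+ z) (linear-without h v f))
                       (lemma k (h w) (coeff f v) (h v) _)
      where
      lemma : ∀ k x y y′ z → k ℤ.* x ℤ.+ (y ℤ.* y′ ℤ.+ z)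
                             ≡ (k ℤ.* 0ℤ ℤ.+ y) ℤ.* y′ ℤ.+ (k ℤ.* x ℤ.+ z)
      lemma = solve-∀

    coeff-without-≡ : ∀ v f → coeff (without v f) v ≡ 0ℤ
    coeff-without-≡ v [] = refl
    coeff-without-≡ v ((k , w) ∷ f) with w ≟ʷ v
    ... | yes _ = coeff-without-≡ v f
    ... | no w≢v with w ≟ʷ v
    ...   | yes w≡v = ⊥-elim (w≢v w≡v)
    ...   | no  _   = trans (cong (λ z → k ℤ.* 0ℤ ℤ.+ z) (coeff-without-≡ v f))
                            (trans (ℤ.+-identityʳ _) (ℤ.*-zeroʳ k))

    coeff-without : ∀ v f → (∀ w → coeff f w ≡ 0ℤ) →
                    ∀ w → coeff (without v f) w ≡ 0ℤ
    coeff-without v f f≈0 w with v ≟ʷ w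
    ... | yes refl = coeff-without-≡ v f
    ... | no  _    = begin
      coeff (without v f) w                            ≡⟨ ℤ.+-identityˡ _ ⟨
      0ℤ ℤ.* δ w v ℤ.+ coeff (without v f) w           ≡⟨ cong (λ z → z ℤ.* δ w v ℤ.+ coeff (without v f) w) (f≈0 v) ⟨
      coeff f v ℤ.* δ w v ℤ.+ coeff (without v f) w    ≡⟨ linear-without (δ w) v f ⟨
      coeff f w                                        ≡⟨ f≈0 w ⟩
      0ℤ                                               ∎
      where open ≡-Reasoning

    length-without : ∀ k v f → length (without v ((k , v) ∷ f)) ℕ.≤ length f
    length-without k v f with v ≟ʷ v
    ... | yes _  = List.length-filter (λ t → ¬? (proj₂ t ≟ʷ v)) f
    ... | no v≢v = ⊥-elim (v≢v refl)

    linear-zero : ∀ h n f → length f ℕ.≤ n → (∀ w → coeff f w ≡ 0ℤ) →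
                  linear h f ≡ 0ℤ
    linear-zero h n       []              _           f≈0 = refl
    linear-zero h (suc n) f@((k , v) ∷ f′) (ℕ.s≤s len) f≈0 = begin
      linear h f                                       ≡⟨ linear-without h v f ⟩
      coeff f v ℤ.* h v ℤ.+ linear h (without v f)     ≡⟨ cong₂ (λ x y → x ℤ.* h v ℤ.+ y) (f≈0 v)
                                                            (linear-zero h n (without v f)
                                                              (ℕ.≤-trans (length-without k v f′) len)
                                                              (coeff-without v f f≈0)) ⟩
      0ℤ                                               ∎
      where open ≡-Reasoning

    difference : ∀ h f g → linear h (f + - g) ≡ linear h f ℤ.- linear h g
    difference h f g =
      trans (linear-+ h f (- g)) (cong (λ z → linear h f ℤ.+ z) (linear-neg h g))

  linear-resp-≈ : ∀ h {f g} → f ≈ g → linear h f ≡ linear h g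
  linear-resp-≈ h {f} {g} f≈g = ℤ.i-j≡0⇒i≡j _ _ (trans
    (sym (difference h f g))
    (linear-zero h _ (f + - g) ℕ.≤-refl λ w →
      trans (difference (δ w) f g) (ℤ.i≡j⇒i-j≡0 (coeff-≡ f≈g w))))

  ring : Ring 0ℓ 0ℓ
  ring = record
    { Carrier = Polynomial ; _≈_ = _≈_ ; _+_ = _+_ ; _*_ = _*_ ; -_ = -_
    ; 0# = 0# ; 1# = 1#
    ; isRing = record
      { +-isAbelianGroup = record
        { isGroup = record
          { isMonoid = record
            { isSemigroup = record
              { isMagma = record
                { isEquivalence = record
                  { refl  = coeffwise λ w → refl
                  ; sym   = λ p → coeffwise λ w → sym (coeff-≡ p w)
                  ; trans = λ p q → coeffwise λ w → trans (coeff-≡ p w) (coeff-≡ q w)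
                  }
                ; ∙-cong = λ {f} {f′} {g} {g′} p q → coeffwise λ w →
                    trans (linear-+ (δ w) f g)
                      (trans (cong₂ ℤ._+_ (coeff-≡ p w) (coeff-≡ q w))
                        (sym (linear-+ (δ w) f′ g′)))
                }
              ; assoc = λ f g h → reflexive (List.++-assoc f g h)
              }
            ; identity = (λ f → reflexive refl) , (λ f → reflexive (List.++-identityʳ f))
            }
          ; inverse =
              (λ f → coeffwise λ w → trans (linear-+ (δ w) (- f) f)
                 (trans (cong (ℤ._+ coeff f w) (linear-neg (δ w) f))
                        (ℤ.+-inverseˡ (coeff f w))))
            , (λ f → coeffwise λ w → trans (difference (δ w) f f)
                 (ℤ.+-inverseʳ (coeff f w)))
          ; ⁻¹-cong = λ {f} {g} p → coeffwise λ w →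
              trans (linear-neg (δ w) f)
                (trans (cong ℤ.-_ (coeff-≡ p w)) (sym (linear-neg (δ w) g)))
          }
        ; comm = λ f g → coeffwise λ w →
            trans (linear-+ (δ w) f g)
              (trans (ℤ.+-comm (coeff f w) (coeff g w)) (sym (linear-+ (δ w) g f)))
        }
      ; *-cong = λ {f} {f′} {g} {g′} p q → coeffwise λ w →
          trans (linear-* (δ w) f g)
            (trans (linear-resp-≈ _ p)
              (trans (linear-cong (λ v → linear-resp-≈ _ q) f′)
                (sym (linear-* (δ w) f′ g′))))
      ; *-assoc = λ f g h → coeffwise λ w → begin
          linear (δ w) ((f * g) * h)
            ≡⟨ linear-* (δ w) (f * g) h ⟩
          linear (λ v → linear (λ z → δ w (v ++ z)) h) (f * g)
            ≡⟨ linear-* _ f g ⟩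
          linear (λ x → linear (λ y → linear (λ z → δ w ((x ++ y) ++ z)) h) g) f
            ≡⟨ linear-cong (λ x → linear-cong (λ y → linear-cong (λ z →
                 cong (δ w) (List.++-assoc x y z)) h) g) f ⟩
          linear (λ x → linear (λ y → linear (λ z → δ w (x ++ (y ++ z))) h) g) f
            ≡⟨ linear-cong (λ x → linear-* _ g h) f ⟨
          linear (λ x → linear (λ y → δ w (x ++ y)) (g * h)) f
            ≡⟨ linear-* (δ w) f (g * h) ⟨
          linear (δ w) (f * (g * h)) ∎
      ; *-identity =
          (λ f → coeffwise λ w → trans (linear-* (δ w) 1# f)
            (trans (ℤ.+-identityʳ _) (ℤ.*-identityˡ _)))
        , (λ f → coeffwise λ w → trans (linear-* (δ w) f 1#)
            (linear-cong (λ v → trans (ℤ.+-identityʳ _)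
              (trans (ℤ.*-identityˡ _) (cong (δ w) (List.++-identityʳ v)))) f))
      ; distrib =
          (λ f g h → coeffwise λ w → trans (linear-* (δ w) f (g + h))
            (trans (linear-cong (λ v → linear-+ _ g h) f)
              (trans (linear-sum _ _ f)
                (trans (cong₂ ℤ._+_ (sym (linear-* (δ w) f g)) (sym (linear-* (δ w) f h)))
                  (sym (linear-+ (δ w) (f * g) (f * h)))))))
        , (λ f g h → coeffwise λ w → trans (linear-* (δ w) (g + h) f)
            (trans (linear-+ _ g h)
              (trans (cong₂ ℤ._+_ (sym (linear-* (δ w) g f)) (sym (linear-* (δ w) h f)))
                (sym (linear-+ (δ w) (g * f) (h * f))))))
      }
    }
    where
    open ≡-Reasoning
    reflexive : ∀ {f g} → f ≡ g → f ≈ g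
    reflexive refl = coeffwise λ w → refl
    linear-sum : ∀ h h′ f →
                 linear (λ w → h w ℤ.+ h′ w) f ≡ linear h f ℤ.+ linear h′ f
    linear-sum h h′ []            = refl
    linear-sum h h′ ((k , v) ∷ f) = trans
      (cong (λ z → k ℤ.* (h v ℤ.+ h′ v) ℤ.+ z) (linear-sum h h′ f))
      (lemma k (h v) (h′ v) (linear h f) (linear h′ f))
      where
      lemma : ∀ k x y s t → k ℤ.* (x ℤ.+ y) ℤ.+ (s ℤ.+ t)
                            ≡ (k ℤ.* x ℤ.+ s) ℤ.+ (k ℤ.* y ℤ.+ t)
      lemma = solve-∀

  open Ring ring public using (_-_)

  infix 5 ∑ ∏

  ∑ ∏ : List B → (B → Polynomial) → Polynomial
  ∑ xs f = foldr _+_ 0# (map f xs)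
  ∏ xs f = foldr _*_ 1# (map f xs)

  syntax ∑ xs (λ x → f) = ∑[ x ∈ xs ] f
  syntax ∏ xs (λ x → f) = ∏[ x ∈ xs ] f

vectors : List A → (n : ℕ) → List (Vec A n)
vectors xs zero    = [] ∷ []
vectors xs (suc n) = cartesianProductWith _∷_ xs (vectors xs n)

-- The elements of S_k in one-line notation (on 0 , … , k - 1).
permutations : (k : ℕ) → List (Vec (Fin k) k)
permutations k =
  filter (Vec.allPairs? λ i j → ¬? (i Fin.≟ j)) (vectors (allFin k) k)

inversions : ∀ {k n} → Vec (Fin k) n → ℕ
inversions []      = 0
inversions (i ∷ π) = length (filter (Fin._<? i) (Vec.toList π)) ℕ.+ inversions π

sgn : ∀ {k} → Vec (Fin k) k → ℤ
sgn π = -1ℤ ℤ.^ inversions π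

record Partition : Set where
  field
    parts      : List ℕ
    decreasing : Linked ℕ._≥_ parts
    positive   : All NonZero parts

  -- The first part, 0 for the empty partition.
  first : ℕ
  first = fromMaybe 0 (head parts)

  -- The j-th part of the conjugate partition (j ≥ 1).
  conjugatePart : ℕ → ℕ
  conjugatePart j = length (filter (j ℕ.≤?_) parts)

-- The r-th row of a filling is a vector of length the r-th part.
Filling : Set → List ℕ → Set
Filling A = All (Vec A)

fillings : List A → (ℓs : List ℕ) → List (Filling A ℓs)
fillings xs []       = [] ∷ []
fillings xs (ℓ ∷ ℓs) = cartesianProductWith _∷_ (vectors xs ℓ) (fillings xs ℓs)

rows : ∀ {ℓs} → Filling A ℓs → List (List A)
rows = All.reduce Vec.toList

-- Entries of the column with (0-based) index c, from top to bottom; rows too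
-- short to meet that column contribute nothing.
column : ∀ {ℓs} → ℕ → Filling A ℓs → List A
column c T = mapMaybe (head ∘ drop c) (rows T)

module PSchur (P : FinitePoset) where
  open FinitePoset P
  open FreeRing _≟_ public

  e : ℤ → Polynomial
  e (+ k)    = ∑[ w ∈ filter (linked? (flip _<?_)) (map Vec.toList (vectors elements k)) ] 𝐮 w
  e -[1+ _ ] = 0#

  -- With 0-based i the index λ'ᵢ + π(i) - i is unaffected by the shift of
  -- both π(i) and i.
  𝔍 : Partition → Polynomial
  𝔍 Λ = ∑[ π ∈ permutations first ] sgn π ·
           (∏[ i ∈ allFin first ]
             e (+ conjugatePart (suc (toℕ i)) ℤ.+ + toℕ (Vec.lookup π i) ℤ.- + toℕ i))
    where open Partition Λ

  data PlacticRelation : Pred Polynomial 0ℓ where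
    rel₁ : ∀ {a b c} → a < b → ¬ (c < b) → a < c →
           PlacticRelation (𝐮 (b ∷ a ∷ c ∷ []) - 𝐮 (b ∷ c ∷ a ∷ []))
    rel₂ : ∀ {a b c} → ¬ (b < a) → b < c → a < c →
           PlacticRelation (𝐮 (c ∷ a ∷ b ∷ []) - 𝐮 (a ∷ c ∷ b ∷ []))
    rel₃ : ∀ {a b c} → a ∼ b → b ∼ c → a < c →
           PlacticRelation (𝐮 (c ∷ a ∷ b ∷ []) - 𝐮 (b ∷ c ∷ a ∷ []))

  I-plac : Pred Polynomial 0ℓ
  I-plac = IdealGeneratedBy ring PlacticRelation

  infix 4 _≡_mod-I-plac
  _≡_mod-I-plac : Rel Polynomial 0ℓ
  f ≡ g mod-I-plac = CongruentMod ring I-plac f g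

  module _ (Λ : Partition) where
    open Partition Λ

    IsTableau : Pred (Filling Carrier parts) 0ℓ
    IsTableau T = All (λ c → Linked _<_ (column c T)) (upTo first)
                × All (Linked λ x y → ¬ (y < x)) (rows T)

    isTableau? : Decidable IsTableau
    isTableau? T = All.all? (λ c → linked? _<?_ (column c T)) (upTo first)
             ×-dec All.all? (linked? λ x y → ¬? (y <? x)) (rows T)

    SSYT : List (Filling Carrier parts)
    SSYT = filter isTableau? (fillings elements parts)

    colword : Filling Carrier parts → Word
    colword T = concatMap (λ c → reverse (column c T)) (upTo first)

{-# OPTIONS --safe #-}

-- Write e for the elementary sums, taken inside a sub-poset S, and read columns
-- from bottom to top. In a pair of columns let the first flaw be the first row r in
-- which the right entry b lies below the left one, or the left one is missing.
-- (3+1)-freeness lets one cut at b as Gasharov does: M (rows < r of the left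
-- column) and N (rows ≤ r of the right one) stay, and both tails X, Y range over
-- all chains above b. The Knuth relations move Y past M, so the word X M Y N
-- becomes X Y M N, and the tails contribute a product e_i e_j over {x > b}.
-- Hence e_p e_q = (tableaux) + Σ_(M,N) e_(p-r+1) e_(q-r) M N, and once the e commute
-- this is symmetric under (p , q) ↦ (q - 1 , p + 1). Applied at the rightmost flaw
-- of the first flawed row of an array of columns, this cancels all flawed arrays in
-- the (transposed) alternating sum, and only tableaux of shape λ survive.
--
-- Commutation e_m e_n = e_n e_m, for m > n, is proved by induction on m + n. No
-- pair counted by e_n e_m is flawless, so e_n e_m expands at its first flaw; reversing
-- order and multiplication, e_m e_n expands at its last one. Expanding the inner
-- products in the opposite way makes both sides agree by induction, up to flawless
-- pairs with columns of equal length. These matter only for m = n + 1; there both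
-- sides are sums of words  balanced · D C · balanced  and  balanced · C D · balanced
-- over zigzags (C , D) with incomparable neighbours, for which D C = C D.

module Submission where

open import Level using (0ℓ)
open import Algebra.Bundles using (Ring)
import Algebra.Properties.Ring
open import Data.Bool.Base using (if_then_else_)
open import Data.Empty using (⊥; ⊥-elim)
open import Data.Fin.Base as Fin using (Fin; toℕ)
import Data.Fin.Properties as Fin
open import Data.Integer.Base as ℤ using (ℤ; +_; -[1+_]; 1ℤ; -1ℤ)
import Data.Integer.Properties as ℤ
open import Data.Integer.Tactic.RingSolver using (solve-∀)
open import Data.List.Base
  using (List; []; _∷_; _++_; [_]; _∷ʳ_; map; foldr; filter; reverse; length; head; drop;
         concatMap; cartesianProductWith; allFin; upTo; applyUpTo; tabulate; initLast; _∷ʳ′_)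
import Data.List.Properties as List
open import Data.List.Membership.Propositional using (_∈_)
open import Data.List.Membership.Propositional.Properties
  using (∈-allFin; ∈-cartesianProductWith⁺; ∈-map⁺; ∈-filter⁺; ∈-filter⁻)
open import Data.List.Membership.Propositional.Properties.WithK using (unique∧set⇒bag)
open import Data.List.Relation.Binary.BagAndSetEquality using (∼bag⇒↭)
open import Data.List.Relation.Binary.Permutation.Propositional using (_↭_; ↭-sym; ↭-refl)
open import Data.List.Relation.Binary.Permutation.Propositional.Properties
  using (All-resp-↭; ↭-reverse; filter-↭; ↭-length; ++⁺ˡ)
open import Data.List.Relation.Binary.Pointwise as Pointwise using (Pointwise; []; _∷_)
open import Data.List.Relation.Unary.All as All using (All; []; _∷_)
import Data.List.Relation.Unary.All.Properties as All
open import Data.List.Relation.Unary.AllPairs as AllPairs using (AllPairs; []; _∷_; allPairs?)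
import Data.List.Relation.Unary.AllPairs.Properties as AllPairs
open import Data.List.Relation.Unary.Any using (here; there)
open import Data.List.Relation.Unary.Linked as Linked using (Linked; []; [-]; _∷_; linked?)
import Data.List.Relation.Unary.Linked.Properties as Linked
open import Data.List.Relation.Unary.Unique.Propositional using (Unique)
import Data.List.Relation.Unary.Unique.Propositional.Properties as Unique
open import Data.Maybe.Base using (fromMaybe)
open import Data.Nat.Base as ℕ using (ℕ; zero; suc)
import Data.Nat.Properties as ℕ
open import Data.Product.Base using (∃; _×_; _,_; proj₁; proj₂; map₁)
open import Data.Sum.Base as Sum using (_⊎_; inj₁; inj₂; [_,_]′)
import Data.Sum.Relation.Binary.Pointwise as Sumᴾ
open import Data.Unit.Base using (⊤; tt)
open import Data.Vec.Base as Vec using (Vec; []; _∷_; lookup; toList)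
import Data.Vec.Properties as Vec
import Data.Vec.Relation.Unary.All as Vecᴬ
import Data.Vec.Relation.Unary.AllPairs as Vecᴾ
import Data.Vec.Relation.Unary.Unique.Propositional.Properties as Vecᵁ
open import Function.Base using (_∘_; flip; id)
open import Function.Bundles using (mk⇔)
open import Function.Definitions using (Injective)
open import Relation.Binary.Definitions using (tri<; tri≈; tri>)
open import Relation.Binary.PropositionalEquality as ≡
  using (_≡_; refl; cong; cong₂; subst)
open import Relation.Binary.Structures using (IsDecPartialOrder; IsDecStrictPartialOrder)
open import Relation.Nullary using (¬_; Dec; does; yes; no; ¬?; _×-dec_)
open import Relation.Unary using (Pred; Decidable)
open import Tactic.MonoidSolver using (solve)
open import Defs

-- For commuting variables one would exchange the tails of two columns word by word. Here no such
-- termwise exchange is available: only the sums over all tails X and Y are compared, and these are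
-- products of elementary sums over the elements of S above b. This is why sub-posets occur
-- throughout, and why commutation has to be proved for all of them simultaneously. The relations
-- and (3+1)-freeness survive the reversal of order and multiplication, so an expansion at the last
-- flaw is an expansion at the first flaw in the opposite algebra. To make this usable, the argument
-- is carried out in an abstract algebra whose equality plays the role of congruence modulo the
-- ideal. The alternating sum has to be transposed because, in the original one, exchanging two
-- values of π does not act on neighbouring heights as (p , q) ↦ (q - 1 , p + 1). Once the position
-- of a factor carries the shift, exchanging two neighbouring letters does exactly this. The
-- transposition itself already needs that the e commute.

words : {A : Set} → List A → ℕ → List (List A)
words S zero    = [ [] ]
words S (suc k) = cartesianProductWith _∷_ S (words S k)

indices : ℕ → List ℕ
indices zero    = []
indices (suc b) = 0 ∷ map suc (indices b)

-- Finite sums in a ring, restricted by decidable conditions.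

module Sums (R : Ring 0ℓ 0ℓ) where
  open Ring R renaming (refl to ≈-refl)
  open import Relation.Binary.Reasoning.Setoid setoid

  ∑ : {B : Set} → List B → (B → Carrier) → Carrier
  ∑ xs f = foldr _+_ 0# (map f xs)

  infix 5 ∑
  syntax ∑ xs (λ x → f) = ∑[ x ∈ xs ] f

  -- Conditions are kept as zero summands rather than as filtered lists, so that they can be merged,
  -- exchanged and moved through sums and products while the index lists stay the same.
  guard : {P : Set} → Dec P → Carrier → Carrier
  guard p x = if does p then x else 0#

  private
    variable
      B C : Set
      P Q : Set

  ∑-cong : (xs : List B) {f g : B → Carrier} → (∀ x → f x ≈ g x) → ∑ xs f ≈ ∑ xs g
  ∑-cong []       eq = ≈-refl
  ∑-cong (x ∷ xs) eq = +-cong (eq x) (∑-cong xs eq)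

  ∑-zero : (xs : List B) {f : B → Carrier} → (∀ x → f x ≈ 0#) → ∑ xs f ≈ 0#
  ∑-zero []       eq = ≈-refl
  ∑-zero (x ∷ xs) eq = trans (+-cong (eq x) (∑-zero xs eq)) (+-identityˡ 0#)

  +-interchange : ∀ a b c d → (a + b) + (c + d) ≈ (a + c) + (b + d)
  +-interchange a b c d = begin
    (a + b) + (c + d) ≈⟨ +-assoc a b (c + d) ⟩
    a + (b + (c + d)) ≈⟨ +-congˡ (trans (sym (+-assoc b c d)) (+-congʳ (+-comm b c))) ⟩
    a + ((c + b) + d) ≈⟨ +-congˡ (+-assoc c b d) ⟩
    a + (c + (b + d)) ≈⟨ +-assoc a c (b + d) ⟨
    (a + c) + (b + d) ∎

  ∑-+ : (xs : List B) (f g : B → Carrier) → (∑[ x ∈ xs ] (f x + g x)) ≈ ∑ xs f + ∑ xs g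
  ∑-+ []       f g = sym (+-identityˡ 0#)
  ∑-+ (x ∷ xs) f g = trans (+-congˡ (∑-+ xs f g)) (+-interchange _ _ _ _)

  ∑-*ˡ : ∀ c (xs : List B) (f : B → Carrier) → c * ∑ xs f ≈ (∑[ x ∈ xs ] c * f x)
  ∑-*ˡ c []       f = zeroʳ c
  ∑-*ˡ c (x ∷ xs) f = trans (distribˡ _ _ _) (+-congˡ (∑-*ˡ c xs f))

  ∑-*ʳ : ∀ c (xs : List B) (f : B → Carrier) → ∑ xs f * c ≈ (∑[ x ∈ xs ] f x * c)
  ∑-*ʳ c []       f = zeroˡ c
  ∑-*ʳ c (x ∷ xs) f = trans (distribʳ _ _ _) (+-congˡ (∑-*ʳ c xs f))

  ∑-swap : (xs : List B) (ys : List C) (f : B → C → Carrier) →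
           (∑[ x ∈ xs ] ∑[ y ∈ ys ] f x y) ≈ (∑[ y ∈ ys ] ∑[ x ∈ xs ] f x y)
  ∑-swap []       ys f = sym (∑-zero ys λ _ → ≈-refl)
  ∑-swap (x ∷ xs) ys f = trans (+-congˡ (∑-swap xs ys f)) (sym (∑-+ ys _ _))

  ∑-++ : (xs ys : List B) (f : B → Carrier) → ∑ (xs ++ ys) f ≈ ∑ xs f + ∑ ys f
  ∑-++ []       ys f = sym (+-identityˡ _)
  ∑-++ (x ∷ xs) ys f = trans (+-congˡ (∑-++ xs ys f)) (sym (+-assoc _ _ _))

  ∑-map : (h : B → C) (xs : List B) (f : C → Carrier) → ∑ (map h xs) f ≈ ∑ xs (f ∘ h)
  ∑-map h []       f = ≈-refl
  ∑-map h (x ∷ xs) f = +-congˡ (∑-map h xs f)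

  ∑-cartesianProductWith : {D : Set} (h : B → C → D) (xs : List B) (ys : List C) (f : D → Carrier) →
    ∑ (cartesianProductWith h xs ys) f ≈ (∑[ x ∈ xs ] ∑[ y ∈ ys ] f (h x y))
  ∑-cartesianProductWith h []       ys f = ≈-refl
  ∑-cartesianProductWith h (x ∷ xs) ys f =
    trans (∑-++ (map (h x) ys) _ f) (+-cong (∑-map (h x) ys f) (∑-cartesianProductWith h xs ys f))

  guard-cong : (p : Dec P) (q : Dec Q) {x y : Carrier} →
               (P → Q) → (Q → P) → (P → x ≈ y) → guard p x ≈ guard q y
  guard-cong (yes p) (yes q) f g eq = eq p
  guard-cong (yes p) (no ¬q) f g eq = ⊥-elim (¬q (f p))
  guard-cong (no ¬p) (yes q) f g eq = ⊥-elim (¬p (g q))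
  guard-cong (no ¬p) (no ¬q) f g eq = ≈-refl

  guard-congʳ : (p : Dec P) {x y : Carrier} → (P → x ≈ y) → guard p x ≈ guard p y
  guard-congʳ p = guard-cong p p id id

  guard-yes : (p : Dec P) {x : Carrier} → P → guard p x ≈ x
  guard-yes (yes _) p = ≈-refl
  guard-yes (no ¬p) p = ⊥-elim (¬p p)

  guard-no : (p : Dec P) {x : Carrier} → ¬ P → guard p x ≈ 0#
  guard-no (yes p) ¬p = ⊥-elim (¬p p)
  guard-no (no _)  ¬p = ≈-refl

  guard-0 : (p : Dec P) → guard p 0# ≈ 0#
  guard-0 (yes _) = ≈-refl
  guard-0 (no _)  = ≈-refl

  guard-+ : (p : Dec P) (x y : Carrier) → guard p (x + y) ≈ guard p x + guard p y
  guard-+ (yes _) x y = ≈-refl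
  guard-+ (no _)  x y = sym (+-identityˡ 0#)

  guard-× : (p : Dec P) (q : Dec Q) (x : Carrier) → guard p (guard q x) ≈ guard (p ×-dec q) x
  guard-× (yes _) (yes _) x = ≈-refl
  guard-× (yes _) (no _)  x = ≈-refl
  guard-× (no _)  (yes _) x = ≈-refl
  guard-× (no _)  (no _)  x = ≈-refl

  guard-swap : (p : Dec P) (q : Dec Q) (x : Carrier) → guard p (guard q x) ≈ guard q (guard p x)
  guard-swap (yes _) q       x = ≈-refl
  guard-swap (no _)  (yes _) x = ≈-refl
  guard-swap (no _)  (no _)  x = ≈-refl

  guard-*ˡ : (p : Dec P) (c x : Carrier) → c * guard p x ≈ guard p (c * x)
  guard-*ˡ (yes _) c x = ≈-refl
  guard-*ˡ (no _)  c x = zeroʳ c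

  guard-*ʳ : (p : Dec P) (c x : Carrier) → guard p x * c ≈ guard p (x * c)
  guard-*ʳ (yes _) c x = ≈-refl
  guard-*ʳ (no _)  c x = zeroˡ c

  guard-* : (p : Dec P) (q : Dec Q) (x y : Carrier) →
            guard p x * guard q y ≈ guard (p ×-dec q) (x * y)
  guard-* p q x y =
    trans (guard-*ʳ p _ x) (trans (guard-congʳ p λ _ → guard-*ˡ q x y) (guard-× p q _))

  guard-∑ : (p : Dec P) (xs : List B) (f : B → Carrier) →
            guard p (∑ xs f) ≈ (∑[ x ∈ xs ] guard p (f x))
  guard-∑ (yes _) xs f = ≈-refl
  guard-∑ (no _)  xs f = sym (∑-zero xs {λ _ → 0#} λ _ → ≈-refl)

  guard-split : (p : Dec P) (x : Carrier) → x ≈ guard p x + guard (¬? p) x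
  guard-split (yes _) x = sym (+-identityʳ x)
  guard-split (no _)  x = sym (+-identityˡ x)

  ∑-filter : {T : B → Set} (T? : Decidable T) (xs : List B) (f : B → Carrier) →
             ∑ (filter T? xs) f ≈ (∑[ x ∈ xs ] guard (T? x) (f x))
  ∑-filter T? []       f = ≈-refl
  ∑-filter T? (x ∷ xs) f with T? x
  ... | yes _ = +-congˡ (∑-filter T? xs f)
  ... | no  _ = trans (∑-filter T? xs f) (sym (+-identityˡ _))

  ∑-indices-suc : ∀ b (f : ℕ → Carrier) → ∑ (indices (suc b)) f ≈ f 0 + (∑[ r ∈ indices b ] f (suc r))
  ∑-indices-suc b f = +-congˡ (∑-map suc (indices b) f)

  -- A property that never returns once it is lost either survives up to b or is lost at exactly one
  -- step. This turns the choice of a first flaw into a sum over its row.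
  telescope : {T : ℕ → Set} (T? : Decidable T) → (∀ r → T (suc r) → T r) → ∀ b x →
    guard (T? 0) x ≈ guard (T? b) x + (∑[ r ∈ indices b ] guard (T? r ×-dec ¬? (T? (suc r))) x)
  telescope T? mono zero    x = sym (+-identityʳ _)
  telescope T? mono (suc b) x = begin
    guard (T? 0) x
      ≈⟨ guard-split (T? 1) _ ⟩
    guard (T? 1) (guard (T? 0) x) + guard (¬? (T? 1)) (guard (T? 0) x)
      ≈⟨ +-cong (guard-× (T? 1) (T? 0) x) (trans (guard-swap (¬? (T? 1)) (T? 0) x) (guard-× (T? 0) (¬? (T? 1)) x)) ⟩
    guard (T? 1 ×-dec T? 0) x + first
      ≈⟨ +-congʳ (guard-cong (T? 1 ×-dec T? 0) (T? 1) proj₁ (λ t → t , mono 0 t) (λ _ → ≈-refl)) ⟩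
    guard (T? 1) x + first
      ≈⟨ +-congʳ (telescope (λ r → T? (suc r)) (λ r → mono (suc r)) b x) ⟩
    (guard (T? (suc b)) x + rest) + first
      ≈⟨ trans (+-assoc _ _ _) (+-congˡ (+-comm _ _)) ⟩
    guard (T? (suc b)) x + (first + rest)
      ≈⟨ +-congˡ (∑-indices-suc b _) ⟨
    guard (T? (suc b)) x + (∑[ r ∈ indices (suc b) ] guard (T? r ×-dec ¬? (T? (suc r))) x) ∎
    where
    first rest : Carrier
    first = guard (T? 0 ×-dec ¬? (T? 1)) x
    rest  = ∑[ r ∈ indices b ] guard (T? (suc r) ×-dec ¬? (T? (suc (suc r)))) x

  ∑-words-suc : (S : List B) (k : ℕ) (f : List B → Carrier) →
                ∑ (words S (suc k)) f ≈ (∑[ x ∈ S ] ∑[ w ∈ words S k ] f (x ∷ w))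
  ∑-words-suc S k f = ∑-cartesianProductWith _∷_ S (words S k) f

  ∑-words-cong : (S : List B) (k : ℕ) {f g : List B → Carrier} →
                 (∀ w → length w ≡ k → f w ≈ g w) → ∑ (words S k) f ≈ ∑ (words S k) g
  ∑-words-cong S zero    eq = +-congʳ (eq [] refl)
  ∑-words-cong S (suc k) {f} {g} eq = begin
    ∑ (words S (suc k)) f                  ≈⟨ ∑-words-suc S k f ⟩
    (∑[ x ∈ S ] ∑[ w ∈ words S k ] f (x ∷ w)) ≈⟨ ∑-cong S (λ x → ∑-words-cong S k λ w l → eq (x ∷ w) (cong suc l)) ⟩
    (∑[ x ∈ S ] ∑[ w ∈ words S k ] g (x ∷ w)) ≈⟨ ∑-words-suc S k g ⟨
    ∑ (words S (suc k)) g                  ∎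

  -- Words over different sub-posets of S become comparable once all of them are summed over the
  -- words of S.
  ∑-words-filter : {T : B → Set} (T? : Decidable T) (S : List B) (k : ℕ) (f : List B → Carrier) →
                   ∑ (words (filter T? S) k) f ≈ (∑[ w ∈ words S k ] guard (All.all? T? w) (f w))
  ∑-words-filter T? S zero    f = ≈-refl
  ∑-words-filter T? S (suc k) f = begin
    ∑ (words (filter T? S) (suc k)) f
      ≈⟨ ∑-words-suc (filter T? S) k f ⟩
    (∑[ x ∈ filter T? S ] ∑[ w ∈ words (filter T? S) k ] f (x ∷ w))
      ≈⟨ ∑-filter T? S _ ⟩
    (∑[ x ∈ S ] guard (T? x) (∑[ w ∈ words (filter T? S) k ] f (x ∷ w)))
      ≈⟨ ∑-cong S (λ x → guard-congʳ (T? x) λ _ → ∑-words-filter T? S k _) ⟩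
    (∑[ x ∈ S ] guard (T? x) (∑[ w ∈ words S k ] guard (All.all? T? w) (f (x ∷ w))))
      ≈⟨ ∑-cong S (λ x → trans (guard-∑ (T? x) (words S k) _) (∑-cong (words S k) λ w →
           trans (guard-× (T? x) (All.all? T? w) _)
                 (guard-cong (T? x ×-dec All.all? T? w) (All.all? T? (x ∷ w)) (λ (p , q) → p ∷ q) All.uncons
                     (λ _ → ≈-refl)))) ⟩
    (∑[ x ∈ S ] ∑[ w ∈ words S k ] guard (All.all? T? (x ∷ w)) (f (x ∷ w)))
      ≈⟨ ∑-words-suc S k _ ⟨
    (∑[ w ∈ words S (suc k) ] guard (All.all? T? w) (f w)) ∎

  ∑-words-snoc : (S : List B) (k : ℕ) (f : List B → Carrier) →
                 ∑ (words S (suc k)) f ≈ (∑[ x ∈ S ] ∑[ w ∈ words S k ] f (w ∷ʳ x))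
  ∑-words-snoc S zero    f = ∑-words-suc S 0 f
  ∑-words-snoc S (suc k) f = begin
    ∑ (words S (suc (suc k))) f
      ≈⟨ ∑-words-suc S (suc k) f ⟩
    (∑[ x ∈ S ] ∑[ w ∈ words S (suc k) ] f (x ∷ w))
      ≈⟨ ∑-cong S (λ x → ∑-words-snoc S k λ w → f (x ∷ w)) ⟩
    (∑[ x ∈ S ] ∑[ y ∈ S ] ∑[ w ∈ words S k ] f (x ∷ w ∷ʳ y))
      ≈⟨ ∑-swap S S _ ⟩
    (∑[ y ∈ S ] ∑[ x ∈ S ] ∑[ w ∈ words S k ] f (x ∷ w ∷ʳ y))
      ≈⟨ ∑-cong S (λ y → ∑-words-suc S k (λ w → f (w ∷ʳ y))) ⟨
    (∑[ y ∈ S ] ∑[ w ∈ words S (suc k) ] f (w ∷ʳ y)) ∎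

  ∑-words-reverse : (S : List B) (k : ℕ) (f : List B → Carrier) →
                    ∑ (words S k) f ≈ (∑[ w ∈ words S k ] f (reverse w))
  ∑-words-reverse S zero    f = ≈-refl
  ∑-words-reverse S (suc k) f = begin
    ∑ (words S (suc k)) f
      ≈⟨ ∑-words-snoc S k f ⟩
    (∑[ x ∈ S ] ∑[ w ∈ words S k ] f (w ∷ʳ x))
      ≈⟨ ∑-cong S (λ x → ∑-words-reverse S k λ w → f (w ∷ʳ x)) ⟩
    (∑[ x ∈ S ] ∑[ w ∈ words S k ] f (reverse w ∷ʳ x))
      ≈⟨ ∑-cong S (λ x → ∑-cong (words S k) λ w → reflexive (cong f (≡.sym (List.unfold-reverse x w)))) ⟩
    (∑[ x ∈ S ] ∑[ w ∈ words S k ] f (reverse (x ∷ w)))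
      ≈⟨ ∑-words-suc S k (f ∘ reverse) ⟨
    (∑[ w ∈ words S (suc k) ] f (reverse w)) ∎

-- The plactic relations in an abstract ring, and their opposite.

record PlacticAlgebra : Set₁ where
  infix 4 _<_ _<?_
  field
    A        : Set
    _<_      : A → A → Set
    _<?_     : ∀ x y → Dec (x < y)
    <-irrefl : ∀ {x} → ¬ (x < x)
    <-trans  : ∀ {x y z} → x < y → y < z → x < z
    -- (3+1)-freeness in the form in which it is applied: no element avoids being below the top and
    -- above the bottom of a three-element chain at the same time.
    free     : ∀ {x y z} w → x < y → y < z → (w < z) ⊎ (x < w)
    R        : Ring 0ℓ 0ℓ
  open Ring R using (Carrier; _*_; _≈_)
  field
    u    : A → Carrier
    rel₁ : ∀ {a b c} → a < b → ¬ (c < b) → a < c → u b * u a * u c ≈ u b * u c * u a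
    rel₂ : ∀ {a b c} → ¬ (b < a) → b < c → a < c → u c * u a * u b ≈ u a * u c * u b
    rel₃ : ∀ {a b c} → ¬ (a < b) → ¬ (b < a) → ¬ (b < c) → ¬ (c < b) → a < c →
           u c * u a * u b ≈ u b * u c * u a

-- Reversing the order and the multiplication exchanges the first two relations
-- and preserves the third.
op : PlacticAlgebra → PlacticAlgebra
op P = record
  { A = A ; _<_ = flip _<_ ; _<?_ = flip _<?_ ; <-irrefl = <-irrefl ; <-trans = flip <-trans
  ; free = λ w x<y y<z → Sum.swap (free w y<z x<y)
  ; R = record { isRing = record
      { +-isAbelianGroup = +-isAbelianGroup
      ; *-cong = flip *-cong
      ; *-assoc = λ x y z → sym (*-assoc z y x)
      ; *-identity = *-identityʳ , *-identityˡ
      ; distrib = distribʳ , distribˡ } }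
  ; u = u
  ; rel₁ = λ a>b c≯b a>c → trans (sym (*-assoc _ _ _)) (trans (sym (rel₂ c≯b a>b a>c)) (*-assoc _ _ _))
  ; rel₂ = λ b≯a b>c a>c → trans (sym (*-assoc _ _ _)) (trans (sym (rel₁ b>c b≯a a>c)) (*-assoc _ _ _))
  ; rel₃ = λ a≯b b≯a b≯c c≯b a>c → trans (sym (*-assoc _ _ _))
      (trans (sym (rel₃ b≯c c≯b a≯b b≯a a>c)) (*-assoc _ _ _))
  }
  where
  open PlacticAlgebra P
  open Ring R

-- Subtraction by recursion, so that dropping the first row is definitional.
infixl 6 _⊝_
_⊝_ : ℤ → ℕ → ℤ
z ⊝ zero  = z
z ⊝ suc r = ℤ.pred z ⊝ r

⊝-⊝ : ∀ z r s → z ⊝ r ⊝ s ≡ z ⊝ (r ℕ.+ s)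
⊝-⊝ z zero    s = refl
⊝-⊝ z (suc r) s = ⊝-⊝ (ℤ.pred z) r s

-- Columns, Knuth moves between columns, and cutting a pair at its first flaw.

module Columns (P : PlacticAlgebra) where
  open PlacticAlgebra P public
  open Ring R public hiding (zero) renaming (refl to ≈-refl)
  open Sums R public
  open import Relation.Binary.Reasoning.Setoid setoid

  <-asym : ∀ {x y} → x < y → ¬ (y < x)
  <-asym p q = <-irrefl (<-trans p q)

  -- Columns are listed from top to bottom, that is increasingly, and read from
  -- bottom to top.
  col : List A → Carrier
  col []      = 1#
  col (a ∷ X) = col X * u a

  col-++ : ∀ X Y → col (X ++ Y) ≈ col Y * col X
  col-++ []      Y = sym (*-identityʳ _)
  col-++ (a ∷ X) Y = trans (*-congʳ (col-++ X Y)) (*-assoc _ _ _)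

  Chain : List A → Set
  Chain = AllPairs _<_

  chain? : Decidable Chain
  chain? = allPairs? _<?_

  Above : List A → A → Set
  Above N x = All (_< x) N

  above? : ∀ N → Decidable (Above N)
  above? N x = All.all? (_<? x) N

  infix 4 _≪_ _◁_ _◁?_

  _≪_ : List A → List A → Set
  N ≪ X = All (Above N) X

  ≪-swap : ∀ {N X} → N ≪ X → All (λ n → All (n <_) X) N
  ≪-swap []       = All.universal (λ _ → []) _
  ≪-swap (p ∷ ps) = All.zipWith (λ (q , qs) → q ∷ qs) (p , ≪-swap ps)

  _◁_ : A → List A → Set
  a ◁ []      = ⊤
  a ◁ (x ∷ _) = a < x

  _◁?_ : ∀ a X → Dec (a ◁ X)
  a ◁? []      = yes tt
  a ◁? (x ∷ _) = a <? x

  ◁⇒All : ∀ {a X} → Chain X → a ◁ X → All (a <_) X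
  ◁⇒All []       p = []
  ◁⇒All (x< ∷ c) p = p ∷ All.map (<-trans p) x<

  All⇒◁ : ∀ {a X} → All (a <_) X → a ◁ X
  All⇒◁ []      = tt
  All⇒◁ (p ∷ _) = p

  chain-++⁺ : ∀ {X Y} → Chain X → Chain Y → X ≪ Y → Chain (X ++ Y)
  chain-++⁺ cX cY p = AllPairs.++⁺ cX cY (≪-swap p)

  chain-++⁻ : ∀ X {Y} → Chain (X ++ Y) → Chain X × Chain Y × X ≪ Y
  chain-++⁻ []      c       = [] , c , All.universal (λ _ → []) _
  chain-++⁻ (x ∷ X) (p ∷ c) with chain-++⁻ X c
  ... | cX , cY , l = All.++⁻ˡ X p ∷ cX , cY , All.zipWith (λ (q , qs) → q ∷ qs) (All.++⁻ʳ X p , l)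

  -- Each step needs a smaller letter to the right as a catalyst for `rel₂`. While a passes D,
  -- starting with the largest entry, the catalyst is the next smaller entry of D, and for the last
  -- step it is b.
  commute-chain : ∀ {a b} D → ¬ (b < a) → Chain (b ∷ D) → a ◁ D →
                  u a * col D * u b ≈ col D * u a * u b
  commute-chain []      b≮a c a◁D = *-congʳ (trans (*-identityʳ _) (sym (*-identityˡ _)))
  commute-chain {a} {b} (y ∷ D) b≮a ((b<y ∷ _) ∷ (y<D ∷ c)) a<y = begin
    u a * (col D * u y) * u b ≈⟨ *-congʳ (*-assoc _ _ _) ⟨
    u a * col D * u y * u b   ≈⟨ *-congʳ
        (commute-chain D (<-asym a<y) (y<D ∷ c) (All⇒◁ (All.map (<-trans a<y) y<D))) ⟩
    col D * u a * u y * u b   ≈⟨ assoc₄ _ _ _ _ ⟩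
    col D * (u a * u y * u b) ≈⟨ *-congˡ (rel₂ b≮a b<y a<y) ⟨
    col D * (u y * u a * u b) ≈⟨ assoc₄ _ _ _ _ ⟨
    col D * u y * u a * u b   ∎
    where
    assoc₄ : ∀ w x y z → w * x * y * z ≈ w * (x * y * z)
    assoc₄ w x y z = solve *-monoid

  -- Here a is incomparable to both b and y, so the last step is `rel₃`, which carries a past b as
  -- well. Beyond y the previous lemma applies: a lies below all entries of D by (3+1)-freeness,
  -- since b < y < d and b is not below a.
  commute-chain′ : ∀ {a b y} D → ¬ (b < a) → Chain (b ∷ y ∷ D) → ¬ (a < y) →
                   u a * col (y ∷ D) * u b ≈ col (y ∷ D) * u b * u a
  commute-chain′ {a} {b} {y} D b≮a ((b<y ∷ _) ∷ (y<D ∷ c)) a≮y = begin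
    u a * (col D * u y) * u b ≈⟨ *-congʳ (*-assoc _ _ _) ⟨
    u a * col D * u y * u b   ≈⟨ *-congʳ (commute-chain D y≮a (y<D ∷ c) a◁D) ⟩
    col D * u a * u y * u b   ≈⟨ assoc₄ _ _ _ _ ⟩
    col D * (u a * u y * u b) ≈⟨ *-congˡ (rel₃ b≮a a≮b a≮y y≮a b<y) ⟨
    col D * (u y * u b * u a) ≈⟨ assoc₄ _ _ _ _ ⟨
    col D * u y * u b * u a   ∎
    where
    assoc₄ : ∀ w x y z → w * x * y * z ≈ w * (x * y * z)
    assoc₄ w x y z = solve *-monoid
    y≮a : ¬ (y < a)
    y≮a y<a = b≮a (<-trans b<y y<a)
    a≮b : ¬ (a < b)
    a≮b a<b = a≮y (<-trans a<b b<y)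
    a◁D : a ◁ D
    a◁D = All⇒◁ (All.map (λ y<d → [ ⊥-elim ∘ b≮a , id ]′ (Sum.swap (free a b<y y<d))) y<D)

  -- The common weakening of `Facing` and `Weak` that suffices for moving a column; the right column
  -- may be longer.
  Beside : List A → List A → Set
  Beside []      N       = ⊤
  Beside (a ∷ M) []      = ⊥
  Beside (a ∷ M) (b ∷ N) = ¬ (b < a) × Beside M N

  -- The top entry a of M jumps over Y and N together, which form the single chain N ++ Y above the
  -- top entry b of N. The rest of M passes Y by induction, and a then jumps back over N alone.
  commute-columns : ∀ M {N} Y → Beside M N → Chain N → Chain Y → M ≪ Y → N ≪ Y →
                    col M * col Y * col N ≈ col Y * col M * col N
  commute-columns []      Y _ cN cY M≪Y N≪Y = *-congʳ (trans (*-identityˡ _) (sym (*-identityʳ _)))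
  commute-columns (a ∷ M) {b ∷ N} Y (b≮a , l) cN cY M≪Y N≪Y =
    push N (AllPairs.tail cN) l (All.map All.tail M≪Y) (All.map All.tail N≪Y)
         (All⇒◁ (All.map All.head M≪Y)) cN (chain-++⁺ cN cY N≪Y)
    where
    regroup : ∀ m a y n b → m * a * y * (n * b) ≈ m * (a * (y * n) * b)
    regroup m a y n b = solve *-monoid

    -- z records the order in which a and b leave the jump. It is the same for N ++ Y and for N,
    -- because it only depends on whether a lies below the first entry above b in that chain; so the
    -- second jump undoes the first.
    insert : ∀ N z → Beside M N → Chain N → M ≪ Y → N ≪ Y →
             u a * col (N ++ Y) * u b ≈ col (N ++ Y) * z →
             u a * col N * u b ≈ col N * z →
             col M * u a * col Y * (col N * u b) ≈ col Y * (col M * u a) * (col N * u b)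
    insert N z l cN M≪Y N≪Y past-NY past-N = begin
      col M * u a * col Y * (col N * u b)   ≈⟨ regroup _ _ _ _ _ ⟩
      col M * (u a * (col Y * col N) * u b) ≈⟨ *-congˡ (*-congʳ (*-congˡ (col-++ N Y))) ⟨
      col M * (u a * col (N ++ Y) * u b)    ≈⟨ *-congˡ (trans past-NY (*-congʳ (col-++ N Y))) ⟩
      col M * (col Y * col N * z)           ≈⟨ solve *-monoid ⟩
      col M * col Y * col N * z             ≈⟨ *-congʳ (commute-columns M Y l cN cY M≪Y N≪Y) ⟩
      col Y * col M * col N * z             ≈⟨ *-assoc _ _ _ ⟩
      col Y * col M * (col N * z)           ≈⟨ *-congˡ past-N ⟨
      col Y * col M * (u a * col N * u b)   ≈⟨ solve *-monoid ⟩
      col Y * (col M * u a) * (col N * u b) ∎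

    push : ∀ N → Chain N → Beside M N → M ≪ Y → N ≪ Y → a ◁ Y → Chain (b ∷ N) → Chain (b ∷ N ++ Y) →
           col M * u a * col Y * (col N * u b) ≈ col Y * (col M * u a) * (col N * u b)
    push [] cN l M≪Y N≪Y a◁Y c cD =
      insert [] (u a * u b) l cN M≪Y N≪Y
        (trans (commute-chain Y b≮a cD a◁Y) (*-assoc _ _ _))
        (trans (commute-chain [] b≮a c tt) (*-assoc _ _ _))
    push (n ∷ N) cN l M≪Y N≪Y a◁Y c cD with a <? n
    ... | yes a<n = insert (n ∷ N) (u a * u b) l cN M≪Y N≪Y
        (trans (commute-chain (n ∷ N ++ Y) b≮a cD a<n) (*-assoc _ _ _))
        (trans (commute-chain (n ∷ N) b≮a c a<n) (*-assoc _ _ _))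
    ... | no  a≮n = insert (n ∷ N) (u b * u a) l cN M≪Y N≪Y
        (trans (commute-chain′ (N ++ Y) b≮a cD a≮n) (*-assoc _ _ _))
        (trans (commute-chain′ N b≮a c a≮n) (*-assoc _ _ _))

  -- The relation between the heads of a pair cut at a flaw: the surplus last entry of the right
  -- column is the flawed one, which no longer has a partner.
  Facing : List A → List A → Set
  Facing []      []          = ⊥
  Facing []      (b ∷ [])    = ⊤
  Facing []      (b ∷ _ ∷ _) = ⊥
  Facing (a ∷ M) []          = ⊥
  Facing (a ∷ M) (b ∷ N)     = ¬ (b < a) × Facing M N

  facing? : ∀ M N → Dec (Facing M N)
  facing? []      []          = no id
  facing? []      (b ∷ [])    = yes tt
  facing? []      (b ∷ _ ∷ _) = no id
  facing? (a ∷ M) []          = no id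
  facing? (a ∷ M) (b ∷ N)     = ¬? (b <? a) ×-dec facing? M N

  -- Each entry of C is compared with the entry of D one row further down; this is `Facing` upside
  -- down in the opposite algebra.
  Unlinked : List A → List A → Set
  Unlinked C []      = ⊥
  Unlinked C (d ∷ D) = Pointwise (λ c d → ¬ (c < d)) C D

  unlinked? : ∀ C D → Dec (Unlinked C D)
  unlinked? C []      = no id
  unlinked? C (d ∷ D) = Pointwise.decidable (λ c d → ¬? (c <? d)) C D

  -- A zigzag d₁ ∼ c₁ ∼ d₂ ∼ c₂ ∼ … ∼ dₖ₊₁ of incomparable neighbours.
  Path : List A → List A → Set
  Path C D = (Facing C D × Unlinked C D) × (Chain C × Chain D)

  path? : ∀ C D → Dec (Path C D)
  path? C D = (facing? C D ×-dec unlinked? C D) ×-dec (chain? C ×-dec chain? D)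

  -- The zigzag is dismantled from the top: d passes C with c as catalyst, the remaining zigzag
  -- commutes by induction, `rel₃` rearranges d, c, d₂, and c returns past D with d₂ as catalyst.
  -- That d lies below C and c below D comes from (3+1)-freeness and the incomparabilities in the
  -- zigzag.
  commute-path : ∀ C D → Path C D → col D * col C ≈ col C * col D
  commute-path []      (d ∷ [])      p = trans (*-identityʳ _) (sym (*-identityˡ _))
  commute-path (c ∷ C) (d ∷ d₂ ∷ D) (((d≮c , f) , (c≮d₂ ∷ l)) , (c<C ∷ cC) , ((d<d₂ ∷ d<D) ∷ d₂<D ∷ cD)) = begin
    col D * u d₂ * u d * (col C * u c)   ≈⟨ solve *-monoid ⟩
    col D * u d₂ * (u d * col C * u c)   ≈⟨ *-congˡ (commute-chain C c≮d (c<C ∷ cC) (d◁C f l d₂<D)) ⟩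
    col D * u d₂ * (col C * u d * u c)   ≈⟨ solve *-monoid ⟩
    col D * u d₂ * col C * u d * u c     ≈⟨ *-congʳ (*-congʳ (commute-path C (d₂ ∷ D) ((f , l) , cC , d₂<D ∷ cD))) ⟩
    col C * (col D * u d₂) * u d * u c   ≈⟨ regroup _ _ _ _ _ ⟩
    col C * (col D * (u d₂ * u d * u c)) ≈⟨ *-congˡ (*-congˡ (rel₃ d≮c c≮d c≮d₂ d₂≮c d<d₂)) ⟩
    col C * (col D * (u c * u d₂ * u d)) ≈⟨ regroup′ _ _ _ _ _ ⟩
    col C * (col D * u c * u d₂) * u d   ≈⟨ *-congʳ (*-congˡ (commute-chain D d₂≮c (d₂<D ∷ cD) c◁D)) ⟨
    col C * (u c * col D * u d₂) * u d   ≈⟨ regroup″ _ _ _ _ _ ⟩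
    col C * u c * (col D * u d₂ * u d)   ∎
    where
    regroup : ∀ a b c d e → a * (b * c) * d * e ≈ a * (b * (c * d * e))
    regroup a b c d e = solve *-monoid
    regroup′ : ∀ a b c d e → a * (b * (c * d * e)) ≈ a * (b * c * d) * e
    regroup′ a b c d e = solve *-monoid
    regroup″ : ∀ a b c d e → a * (b * c * d) * e ≈ a * b * (c * d * e)
    regroup″ a b c d e = solve *-monoid
    c≮d : ¬ (c < d)
    c≮d c<d = c≮d₂ (<-trans c<d d<d₂)
    d₂≮c : ¬ (d₂ < c)
    d₂≮c d₂<c = d≮c (<-trans d<d₂ d₂<c)
    d◁C : ∀ {C D} → Facing C (d₂ ∷ D) → Pointwise (λ c d → ¬ (c < d)) C D → All (d₂ <_) D → d ◁ C
    d◁C _ []      _          = tt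
    d◁C _ (n ∷ _) (d₂<d₃ ∷ _) = [ ⊥-elim ∘ n , id ]′ (free _ d<d₂ d₂<d₃)
    c◁D : c ◁ D
    c◁D = All⇒◁ (All.map (λ d₂<e → [ id , ⊥-elim ∘ d≮c ]′ (free c d<d₂ d₂<e)) d₂<D)

  -- An entry a of M faces b, and below b there is a further entry b₂ of N. From b < b₂ < x and b
  -- not below a, (3+1)-freeness gives a < x. Hence any tail that fits under N also fits under M.
  facing-≪ : ∀ M N {x} → Facing M N → Chain N → Above N x → Above M x
  facing-≪ []      N                _         cN              N<x = []
  facing-≪ (a ∷ [])    (b ∷ []) (_ , ())
  facing-≪ (a ∷ _ ∷ _) (b ∷ []) (_ , ())
  facing-≪ (a ∷ M) (b ∷ b₂ ∷ N) (b≮a , f) ((b<b₂ ∷ _) ∷ cN) (_ ∷ b₂<x ∷ N<x) =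
    [ id , ⊥-elim ∘ b≮a ]′ (free a b<b₂ b₂<x) ∷ facing-≪ M (b₂ ∷ N) f cN (b₂<x ∷ N<x)

  -- The tableau condition on the first r rows; an entry of B without a left
  -- neighbour violates it.
  Tab≤ : ℕ → List A → List A → Set
  Tab≤ zero    A       B       = ⊤
  Tab≤ (suc r) A       []      = ⊤
  Tab≤ (suc r) []      (b ∷ B) = ⊥
  Tab≤ (suc r) (a ∷ A) (b ∷ B) = ¬ (b < a) × Tab≤ r A B

  tab≤? : ∀ r A B → Dec (Tab≤ r A B)
  tab≤? zero    A       B       = yes tt
  tab≤? (suc r) A       []      = yes tt
  tab≤? (suc r) []      (b ∷ B) = no id
  tab≤? (suc r) (a ∷ A) (b ∷ B) = ¬? (b <? a) ×-dec tab≤? r A B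

  tab≤-pred : ∀ r A B → Tab≤ (suc r) A B → Tab≤ r A B
  tab≤-pred zero    A       B       _       = tt
  tab≤-pred (suc r) A       []      _       = tt
  tab≤-pred (suc r) (a ∷ A) (b ∷ B) (n , t) = n , tab≤-pred r A B t

  Flawed : ℕ → List A → List A → Set
  Flawed r A B = Tab≤ r A B × ¬ Tab≤ (suc r) A B

  flawed? : ∀ r A B → Dec (Flawed r A B)
  flawed? r A B = tab≤? r A B ×-dec ¬? (tab≤? (suc r) A B)

  -- N ends in the first flawed row of the columns M ++ X and N ++ Y, M just above it.
  FlawAt : List A → List A → List A → Set
  FlawAt []      []          X = ⊥
  FlawAt []      (b ∷ [])    X = b ◁ X
  FlawAt []      (b ∷ _ ∷ _) X = ⊥
  FlawAt (a ∷ M) []          X = ⊥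
  FlawAt (a ∷ M) (b ∷ N)     X = ¬ (b < a) × FlawAt M N X

  flawAt? : ∀ M N X → Dec (FlawAt M N X)
  flawAt? []      []          X = no id
  flawAt? []      (b ∷ [])    X = b ◁? X
  flawAt? []      (b ∷ _ ∷ _) X = no id
  flawAt? (a ∷ M) []          X = no id
  flawAt? (a ∷ M) (b ∷ N)     X = ¬? (b <? a) ×-dec flawAt? M N X

  flawed-first : ∀ A b Y → Flawed 0 A (b ∷ Y) → b ◁ A
  flawed-first []      b Y _       = tt
  flawed-first (a ∷ A) b Y (_ , t) with b <? a
  ... | yes b<a = b<a
  ... | no  b≮a = ⊥-elim (t (b≮a , tt))

  first-flawed : ∀ A b Y → b ◁ A → Flawed 0 A (b ∷ Y)
  first-flawed []      b Y _   = tt , id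
  first-flawed (a ∷ A) b Y b<a = tt , λ (b≮a , _) → b≮a b<a

  -- Heights are integers for two reasons: indices of the elementary sums may be negative in the
  -- determinant, and a column too short to be cut in a given row must contribute nothing instead of
  -- leaving an empty tail.
  wordsℤ : List A → ℤ → List (List A)
  wordsℤ S (+ k)    = words S k
  wordsℤ S -[1+ _ ] = []

  ∑-wordsℤ-negative : ∀ S n r (f : List A → Carrier) → ∑ (wordsℤ S (-[1+ n ] ⊝ r)) f ≈ 0#
  ∑-wordsℤ-negative S n zero    f = ≈-refl
  ∑-wordsℤ-negative S n (suc r) f = ∑-wordsℤ-negative S (suc n) r f

  ∑-words-suc₂ : ∀ S m n (f : List A → List A → Carrier) →
    (∑[ X ∈ words S (suc m) ] ∑[ Y ∈ words S (suc n) ] f X Y) ≈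
    (∑[ x ∈ S ] ∑[ y ∈ S ] ∑[ X ∈ words S m ] ∑[ Y ∈ words S n ] f (x ∷ X) (y ∷ Y))
  ∑-words-suc₂ S m n f = begin
    (∑[ X ∈ words S (suc m) ] ∑[ Y ∈ words S (suc n) ] f X Y)
      ≈⟨ ∑-words-suc S m _ ⟩
    (∑[ x ∈ S ] ∑[ X ∈ words S m ] ∑[ Y ∈ words S (suc n) ] f (x ∷ X) Y)
      ≈⟨ ∑-cong S (λ x → trans (∑-cong (words S m) λ X → ∑-words-suc S n _) (∑-swap (words S m) S _)) ⟩
    (∑[ x ∈ S ] ∑[ y ∈ S ] ∑[ X ∈ words S m ] ∑[ Y ∈ words S n ] f (x ∷ X) (y ∷ Y)) ∎

  module _ (S : List A) where
    -- If A has fewer than r entries, or B at most r, then agreement in r rows implies agreement in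
    -- the next one, so there is no flaw to count. On the right-hand side the same pairs are
    -- excluded by a negative tail height.
    ∑-cut : ∀ r p q (g : List A → List A → Carrier) →
      (∑[ A ∈ wordsℤ S p ] ∑[ B ∈ wordsℤ S q ] guard (flawed? r A B) (g A B)) ≈
      (∑[ M ∈ words S r ] ∑[ N ∈ words S (suc r) ] ∑[ X ∈ wordsℤ S (p ⊝ r) ] ∑[ Y ∈ wordsℤ S (q ⊝ suc r) ]
        guard (flawAt? M N X) (g (M ++ X) (N ++ Y)))
    ∑-cut r       -[1+ m ] q        g =
      sym (∑-zero (words S r) λ M → ∑-zero (words S (suc r)) λ N → ∑-wordsℤ-negative S m r _)
    ∑-cut r p -[1+ n ] g =
      trans (∑-zero (wordsℤ S p) λ _ → ≈-refl)
      (sym (∑-zero (words S r) λ M → ∑-zero (words S (suc r)) λ N → ∑-zero (wordsℤ S (p ⊝ r)) λ X →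
          ∑-wordsℤ-negative S n (suc r) _))
    ∑-cut r p (+ zero) g =
      trans (∑-zero (wordsℤ S p) λ A → trans (+-identityʳ _) (guard-no (flawed? r A []) λ (_ , t) → t tt))
      (sym (∑-zero (words S r) λ M → ∑-zero (words S (suc r)) λ N → ∑-zero (wordsℤ S (p ⊝ r)) λ X →
          ∑-wordsℤ-negative S 0 r _))
    ∑-cut zero    p (+ suc n) g = begin
      (∑[ A ∈ wordsℤ S p ] ∑[ B ∈ words S (suc n) ] guard (flawed? 0 A B) (g A B))
        ≈⟨ ∑-cong (wordsℤ S p) (λ A → ∑-words-suc S n _) ⟩
      (∑[ A ∈ wordsℤ S p ] ∑[ b ∈ S ] ∑[ B ∈ words S n ] guard (flawed? 0 A (b ∷ B)) (g A (b ∷ B)))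
        ≈⟨ ∑-swap (wordsℤ S p) S _ ⟩
      (∑[ b ∈ S ] ∑[ A ∈ wordsℤ S p ] ∑[ B ∈ words S n ] guard (flawed? 0 A (b ∷ B)) (g A (b ∷ B)))
        ≈⟨ ∑-cong S (λ b → ∑-cong (wordsℤ S p) λ A → ∑-cong (words S n) λ B →
             guard-cong (flawed? 0 A (b ∷ B)) (b ◁? A) (flawed-first A b B) (first-flawed A b B) (λ _ → ≈-refl)) ⟩
      (∑[ b ∈ S ] ∑[ A ∈ wordsℤ S p ] ∑[ B ∈ words S n ] guard (b ◁? A) (g A (b ∷ B)))
        ≈⟨ ∑-cong S (λ b → +-identityʳ _) ⟨
      (∑[ b ∈ S ] ∑[ w ∈ words S 0 ] ∑[ A ∈ wordsℤ S p ] ∑[ B ∈ words S n ] guard (flawAt? [] (b ∷ w) A)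
          (g A (b ∷ w ++ B)))
        ≈⟨ ∑-words-suc S 0 _ ⟨
      (∑[ N ∈ words S 1 ] ∑[ A ∈ wordsℤ S p ] ∑[ B ∈ words S n ] guard (flawAt? [] N A) (g A (N ++ B)))
        ≈⟨ +-identityʳ _ ⟨
      (∑[ M ∈ words S 0 ] ∑[ N ∈ words S 1 ] ∑[ A ∈ wordsℤ S p ] ∑[ B ∈ words S n ] guard (flawAt? M N A)
          (g (M ++ A) (N ++ B))) ∎
    ∑-cut (suc r) (+ zero) (+ suc n) g =
      trans (trans (+-identityʳ _) (trans (∑-words-suc S n (λ B → guard (flawed? (suc r) [] B) (g [] B)))
          (∑-zero S λ b → ∑-zero (words S n) λ B →
        guard-no (flawed? (suc r) [] (b ∷ B)) {g [] (b ∷ B)} proj₁)))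
      (sym (∑-zero (words S (suc r)) λ M → ∑-zero (words S (suc (suc r))) λ N → ∑-wordsℤ-negative S 0 r _))
    ∑-cut (suc r) (+ suc m) (+ suc n) g = begin
      (∑[ A ∈ words S (suc m) ] ∑[ B ∈ words S (suc n) ] guard (flawed? (suc r) A B) (g A B))
        ≈⟨ ∑-words-suc₂ S m n _ ⟩
      (∑[ a ∈ S ] ∑[ b ∈ S ] ∑[ A ∈ words S m ] ∑[ B ∈ words S n ] guard (flawed? (suc r) (a ∷ A) (b ∷ B))
          (g (a ∷ A) (b ∷ B)))
        ≈⟨ ∑-cong S (λ a → ∑-cong S λ b → step a b) ⟩
      (∑[ a ∈ S ] ∑[ b ∈ S ] ∑[ M ∈ words S r ] ∑[ N ∈ words S (suc r) ] summand (a ∷ M) (b ∷ N))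
        ≈⟨ ∑-words-suc₂ S r (suc r) summand ⟨
      (∑[ M ∈ words S (suc r) ] ∑[ N ∈ words S (suc (suc r)) ] summand M N) ∎
      where
      summand : List A → List A → Carrier
      summand M N = ∑[ X ∈ wordsℤ S (+ m ⊝ r) ] ∑[ Y ∈ wordsℤ S (+ n ⊝ suc r) ]
                      guard (flawAt? M N X) (g (M ++ X) (N ++ Y))
      step : ∀ a b →
        (∑[ A ∈ words S m ] ∑[ B ∈ words S n ] guard (flawed? (suc r) (a ∷ A) (b ∷ B)) (g (a ∷ A) (b ∷ B))) ≈
        (∑[ M ∈ words S r ] ∑[ N ∈ words S (suc r) ] summand (a ∷ M) (b ∷ N))
      step a b = begin
        (∑[ A ∈ words S m ] ∑[ B ∈ words S n ] guard (flawed? (suc r) (a ∷ A) (b ∷ B)) (g (a ∷ A) (b ∷ B)))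
          ≈⟨ ∑-cong (words S m) (λ A → ∑-cong (words S n) λ B → trans
               (guard-cong (flawed? (suc r) (a ∷ A) (b ∷ B)) (flawed? r A B ×-dec ¬? (b <? a))
                 (λ ((n , t) , t′) → (t , λ t″ → t′ (n , t″)) , n)
                 (λ ((t , t′) , n) → (n , t) , λ (_ , t″) → t′ t″) (λ _ → ≈-refl))
               (sym (guard-× (flawed? r A B) (¬? (b <? a)) _))) ⟩
        (∑[ A ∈ words S m ] ∑[ B ∈ words S n ] guard (flawed? r A B) (guard (¬? (b <? a)) (g (a ∷ A) (b ∷ B))))
          ≈⟨ ∑-cut r (+ m) (+ n) (λ A B → guard (¬? (b <? a)) (g (a ∷ A) (b ∷ B))) ⟩
        (∑[ M ∈ words S r ] ∑[ N ∈ words S (suc r) ] ∑[ X ∈ wordsℤ S (+ m ⊝ r) ] ∑[ Y ∈ wordsℤ S (+ n ⊝ suc r) ]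
          guard (flawAt? M N X) (guard (¬? (b <? a)) (g (a ∷ M ++ X) (b ∷ N ++ Y))))
          ≈⟨ ∑-cong (words S r) (λ M → ∑-cong (words S (suc r)) λ N → ∑-cong (wordsℤ S (+ m ⊝ r)) λ X →
               ∑-cong (wordsℤ S (+ n ⊝ suc r)) λ Y →
               trans (guard-swap (flawAt? M N X) (¬? (b <? a)) _) (guard-× (¬? (b <? a)) (flawAt? M N X) _)) ⟩
        (∑[ M ∈ words S r ] ∑[ N ∈ words S (suc r) ] summand (a ∷ M) (b ∷ N)) ∎

-- The expansion of a product of two elementary sums at the first flaw.

module Decomposition (P : PlacticAlgebra) where
  open Columns P public
  open import Relation.Binary.Reasoning.Setoid setoid

  ∑-* : {B C : Set} (xs : List B) (ys : List C) (f : B → Carrier) (g : C → Carrier) →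
        ∑ xs f * ∑ ys g ≈ (∑[ x ∈ xs ] ∑[ y ∈ ys ] f x * g y)
  ∑-* xs ys f g = trans (∑-*ʳ (∑ ys g) xs f) (∑-cong xs λ x → ∑-*ˡ (f x) ys g)

  e : List A → ℤ → Carrier
  e S z = ∑[ X ∈ wordsℤ S z ] guard (chain? X) (col X)

  infixl 5 _⇑_
  -- For a chain N this is the part of S above the last entry of N, the flawed one; testing all
  -- entries avoids singling it out.
  _⇑_ : List A → List A → List A
  S ⇑ N = filter (above? N) S

  e-⇑ : ∀ S N z → e (S ⇑ N) z ≈
        (∑[ X ∈ wordsℤ S z ] guard (All.all? (above? N) X ×-dec chain? X) (col X))
  e-⇑ S N (+ k)    = trans (∑-words-filter (above? N) S k _)
                           (∑-cong (words S k) λ X → guard-× (All.all? (above? N) X) (chain? X) _)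
  e-⇑ S N -[1+ n ] = ≈-refl

  Head : List A → List A → Set
  Head M N = Facing M N × Chain M × Chain N

  head? : ∀ M N → Dec (Head M N)
  head? M N = facing? M N ×-dec chain? M ×-dec chain? N

  flawAt⇒facing : ∀ M N {X} → FlawAt M N X → Facing M N
  flawAt⇒facing []      (b ∷ []) _       = tt
  flawAt⇒facing (a ∷ M) (b ∷ N)  (n , f) = n , flawAt⇒facing M N f

  flawAt⇒≪ : ∀ M N {X} → FlawAt M N X → Chain N → Chain X → N ≪ X
  flawAt⇒≪ []      (b ∷ [])     f       cN                 cX = All.map (_∷ []) (◁⇒All cX f)
  flawAt⇒≪ (a ∷ []) (b ∷ []) (_ , ()) cN cX
  flawAt⇒≪ (a ∷ _ ∷ _) (b ∷ []) (_ , ()) cN cX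
  flawAt⇒≪ (a ∷ M) (b ∷ b₂ ∷ N) (_ , f) ((b<b₂ ∷ _) ∷ cN) cX =
    All.map (λ { (b₂<x ∷ l) → <-trans b<b₂ b₂<x ∷ b₂<x ∷ l }) (flawAt⇒≪ M (b₂ ∷ N) f cN cX)

  facing⇒flawAt : ∀ M N {X} → Facing M N → N ≪ X → FlawAt M N X
  facing⇒flawAt []      (b ∷ []) _       N≪X = All⇒◁ (All.map All.head N≪X)
  facing⇒flawAt (a ∷ M) (b ∷ N)  (n , f) N≪X = n , facing⇒flawAt M N f (All.map All.tail N≪X)

  facing⇒beside : ∀ M N → Facing M N → Beside M N
  facing⇒beside []      N       _       = tt
  facing⇒beside (a ∷ M) (b ∷ N) (n , f) = n , facing⇒beside M N f

  -- The conditions on X and Y decouple and become identical: both have to be chains above N. For X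
  -- this is the flaw together with `facing-≪`, for Y it is the column condition. Therefore the sum
  -- factors, after `commute-columns` has moved Y to the left of M.
  ∑-block : ∀ S M N i j →
    (∑[ X ∈ wordsℤ S i ] ∑[ Y ∈ wordsℤ S j ]
      guard (flawAt? M N X ×-dec chain? (M ++ X) ×-dec chain? (N ++ Y)) (col (M ++ X) * col (N ++ Y))) ≈
    guard (head? M N) (e (S ⇑ N) i * e (S ⇑ N) j * (col M * col N))
  ∑-block S M N i j = begin
    (∑[ X ∈ wordsℤ S i ] ∑[ Y ∈ wordsℤ S j ]
      guard (flawAt? M N X ×-dec chain? (M ++ X) ×-dec chain? (N ++ Y)) (col (M ++ X) * col (N ++ Y)))
      ≈⟨ ∑-cong (wordsℤ S i) (λ X → ∑-cong (wordsℤ S j) λ Y → trans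
           (guard-cong (flawAt? M N X ×-dec chain? (M ++ X) ×-dec chain? (N ++ Y))
                       (head? M N ×-dec (over? X ×-dec over? Y)) (split X Y) (join X Y) (word X Y))
           (trans (sym (guard-× (head? M N) (over? X ×-dec over? Y) _))
             (guard-congʳ (head? M N) λ _ → trans (sym (guard-*ʳ (over? X ×-dec over? Y) _ _))
               (*-congʳ (sym (guard-* (over? X) (over? Y) (col X) (col Y))))))) ⟩
    (∑[ X ∈ wordsℤ S i ] ∑[ Y ∈ wordsℤ S j ]
      guard (head? M N) (guard (over? X) (col X) * guard (over? Y) (col Y) * (col M * col N)))
      ≈⟨ ∑-cong (wordsℤ S i) (λ X → guard-∑ (head? M N) (wordsℤ S j) _) ⟨
    (∑[ X ∈ wordsℤ S i ]
      guard (head? M N) (∑[ Y ∈ wordsℤ S j ] guard (over? X) (col X) * guard (over? Y) (col Y) * (col M * col N)))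
      ≈⟨ guard-∑ (head? M N) (wordsℤ S i) _ ⟨
    guard (head? M N) (∑[ X ∈ wordsℤ S i ] ∑[ Y ∈ wordsℤ S j ]
      guard (over? X) (col X) * guard (over? Y) (col Y) * (col M * col N))
      ≈⟨ guard-congʳ (head? M N) (λ _ → trans (∑-cong (wordsℤ S i) λ X → sym (∑-*ʳ _ (wordsℤ S j) _))
                                         (sym (∑-*ʳ _ (wordsℤ S i) _))) ⟩
    guard (head? M N) ((∑[ X ∈ wordsℤ S i ] ∑[ Y ∈ wordsℤ S j ]
      guard (over? X) (col X) * guard (over? Y) (col Y)) * (col M * col N))
      ≈⟨ guard-congʳ (head? M N) (λ _ → *-congʳ (trans (sym (∑-* (wordsℤ S i) (wordsℤ S j) _ _))
           (*-cong (sym (e-⇑ S N i)) (sym (e-⇑ S N j))))) ⟩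
    guard (head? M N) (e (S ⇑ N) i * e (S ⇑ N) j * (col M * col N)) ∎
    where
    over? : ∀ X → Dec (N ≪ X × Chain X)
    over? X = All.all? (above? N) X ×-dec chain? X

    split : ∀ X Y → FlawAt M N X × Chain (M ++ X) × Chain (N ++ Y) →
            Head M N × ((N ≪ X × Chain X) × (N ≪ Y × Chain Y))
    split X Y (f , cMX , cNY) with chain-++⁻ M cMX | chain-++⁻ N cNY
    ... | cM , cX , M≪X | cN , cY , N≪Y =
      (flawAt⇒facing M N f , cM , cN) , (flawAt⇒≪ M N f cN cX , cX) , (N≪Y , cY)

    join : ∀ X Y → Head M N × ((N ≪ X × Chain X) × (N ≪ Y × Chain Y)) →
           FlawAt M N X × Chain (M ++ X) × Chain (N ++ Y)
    join X Y ((f , cM , cN) , (N≪X , cX) , (N≪Y , cY)) =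
      facing⇒flawAt M N f N≪X ,
      chain-++⁺ cM cX (All.map (facing-≪ M N f cN) N≪X) ,
      chain-++⁺ cN cY N≪Y

    word : ∀ X Y → FlawAt M N X × Chain (M ++ X) × Chain (N ++ Y) →
           col (M ++ X) * col (N ++ Y) ≈ col X * col Y * (col M * col N)
    word X Y h with split X Y h
    ... | (f , cM , cN) , (N≪X , cX) , (N≪Y , cY) = begin
      col (M ++ X) * col (N ++ Y)     ≈⟨ *-cong (col-++ M X) (col-++ N Y) ⟩
      col X * col M * (col Y * col N) ≈⟨ solve *-monoid ⟩
      col X * (col M * col Y * col N)
        ≈⟨ *-congˡ (commute-columns M Y (facing⇒beside M N f) cN cY (All.map (facing-≪ M N f cN) N≪Y) N≪Y) ⟩
      col X * (col Y * col M * col N) ≈⟨ solve *-monoid ⟩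
      col X * col Y * (col M * col N) ∎

  -- The sum over the heads M, N of flawed pairs; the tails lie in S ⇑ N.
  Λ : ℕ → List A → (ℕ → List A → Carrier) → Carrier
  Λ b S h = ∑[ r ∈ indices b ] ∑[ M ∈ words S r ] ∑[ N ∈ words S (suc r) ]
              guard (head? M N) (h r (S ⇑ N) * (col M * col N))

  Λ-cong : ∀ b S {h h′} → (∀ r S′ → h r S′ ≈ h′ r S′) → Λ b S h ≈ Λ b S h′
  Λ-cong b S eq = ∑-cong (indices b) λ r → ∑-cong (words S r) λ M → ∑-cong (words S (suc r)) λ N →
    guard-congʳ (head? M N) λ _ → *-congʳ (eq r (S ⇑ N))

  Λ-+ : ∀ b S h h′ → Λ b S (λ r S′ → h r S′ + h′ r S′) ≈ Λ b S h + Λ b S h′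
  Λ-+ b S h h′ = 
    trans (∑-cong (indices b) λ r → trans (∑-cong (words S r) λ M → trans (∑-cong (words S (suc r)) λ N →
      trans (guard-congʳ (head? M N) λ _ → distribʳ _ _ _) (guard-+ (head? M N) _ _))
      (∑-+ (words S (suc r)) _ _)) (∑-+ (words S r) _ _)) (∑-+ (indices b) _ _)

  -- The flawless pairs, provided that b is at least q: rows beyond b are not inspected.
  T : ℕ → List A → ℤ → ℤ → Carrier
  T b S p q = ∑[ X ∈ wordsℤ S p ] ∑[ Y ∈ wordsℤ S q ]
                guard (tab≤? b X Y ×-dec chain? X ×-dec chain? Y) (col X * col Y)

  -- With r counting the good rows above the flaw, the heads use up r and r + 1 entries, which
  -- explains the heights of the tails.
  e-* : ∀ b S p q → e S p * e S q ≈ T b S p q + Λ b S (λ r S′ → e S′ (p ⊝ r) * e S′ (q ⊝ suc r))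
  e-* b S p q = begin
    e S p * e S q
      ≈⟨ ∑-* (wordsℤ S p) (wordsℤ S q) _ _ ⟩
    (∑[ X ∈ wordsℤ S p ] ∑[ Y ∈ wordsℤ S q ] guard (chain? X) (col X) * guard (chain? Y) (col Y))
      ≈⟨ ∑-cong (wordsℤ S p) (λ X → ∑-cong (wordsℤ S q) λ Y → trans (guard-* (chain? X) (chain? Y) _ _)
           (telescope (λ r → tab≤? r X Y) (λ r → tab≤-pred r X Y) b _)) ⟩
    (∑[ X ∈ wordsℤ S p ] ∑[ Y ∈ wordsℤ S q ]
      (guard (tab≤? b X Y) (pair X Y) + (∑[ r ∈ indices b ] guard (flawed? r X Y) (pair X Y))))
      ≈⟨ trans (∑-cong (wordsℤ S p) λ X → ∑-+ (wordsℤ S q) _ _) (∑-+ (wordsℤ S p) _ _) ⟩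
    (∑[ X ∈ wordsℤ S p ] ∑[ Y ∈ wordsℤ S q ] guard (tab≤? b X Y) (pair X Y)) +
    (∑[ X ∈ wordsℤ S p ] ∑[ Y ∈ wordsℤ S q ] ∑[ r ∈ indices b ] guard (flawed? r X Y) (pair X Y))
      ≈⟨ +-cong (∑-cong (wordsℤ S p) λ X → ∑-cong (wordsℤ S q) λ Y →
           guard-× (tab≤? b X Y) (chain? X ×-dec chain? Y) _)
           (trans (∑-cong (wordsℤ S p) λ X → ∑-swap (wordsℤ S q) (indices b) _) (∑-swap (wordsℤ S p) (indices b) _)) ⟩
    T b S p q + (∑[ r ∈ indices b ] ∑[ X ∈ wordsℤ S p ] ∑[ Y ∈ wordsℤ S q ] guard (flawed? r X Y) (pair X Y))
      ≈⟨ +-congˡ (∑-cong (indices b) λ r → trans (∑-cut S r p q pair)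
           (∑-cong (words S r) λ M → ∑-cong (words S (suc r)) λ N → trans
             (∑-cong (wordsℤ S (p ⊝ r)) λ X → ∑-cong (wordsℤ S (q ⊝ suc r)) λ Y →
                 guard-× (flawAt? M N X) (chain? (M ++ X) ×-dec chain? (N ++ Y)) _)
             (∑-block S M N (p ⊝ r) (q ⊝ suc r)))) ⟩
    T b S p q + Λ b S (λ r S′ → e S′ (p ⊝ r) * e S′ (q ⊝ suc r)) ∎
    where
    pair : List A → List A → Carrier
    pair X Y = guard (chain? X ×-dec chain? Y) (col X * col Y)

-- Duality under reversal of order and multiplication; balanced pairs of columns.

allPairs-reverse : {B : Set} {_~_ : B → B → Set} {X : List B} →
                   AllPairs _~_ X → AllPairs (flip _~_) (reverse X)
allPairs-reverse                 []                   = []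
allPairs-reverse {X = x ∷ X} (p ∷ ps) =
  subst (AllPairs _) (≡.sym (List.unfold-reverse x X))
    (AllPairs.++⁺ (allPairs-reverse ps) ([] ∷ []) (All.map (_∷ []) (All-resp-↭ (↭-sym (↭-reverse X)) p)))

filter-comm : {B : Set} {U V : B → Set} (U? : Decidable U) (V? : Decidable V) (xs : List B) →
              filter U? (filter V? xs) ≡ filter V? (filter U? xs)
filter-comm U? V? []       = refl
filter-comm U? V? (x ∷ xs) with U? x in eqU | V? x in eqV
... | yes _ | yes _ rewrite eqU | eqV = cong (x ∷_) (filter-comm U? V? xs)
... | yes _ | no  _ rewrite eqV       = filter-comm U? V? xs
... | no  _ | yes _ rewrite eqU       = filter-comm U? V? xs
... | no  _ | no  _                   = filter-comm U? V? xs

module Duality (P : PlacticAlgebra) where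
  open Decomposition P public
  module Dual = Decomposition (op P)
  open import Relation.Binary.Reasoning.Setoid setoid

  col-reverse : ∀ X → Dual.col (reverse X) ≈ col X
  col-reverse []      = ≈-refl
  col-reverse (a ∷ X) = begin
    Dual.col (reverse (a ∷ X))            ≡⟨ cong Dual.col (List.unfold-reverse a X) ⟩
    Dual.col (reverse X ∷ʳ a)             ≈⟨ Dual.col-++ (reverse X) [ a ] ⟩
    Dual.col (reverse X) * (u a * 1#)     ≈⟨ *-cong (col-reverse X) (*-identityʳ _) ⟩
    col X * u a                           ∎

  chain-reverse : ∀ {X} → Chain X → Dual.Chain (reverse X)
  chain-reverse = allPairs-reverse

  chain-reverse⁻ : ∀ {X} → Dual.Chain (reverse X) → Chain X
  chain-reverse⁻ {X} c = subst Chain (List.reverse-involutive X) (allPairs-reverse c)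

  -- A reversed chain is a chain for the opposite order, and the opposite multiplication reads it as
  -- the same element. So the expansion in the opposite algebra is a second expansion of the same
  -- products, at the last flaw of columns aligned at their bottoms.
  e-dual : ∀ S z → Dual.e S z ≈ e S z
  e-dual S -[1+ n ] = ≈-refl
  e-dual S (+ k)    = begin
    (∑[ X ∈ words S k ] guard (Dual.chain? X) (Dual.col X))
      ≈⟨ ∑-words-reverse S k _ ⟩
    (∑[ X ∈ words S k ] guard (Dual.chain? (reverse X)) (Dual.col (reverse X)))
      ≈⟨ ∑-cong (words S k) (λ X → guard-cong (Dual.chain? (reverse X)) (chain? X)
           chain-reverse⁻ chain-reverse (λ _ → col-reverse X)) ⟩
    (∑[ X ∈ words S k ] guard (chain? X) (col X)) ∎

  Weak : List A → List A → Set
  Weak = Pointwise (λ a b → ¬ (b < a))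

  weak? : ∀ X Y → Dec (Weak X Y)
  weak? = Pointwise.decidable (λ a b → ¬? (b <? a))

  -- Tableaux with two columns of equal length. `Weak` replaces `Tab≤` here because a pointwise
  -- relation survives the reversal of both columns.
  Balanced : List A → ℕ → Carrier
  Balanced S k = ∑[ X ∈ words S k ] ∑[ Y ∈ words S k ]
                   guard (weak? X Y ×-dec chain? X ×-dec chain? Y) (col X * col Y)

  tab≤⇒weak : ∀ b X Y → length X ≡ length Y → length Y ℕ.≤ b → Tab≤ b X Y → Weak X Y
  tab≤⇒weak b       []      []      _ _         _       = []
  tab≤⇒weak (suc b) (x ∷ X) (y ∷ Y) l (ℕ.s≤s m) (n , t) = n ∷ tab≤⇒weak b X Y (ℕ.suc-injective l) m t

  weak⇒tab≤ : ∀ b {X Y} → Weak X Y → Tab≤ b X Y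
  weak⇒tab≤ zero    _       = tt
  weak⇒tab≤ (suc b) []      = tt
  weak⇒tab≤ (suc b) (n ∷ w) = n , weak⇒tab≤ b w

  tab≤⇒length : ∀ b X Y → length Y ℕ.≤ b → Tab≤ b X Y → length Y ℕ.≤ length X
  tab≤⇒length b       X       []      _         _       = ℕ.z≤n
  tab≤⇒length (suc b) (x ∷ X) (y ∷ Y) (ℕ.s≤s m) (_ , t) = ℕ.s≤s (tab≤⇒length b X Y m t)

  T-square : ∀ b S k → k ℕ.≤ b → T b S (+ k) (+ k) ≈ Balanced S k
  T-square b S k k≤b = ∑-words-cong S k λ X lX → ∑-words-cong S k λ Y lY →
    guard-cong (tab≤? b X Y ×-dec chain? X ×-dec chain? Y) (weak? X Y ×-dec chain? X ×-dec chain? Y)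
      (λ (t , c) → tab≤⇒weak b X Y (≡.trans lX (≡.sym lY)) (subst (ℕ._≤ b) (≡.sym lY) k≤b) t , c)
      (λ (w , c) → weak⇒tab≤ b w , c) (λ _ → ≈-refl)

  -- The surplus entries of the right column are flaws, and b is large enough for them to be seen;
  -- once r exceeds m, the left height is negative and there is no pair at all.
  T-zero : ∀ b S m n r → m ℕ.< n → n ℕ.≤ b → T b S (+ m ⊝ r) (+ n ⊝ r) ≈ 0#
  T-zero b S m n zero m<n n≤b =
    trans (∑-words-cong S m {g = λ _ → 0#} λ X lX → trans (∑-words-cong S n {g = λ _ → 0#} λ Y lY →
      guard-no (tab≤? b X Y ×-dec chain? X ×-dec chain? Y) λ (t , _) →
        ℕ.<⇒≱ m<n (≡.subst₂ ℕ._≤_ lY lX (tab≤⇒length b X Y (subst (ℕ._≤ b) (≡.sym lY) n≤b) t)))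
      (∑-zero (words S n) λ _ → ≈-refl))
      (∑-zero (words S m) λ _ → ≈-refl)
  T-zero b S zero    (suc n) (suc r) m<n         n≤b = ∑-wordsℤ-negative S 0 r _
  T-zero b S (suc m) (suc n) (suc r) (ℕ.s≤s m<n) n≤b = T-zero b S m n r m<n (ℕ.≤-trans (ℕ.n≤1+n n) n≤b)

  -- In this form nested head sums range over fixed lists, so that `Λ-exchange` can interchange
  -- them.
  Λ-filter : ∀ {Q : A → Set} (Q? : Decidable Q) b S h → Λ b (filter Q? S) h ≈
    (∑[ r ∈ indices b ] ∑[ M ∈ words S r ] ∑[ N ∈ words S (suc r) ]
      guard (head? M N ×-dec (All.all? Q? M ×-dec All.all? Q? N)) (h r (filter Q? S ⇑ N) * (col M * col N)))
  Λ-filter Q? b S h = ∑-cong (indices b) λ r → trans (∑-words-filter Q? S r _) (∑-cong (words S r) λ M →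
    trans (guard-congʳ (All.all? Q? M) λ _ → ∑-words-filter Q? S (suc r) _)
      (trans (guard-∑ (All.all? Q? M) (words S (suc r)) _) (∑-cong (words S (suc r)) λ N →
        trans (guard-× (All.all? Q? M) (All.all? Q? N) _)
          (trans (guard-swap (All.all? Q? M ×-dec All.all? Q? N) (head? M N) _)
            (guard-× (head? M N) (All.all? Q? M ×-dec All.all? Q? N) _)))))

-- Sums over the pairs (s , k) with s + k = r, and over triples with a given sum.

splits splits⁺ : ℕ → List (ℕ × ℕ)
splits r = (0 , r) ∷ splits⁺ r
splits⁺ zero    = []
splits⁺ (suc r) = map (map₁ suc) (splits r)

pointwise-reverse⁻ : {B C : Set} {_~_ : B → C → Set} {X : List B} {Y : List C} →
                     Pointwise _~_ (reverse X) (reverse Y) → Pointwise _~_ X Y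
pointwise-reverse⁻ {_~_ = _~_} {X} {Y} w =
  ≡.subst₂ (Pointwise _~_) (List.reverse-involutive X) (List.reverse-involutive Y) (Pointwise.reverse⁺ w)

module Splits (R : Ring 0ℓ 0ℓ) where
  open Ring R renaming (refl to ≈-refl)
  open Sums R
  open import Relation.Binary.Reasoning.Setoid setoid

  ∑-splits-suc : ∀ r (g : ℕ × ℕ → Carrier) →
    ∑ (splits (suc r)) g ≈ g (0 , suc r) + (∑[ (s , k) ∈ splits r ] g (suc s , k))
  ∑-splits-suc r g = +-congˡ (∑-map (map₁ suc) (splits r) g)

  ∑-splits-snoc : ∀ r (g : ℕ × ℕ → Carrier) →
    ∑ (splits (suc r)) g ≈ (∑[ (s , k) ∈ splits r ] g (s , suc k)) + g (suc r , 0)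
  ∑-splits-snoc zero    g = trans (sym (+-assoc _ _ _)) (trans (+-identityʳ _) (+-congʳ (sym (+-identityʳ _))))
  ∑-splits-snoc (suc r) g = begin
    ∑ (splits (suc (suc r))) g
      ≈⟨ ∑-splits-suc (suc r) g ⟩
    g (0 , suc (suc r)) + (∑[ (s , k) ∈ splits (suc r) ] g (suc s , k))
      ≈⟨ +-congˡ (∑-splits-snoc r λ (s , k) → g (suc s , k)) ⟩
    g (0 , suc (suc r)) + ((∑[ (s , k) ∈ splits r ] g (suc s , suc k)) + g (suc (suc r) , 0))
      ≈⟨ trans (sym (+-assoc _ _ _)) (+-congʳ (sym (∑-splits-suc r _))) ⟩
    (∑[ (s , k) ∈ splits (suc r) ] g (s , suc k)) + g (suc (suc r) , 0) ∎

  ∑-splits-comm : ∀ r (g : ℕ → ℕ → Carrier) →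
    (∑[ (s , k) ∈ splits r ] g s k) ≈ (∑[ (s , k) ∈ splits r ] g k s)
  ∑-splits-comm zero    g = ≈-refl
  ∑-splits-comm (suc r) g = begin
    (∑[ (s , k) ∈ splits (suc r) ] g s k)                     ≈⟨ ∑-splits-suc r _ ⟩
    g 0 (suc r) + (∑[ (s , k) ∈ splits r ] g (suc s) k)       ≈⟨ +-comm _ _ ⟩
    (∑[ (s , k) ∈ splits r ] g (suc s) k) + g 0 (suc r)       ≈⟨ +-congʳ (∑-splits-comm r λ s k → g (suc s) k) ⟩
    (∑[ (s , k) ∈ splits r ] g (suc k) s) + g 0 (suc r)       ≈⟨ ∑-splits-snoc r _ ⟨
    (∑[ (s , k) ∈ splits (suc r) ] g k s)                     ∎

  ∑-splits-assoc : ∀ n (g : ℕ → ℕ → ℕ → Carrier) →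
    (∑[ (r , t) ∈ splits n ] ∑[ (s , k) ∈ splits r ] g s k t) ≈
    (∑[ (s , r) ∈ splits n ] ∑[ (k , t) ∈ splits r ] g s k t)
  ∑-splits-assoc zero    g = ≈-refl
  ∑-splits-assoc (suc n) g = begin
    (∑[ (r , t) ∈ splits (suc n) ] ∑[ (s , k) ∈ splits r ] g s k t)
      ≈⟨ ∑-splits-suc n _ ⟩
    (∑[ (s , k) ∈ splits 0 ] g s k (suc n)) + (∑[ (r , t) ∈ splits n ] ∑[ (s , k) ∈ splits (suc r) ] g s k t)
      ≈⟨ +-cong (+-identityʳ _) (trans (∑-cong (splits n) λ (r , t) → ∑-splits-suc r _) (∑-+ (splits n) _ _)) ⟩
    g 0 0 (suc n) + ((∑[ (r , t) ∈ splits n ] g 0 (suc r) t) +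
                     (∑[ (r , t) ∈ splits n ] ∑[ (s , k) ∈ splits r ] g (suc s) k t))
      ≈⟨ trans (sym (+-assoc _ _ _)) (+-cong (sym (∑-splits-suc n _)) (∑-splits-assoc n λ s → g (suc s))) ⟩
    (∑[ (k , t) ∈ splits (suc n) ] g 0 k t) + (∑[ (s , r) ∈ splits n ] ∑[ (k , t) ∈ splits r ] g (suc s) k t)
      ≈⟨ ∑-splits-suc n _ ⟨
    (∑[ (s , r) ∈ splits (suc n) ] ∑[ (k , t) ∈ splits r ] g s k t) ∎

  -- Needed because duality turns the stack balanced, path, balanced upside down.
  ∑-splits-reverse : ∀ n (g : ℕ → ℕ → ℕ → Carrier) →
    (∑[ (r , t) ∈ splits n ] ∑[ (s , k) ∈ splits r ] g s k t) ≈
    (∑[ (r , t) ∈ splits n ] ∑[ (s , k) ∈ splits r ] g t k s)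
  ∑-splits-reverse n g = begin
    (∑[ (r , t) ∈ splits n ] ∑[ (s , k) ∈ splits r ] g s k t)
      ≈⟨ ∑-splits-assoc n g ⟩
    (∑[ (s , r) ∈ splits n ] ∑[ (k , t) ∈ splits r ] g s k t)
      ≈⟨ ∑-splits-comm n (λ s r → ∑[ (k , t) ∈ splits r ] g s k t) ⟩
    (∑[ (r , s) ∈ splits n ] ∑[ (k , t) ∈ splits r ] g s k t)
      ≈⟨ ∑-cong (splits n) (λ (r , s) → ∑-splits-comm r (g s)) ⟩
    (∑[ (r , s) ∈ splits n ] ∑[ (t , k) ∈ splits r ] g s k t) ∎

-- Interchanging cuts at the first flaw with cuts at the last flaw.

module Exchange (P : PlacticAlgebra) where
  open Duality P public
  open Splits R public
  module Opp = Duality (op P)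
  open import Relation.Binary.Reasoning.Setoid setoid

  -- Duality turns both columns upside down and makes the left one the right one; since they have
  -- equal length, rows remain rows and the row condition is reversed twice.
  Balanced-dual : ∀ S k → Opp.Balanced S k ≈ Balanced S k
  Balanced-dual S k = begin
    (∑[ X ∈ words S k ] ∑[ Y ∈ words S k ]
      guard (Opp.weak? X Y ×-dec Opp.chain? X ×-dec Opp.chain? Y) (Opp.col Y * Opp.col X))
      ≈⟨ ∑-swap (words S k) (words S k) _ ⟩
    (∑[ Y ∈ words S k ] ∑[ X ∈ words S k ]
      guard (Opp.weak? X Y ×-dec Opp.chain? X ×-dec Opp.chain? Y) (Opp.col Y * Opp.col X))
      ≈⟨ trans (∑-words-reverse S k _) (∑-cong (words S k) λ Y → ∑-words-reverse S k _) ⟩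
    (∑[ Y ∈ words S k ] ∑[ X ∈ words S k ]
      guard (Opp.weak? (reverse X) (reverse Y) ×-dec Opp.chain? (reverse X) ×-dec Opp.chain? (reverse Y))
            (Opp.col (reverse Y) * Opp.col (reverse X)))
      ≈⟨ ∑-cong (words S k) (λ Y → ∑-cong (words S k) λ X →
           guard-cong (Opp.weak? (reverse X) (reverse Y) ×-dec Opp.chain? (reverse X) ×-dec Opp.chain? (reverse Y))
                      (weak? Y X ×-dec chain? Y ×-dec chain? X)
             (λ (w , cX , cY) → Pointwise.symmetric id (pointwise-reverse⁻ w) , chain-reverse⁻ cY , chain-reverse⁻ cX)
             (λ (w , cY , cX) → Pointwise.reverse⁺ (Pointwise.symmetric id w) , chain-reverse cX , chain-reverse cY)
             (λ _ → *-cong (col-reverse Y) (col-reverse X))) ⟩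
    (∑[ Y ∈ words S k ] ∑[ X ∈ words S k ] guard (weak? Y X ×-dec chain? Y ×-dec chain? X) (col Y * col X)) ∎

  ∑³-swap : {B C D E : Set} (xs : List B) (ys : B → List C) (zs : B → List D) (es : List E)
            (f : B → C → D → E → Carrier) →
    (∑[ x ∈ xs ] ∑[ y ∈ ys x ] ∑[ z ∈ zs x ] ∑[ e ∈ es ] f x y z e) ≈
    (∑[ e ∈ es ] ∑[ x ∈ xs ] ∑[ y ∈ ys x ] ∑[ z ∈ zs x ] f x y z e)
  ∑³-swap xs ys zs es f = trans
    (∑-cong xs λ x → trans (∑-cong (ys x) λ y → ∑-swap (zs x) es _) (∑-swap (ys x) es _))
    (∑-swap xs es _)

  -- Heads of the opposite algebra are split off at the left end of the word, ordinary heads at the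
  -- right end, so the factors agree up to associativity. In either order the two pairs of heads are
  -- only linked by the condition that N* lies above N: what is required of M or M* follows from
  -- `facing-≪` or its dual.
  Λ-exchange : ∀ b S (h : ℕ → ℕ → List A → Carrier) →
    Opp.Λ b S (λ r S′ → Λ b S′ (h r)) ≈ Λ b S (λ s S′ → Opp.Λ b S′ (λ r → h r s))
  Λ-exchange b S h = begin
    Opp.Λ b S (λ r S′ → Λ b S′ (h r))
      ≈⟨ (∑-cong (indices b) λ r → ∑-cong (words S r) λ M* → ∑-cong (words S (suc r)) λ N* →
           trans (guard-congʳ (Opp.head? M* N*) λ _ → trans (*-congˡ (Λ-filter (Opp.above? N*) b S (h r)))
             (pull (Opp.col N* * Opp.col M*) _))
           (trans (guard-∑ (Opp.head? M* N*) (indices b) _) (∑-cong (indices b) λ s →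
             trans (guard-∑ (Opp.head? M* N*) (words S s) _) (∑-cong (words S s) λ M →
             trans (guard-∑ (Opp.head? M* N*) (words S (suc s)) _) (∑-cong (words S (suc s)) λ N →
             trans (guard-congʳ (Opp.head? M* N*) λ _ → guard-*ˡ (head? M N ×-dec below? M* N* M N) _ _)
               (guard-× (Opp.head? M* N*) (head? M N ×-dec below? M* N* M N) _)))))) ⟩
    (∑[ r ∈ indices b ] ∑[ M* ∈ words S r ] ∑[ N* ∈ words S (suc r) ]
     ∑[ s ∈ indices b ] ∑[ M ∈ words S s ] ∑[ N ∈ words S (suc s) ] left r M* N* s M N)
      ≈⟨ trans (∑³-swap (indices b) (words S) (λ r → words S (suc r)) (indices b) _)
           (∑-cong (indices b) λ s → trans (∑³-swap (indices b) (words S) (λ r → words S (suc r)) (words S s) _)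
           (∑-cong (words S s) λ M → ∑³-swap (indices b) (words S) (λ r → words S (suc r)) (words S (suc s)) _)) ⟩
    (∑[ s ∈ indices b ] ∑[ M ∈ words S s ] ∑[ N ∈ words S (suc s) ]
     ∑[ r ∈ indices b ] ∑[ M* ∈ words S r ] ∑[ N* ∈ words S (suc r) ] left r M* N* s M N)
      ≈⟨ (∑-cong (indices b) λ s → ∑-cong (words S s) λ M → ∑-cong (words S (suc s)) λ N →
          ∑-cong (indices b) λ r → ∑-cong (words S r) λ M* → ∑-cong (words S (suc r)) λ N* →
          guard-cong (Opp.head? M* N* ×-dec (head? M N ×-dec below? M* N* M N))
                     (head? M N ×-dec (Opp.head? M* N* ×-dec above₂? M* N* M N))
            (λ { (h*@(f* , _ , cN*) , h′@(f , _ , cN) , (_ , bN)) → h′ , h* ,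
                 (Opp.≪-swap (All.map (Opp.facing-≪ M* N* f* cN*) bN) , Opp.≪-swap bN) })
            (λ { (h′@(f , _ , cN) , h*@(f* , _ , cN*) , (_ , bN)) → h* , h′ ,
                 (≪-swap (All.map (facing-≪ M N f cN) bN) , ≪-swap bN) })
            (λ _ → trans (reflexive (cong (λ S′ → Opp.col N* * Opp.col M* * (h r s S′ * (col M * col N)))
                                      (filter-comm (above? N) (Opp.above? N*) S)))
                         (sym (*-assoc _ _ _)))) ⟩
    (∑[ s ∈ indices b ] ∑[ M ∈ words S s ] ∑[ N ∈ words S (suc s) ]
     ∑[ r ∈ indices b ] ∑[ M* ∈ words S r ] ∑[ N* ∈ words S (suc r) ] right r M* N* s M N)
      ≈⟨ (∑-cong (indices b) λ s → ∑-cong (words S s) λ M → ∑-cong (words S (suc s)) λ N →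
           trans (guard-congʳ (head? M N) λ _ → trans (*-congʳ (Opp.Λ-filter (above? N) b S (λ r → h r s)))
             (pullʳ (col M * col N) _))
           (trans (guard-∑ (head? M N) (indices b) _) (∑-cong (indices b) λ r →
             trans (guard-∑ (head? M N) (words S r) _) (∑-cong (words S r) λ M* →
             trans (guard-∑ (head? M N) (words S (suc r)) _) (∑-cong (words S (suc r)) λ N* →
             trans (guard-congʳ (head? M N) λ _ → guard-*ʳ (Opp.head? M* N* ×-dec above₂? M* N* M N) _ _)
               (guard-× (head? M N) (Opp.head? M* N* ×-dec above₂? M* N* M N) _)))))) ⟨
    Λ b S (λ s S′ → Opp.Λ b S′ (λ r → h r s)) ∎
    where
    below? : ∀ M* N* M N → Dec (All (Opp.Above N*) M × All (Opp.Above N*) N)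
    below? M* N* M N = All.all? (Opp.above? N*) M ×-dec All.all? (Opp.above? N*) N
    above₂? : ∀ M* N* M N → Dec (All (Above N) M* × All (Above N) N*)
    above₂? M* N* M N = All.all? (above? N) M* ×-dec All.all? (above? N) N*
    left right : ℕ → List A → List A → ℕ → List A → List A → Carrier
    left r M* N* s M N =
      guard (Opp.head? M* N* ×-dec (head? M N ×-dec below? M* N* M N))
            (Opp.col N* * Opp.col M* * (h r s (S Opp.⇑ N* ⇑ N) * (col M * col N)))
    right r M* N* s M N =
      guard (head? M N ×-dec (Opp.head? M* N* ×-dec above₂? M* N* M N))
            (Opp.col N* * Opp.col M* * h r s ((S ⇑ N) Opp.⇑ N*) * (col M * col N))
    pull : ∀ c (f : (r : ℕ) → List A → List A → Carrier) →
      c * (∑[ r ∈ indices b ] ∑[ M ∈ words S r ] ∑[ N ∈ words S (suc r) ] f r M N) ≈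
      (∑[ r ∈ indices b ] ∑[ M ∈ words S r ] ∑[ N ∈ words S (suc r) ] c * f r M N)
    pull c f = trans (∑-*ˡ c (indices b) _) (∑-cong (indices b) λ r → trans (∑-*ˡ c (words S r) _)
      (∑-cong (words S r) λ M → ∑-*ˡ c (words S (suc r)) _))
    pullʳ : ∀ c (f : (r : ℕ) → List A → List A → Carrier) →
      (∑[ r ∈ indices b ] ∑[ M ∈ words S r ] ∑[ N ∈ words S (suc r) ] f r M N) * c ≈
      (∑[ r ∈ indices b ] ∑[ M ∈ words S r ] ∑[ N ∈ words S (suc r) ] f r M N * c)
    pullʳ c f = trans (∑-*ʳ c (indices b) _) (∑-cong (indices b) λ r → trans (∑-*ʳ c (words S r) _)
      (∑-cong (words S r) λ M → ∑-*ʳ c (words S (suc r)) _))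

-- Zigzags inside the heads of flawed pairs with balanced tails.

module Paths (P : PlacticAlgebra) where
  open Exchange P public
  open import Relation.Binary.Reasoning.Setoid setoid

  -- Ends M D: the last entry of M, if any, lies below the first entry of D.
  Ends : List A → List A → Set
  Ends []          D = ⊤
  Ends (a ∷ [])    D = a ◁ D
  Ends (a ∷ b ∷ M) D = Ends (b ∷ M) D

  ends? : ∀ M D → Dec (Ends M D)
  ends? []          D = yes tt
  ends? (a ∷ [])    D = a ◁? D
  ends? (a ∷ b ∷ M) D = ends? (b ∷ M) D

  ends⇒≪ : ∀ M {D} → Chain M → Chain D → Ends M D → M ≪ D
  ends⇒≪ []          cM cD _ = All.universal (λ _ → []) _
  ends⇒≪ (a ∷ [])    cM cD e = All.map (_∷ []) (◁⇒All cD e)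
  ends⇒≪ (a ∷ b ∷ M) ((a<b ∷ _) ∷ cM) cD e =
    All.map (λ { (b<d ∷ l) → <-trans a<b b<d ∷ b<d ∷ l }) (ends⇒≪ (b ∷ M) cM cD e)

  ≪⇒ends : ∀ M {D} → M ≪ D → Ends M D
  ≪⇒ends []          l = tt
  ≪⇒ends (a ∷ [])    l = All⇒◁ (All.map All.head l)
  ≪⇒ends (a ∷ b ∷ M) l = ≪⇒ends (b ∷ M) (All.map All.tail l)

  ∑-∑ : (S : List A) (m n : ℕ) → (List A → List A → Carrier) → Carrier
  ∑-∑ S m n f = ∑[ M ∈ words S m ] ∑[ N ∈ words S n ] f M N

  ∑-∑-cong : ∀ S m n {f g} → (∀ M N → length M ≡ m → length N ≡ n → f M N ≈ g M N) →
             ∑-∑ S m n f ≈ ∑-∑ S m n g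
  ∑-∑-cong S m n eq = ∑-words-cong S m λ M lM → ∑-words-cong S n λ N lN → eq M N lM lN

  ∑-∑-cong₁ : ∀ S m n {f g} → (∀ M N → f M N ≈ g M N) → ∑-∑ S m n f ≈ ∑-∑ S m n g
  ∑-∑-cong₁ S m n eq = ∑-∑-cong S m n λ M N _ _ → eq M N

  ∑-∑-+ : ∀ S m n f g → ∑-∑ S m n (λ M N → f M N + g M N) ≈ ∑-∑ S m n f + ∑-∑ S m n g
  ∑-∑-+ S m n f g = trans (∑-cong (words S m) λ M → ∑-+ (words S n) _ _) (∑-+ (words S m) _ _)

  module _ (S : List A) where
    broken : ℕ → ℕ → (List A → List A → Carrier) → Carrier
    broken s k f = ∑-∑ S s s λ M N → ∑-∑ S k (suc k) λ C D →
      guard (ends? M D ×-dec unlinked? C D) (f (M ++ C) (N ++ D))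

    -- Call a row linked if its left entry lies below the right entry of the next row. Each pair is
    -- cut exactly once, just after its last linked row; without linked rows it is cut at the top,
    -- with s = 0.
    ∑-broken : ∀ r f → ∑-∑ S r (suc r) f ≈ (∑[ (s , k) ∈ splits r ] broken s k f)
    ∑-broken zero    f = begin
      ∑-∑ S 0 1 f
        ≈⟨ ∑-∑-cong S 0 1 {f} {λ C D → guard (ends? [] D ×-dec unlinked? C D) (f C D)}
             (λ { [] (d ∷ []) _ _ → ≈-refl }) ⟩
      ∑-∑ S 0 1 (λ C D → guard (ends? [] D ×-dec unlinked? C D) (f C D))
        ≈⟨ trans (+-identityʳ _) (+-identityʳ _) ⟨
      broken 0 0 f
        ≈⟨ +-identityʳ _ ⟨
      (∑[ (s , k) ∈ splits 0 ] broken s k f) ∎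
    ∑-broken (suc r) f = begin
      ∑-∑ S (suc r) (suc (suc r)) f
        ≈⟨ ∑-words-suc₂ S r (suc r) f ⟩
      (∑[ a ∈ S ] ∑[ b ∈ S ] ∑-∑ S r (suc r) (f₂ a b))
        ≈⟨ (∑-cong S λ a → ∑-cong S λ b → trans (∑-broken r (f₂ a b)) (step a b)) ⟩
      (∑[ a ∈ S ] ∑[ b ∈ S ] (opening a b + (∑[ (s , k) ∈ splits r ] later a b s k)))
        ≈⟨ trans (∑-cong S λ a → ∑-+ S _ _) (∑-+ S _ _) ⟩
      (∑[ a ∈ S ] ∑[ b ∈ S ] opening a b) + (∑[ a ∈ S ] ∑[ b ∈ S ] ∑[ (s , k) ∈ splits r ] later a b s k)
        ≈⟨ +-cong (sym (trans (trans (+-identityʳ _) (+-identityʳ _))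
                    (trans (∑-∑-cong₁ S (suc r) (suc (suc r)) λ C D →
                              guard-cong (ends? [] D ×-dec unlinked? C D) (unlinked? C D) proj₂ (tt ,_)
                                  (λ _ → ≈-refl))
                           (∑-words-suc₂ S r (suc r) _))))
             (trans (trans (∑-cong S λ a → ∑-swap S (splits r) _) (∑-swap S (splits r) _))
               (∑-cong (splits r) λ (s , k) → sym (∑-words-suc₂ S s s _))) ⟩
      broken 0 (suc r) f + (∑[ (s , k) ∈ splits r ] broken (suc s) k f)
        ≈⟨ ∑-splits-suc r _ ⟨
      (∑[ (s , k) ∈ splits (suc r) ] broken s k f) ∎
      where
      f₂ : A → A → List A → List A → Carrier
      f₂ a b M N = f (a ∷ M) (b ∷ N)
      opening : A → A → Carrier
      opening a b = ∑-∑ S r (suc r) λ C D → guard (unlinked? (a ∷ C) (b ∷ D)) (f₂ a b C D)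
      later : A → A → ℕ → ℕ → Carrier
      later a b s k = ∑-∑ S s s λ M N → ∑-∑ S k (suc k) λ C D →
        guard (ends? (a ∷ M) D ×-dec unlinked? C D) (f₂ a b (M ++ C) (N ++ D))
      -- A new top row only affects the cut with s = 0: either it prolongs the unlinked part, or it
      -- becomes the last linked row itself. All other cuts just gain a row above.
      split : ∀ a b C D → length D ≡ suc r →
        guard (ends? [] D ×-dec unlinked? C D) (f₂ a b C D) ≈
        guard (unlinked? (a ∷ C) (b ∷ D)) (f₂ a b C D) +
        guard (ends? (a ∷ []) D ×-dec unlinked? C D) (f₂ a b C D)
      split a b C (d ∷ D) _ with a <? d
      ... | yes _ = sym (+-identityˡ _)
      ... | no  _ = sym (+-identityʳ _)
      step : ∀ a b → (∑[ (s , k) ∈ splits r ] broken s k (f₂ a b)) ≈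
                     opening a b + (∑[ (s , k) ∈ splits r ] later a b s k)
      step a b = begin
        broken 0 r (f₂ a b) + (∑[ (s , k) ∈ splits⁺ r ] broken s k (f₂ a b))
          ≈⟨ +-cong (trans (trans (+-identityʳ _) (+-identityʳ _))
                      (trans (∑-∑-cong S r (suc r) λ C D _ lD → split a b C D lD) (∑-∑-+ S r (suc r) _ _)))
                    (rest r) ⟩
        (opening a b + ∑-∑ S r (suc r) (λ C D → guard (ends? (a ∷ []) D ×-dec unlinked? C D) (f₂ a b C D)))
          + (∑[ (s , k) ∈ splits⁺ r ] later a b s k)
          ≈⟨ +-assoc _ _ _ ⟩
        opening a b + (∑-∑ S r (suc r) (λ C D → guard (ends? (a ∷ []) D ×-dec unlinked? C D) (f₂ a b C D))
          + (∑[ (s , k) ∈ splits⁺ r ] later a b s k))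
          ≈⟨ +-congˡ (+-congʳ (trans (+-identityʳ _) (+-identityʳ _))) ⟨
        opening a b + (∑[ (s , k) ∈ splits r ] later a b s k) ∎
        where
        rest : ∀ r → (∑[ (s , k) ∈ splits⁺ r ] broken s k (f₂ a b)) ≈ (∑[ (s , k) ∈ splits⁺ r ] later a b s k)
        rest zero    = ≈-refl
        rest (suc r) = trans (∑-map (map₁ suc) (splits r) _) (trans
          (∑-cong (splits r) λ (s , k) → ∑-∑-cong S (suc s) (suc s) λ { (m ∷ M) N _ _ → ≈-refl })
          (sym (∑-map (map₁ suc) (splits r) _)))

  -- The dual of `facing-≪`: from x < d < d₂ and c not below d₂, (3+1)-freeness gives x < c.
  unlinked⇒≪ : ∀ C D {x} → Facing C D → Unlinked C D → Chain D → All (x <_) D → All (x <_) C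
  unlinked⇒≪ []      (d ∷ [])     f       l         cD x<D = []
  unlinked⇒≪ (c ∷ C) (d ∷ d₂ ∷ D) (_ , f) (c≮d₂ ∷ l) ((d<d₂ ∷ _) ∷ cD) (x<d ∷ x<D) =
    [ ⊥-elim ∘ c≮d₂ , id ]′ (free c x<d d<d₂) ∷ unlinked⇒≪ C (d₂ ∷ D) f l cD x<D

  facing-++⁻ : ∀ M N {C D} → length M ≡ length N → Facing (M ++ C) (N ++ D) → Weak M N × Facing C D
  facing-++⁻ []      []      l f       = [] , f
  facing-++⁻ (a ∷ M) (b ∷ N) l (n , f) with facing-++⁻ M N (ℕ.suc-injective l) f
  ... | w , f′ = n ∷ w , f′

  facing-++⁺ : ∀ {M N C D} → Weak M N → Facing C D → Facing (M ++ C) (N ++ D)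
  facing-++⁺ []      f = f
  facing-++⁺ (n ∷ w) f = n , facing-++⁺ w f

  weak⇒beside : ∀ {M N} → Weak M N → Beside M N
  weak⇒beside []      = tt
  weak⇒beside (n ∷ w) = n , weak⇒beside w

  ⇑-++ : ∀ S N d D → N ≪ (d ∷ D) → S ⇑ (N ++ d ∷ D) ≡ S ⇑ (d ∷ D)
  ⇑-++ S N d D (N<d ∷ _) = List.filter-≐ (above? (N ++ d ∷ D)) (above? (d ∷ D))
    ((λ p → All.++⁻ʳ N p) , (λ { p@(d<x ∷ _) → All.++⁺ (All.map (λ n<d → <-trans n<d d<x) N<d) p })) S

  -- The heads of flaws with balanced tails decompose as balanced > path > balanced.
  V : List A → ℕ → Carrier
  V S n = ∑[ (r , t) ∈ splits n ] ∑[ (s , k) ∈ splits r ] ∑-∑ S k (suc k) λ C D →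
    guard (path? C D) (Balanced (S ⇑ D) t * (col C * col D) * Balanced (S Opp.⇑ D) s)

  -- The link at the cut puts M below D, and then `unlinked⇒≪` puts it below C. So `commute-columns`
  -- turns C M D N into C D M N, and the conditions on M and N reduce to being a balanced pair below
  -- D. The tails above N ++ D are just those above D.
  ∑-path : ∀ S t s k →
    broken S s k (λ M N → guard (head? M N) (Balanced (S ⇑ N) t * (col M * col N))) ≈
    ∑-∑ S k (suc k) (λ C D → guard (path? C D) (Balanced (S ⇑ D) t * (col C * col D) * Balanced (S Opp.⇑ D) s))
  ∑-path S t s k = begin
    ∑-∑ S s s (λ M N → ∑-∑ S k (suc k) λ C D → guard (ends? M D ×-dec unlinked? C D)
      (guard (head? (M ++ C) (N ++ D)) (Balanced (S ⇑ (N ++ D)) t * (col (M ++ C) * col (N ++ D)))))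
      ≈⟨ (∑-∑-cong S s s λ M N lM lN → ∑-∑-cong₁ S k (suc k) λ C D →
           trans (guard-× (ends? M D ×-dec unlinked? C D) (head? (M ++ C) (N ++ D)) _)
           (trans (guard-cong ((ends? M D ×-dec unlinked? C D) ×-dec head? (M ++ C) (N ++ D))
                       (path? C D ×-dec (under? M N D ×-dec bal? M N))
                       (to M N C D (≡.trans lM (≡.sym lN))) (from M N C D) (word M N C D (≡.trans lM (≡.sym lN))))
             (trans (sym (guard-× (path? C D) (under? M N D ×-dec bal? M N) _))
               (guard-congʳ (path? C D) λ _ → trans (sym (guard-*ˡ (under? M N D ×-dec bal? M N) _ _))
                 (*-congˡ (sym (guard-× (under? M N D) (bal? M N) _))))))) ⟩
    ∑-∑ S s s (λ M N → ∑-∑ S k (suc k) λ C D → guard (path? C D)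
      (Balanced (S ⇑ D) t * (col C * col D) * guard (under? M N D) (guard (bal? M N) (col M * col N))))
      ≈⟨ trans (∑-cong (words S s) λ M → trans (∑-swap (words S s) (words S k) _) (∑-cong (words S k) λ C →
           ∑-swap (words S s) (words S (suc k)) _))
           (trans (∑-swap (words S s) (words S k) _) (∑-cong (words S k) λ C →
               ∑-swap (words S s) (words S (suc k)) _)) ⟩
    ∑-∑ S k (suc k) (λ C D → ∑-∑ S s s λ M N → guard (path? C D)
      (Balanced (S ⇑ D) t * (col C * col D) * guard (under? M N D) (guard (bal? M N) (col M * col N))))
      ≈⟨ (∑-∑-cong₁ S k (suc k) λ C D → trans
           (trans (∑-cong (words S s) λ M → sym (guard-∑ (path? C D) (words S s) _))
               (sym (guard-∑ (path? C D) (words S s) _)))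
           (guard-congʳ (path? C D) λ _ → trans
             (trans (∑-cong (words S s) λ M → sym (∑-*ˡ _ (words S s) _)) (sym (∑-*ˡ _ (words S s) _)))
             (*-congˡ (lower D)))) ⟩
    ∑-∑ S k (suc k) (λ C D → guard (path? C D) (Balanced (S ⇑ D) t * (col C * col D) * Balanced (S Opp.⇑ D) s)) ∎
    where
    under? : ∀ M N D → Dec (All (Opp.Above D) M × All (Opp.Above D) N)
    under? M N D = All.all? (Opp.above? D) M ×-dec All.all? (Opp.above? D) N
    bal? : ∀ M N → Dec (Weak M N × Chain M × Chain N)
    bal? M N = weak? M N ×-dec chain? M ×-dec chain? N

    lower : ∀ D → ∑-∑ S s s (λ M N → guard (under? M N D) (guard (bal? M N) (col M * col N))) ≈ Balanced (S Opp.⇑ D) s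
    lower D = begin
      ∑-∑ S s s (λ M N → guard (under? M N D) (guard (bal? M N) (col M * col N)))
        ≈⟨ (∑-cong (words S s) λ M →
             trans (∑-cong (words S s) λ N → sym (guard-× (All.all? (Opp.above? D) M) (All.all? (Opp.above? D) N) _))
              (sym (guard-∑ (All.all? (Opp.above? D) M) (words S s) _))) ⟩
      (∑[ M ∈ words S s ] guard (All.all? (Opp.above? D) M)
        (∑[ N ∈ words S s ] guard (All.all? (Opp.above? D) N) (guard (bal? M N) (col M * col N))))
        ≈⟨ (∑-cong (words S s) λ M → guard-congʳ (All.all? (Opp.above? D) M) λ _ →
             ∑-words-filter (Opp.above? D) S s _) ⟨
      (∑[ M ∈ words S s ] guard (All.all? (Opp.above? D) M)
        (∑[ N ∈ words (S Opp.⇑ D) s ] guard (bal? M N) (col M * col N)))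
        ≈⟨ ∑-words-filter (Opp.above? D) S s _ ⟨
      Balanced (S Opp.⇑ D) s ∎

    to : ∀ M N C D → length M ≡ length N → (Ends M D × Unlinked C D) × Head (M ++ C) (N ++ D) →
         Path C D × ((All (Opp.Above D) M × All (Opp.Above D) N) × (Weak M N × Chain M × Chain N))
    to M N C D l ((e , n) , (f , cMC , cND)) with facing-++⁻ M N l f | chain-++⁻ M cMC | chain-++⁻ N cND
    ... | w , f′ | cM , cC , M≪C | cN , cD , N≪D =
      ((f′ , n) , (cC , cD)) , (≪-swap (ends⇒≪ M cM cD e) , ≪-swap N≪D) , (w , cM , cN)

    from : ∀ M N C D → Path C D × ((All (Opp.Above D) M × All (Opp.Above D) N) × (Weak M N × Chain M × Chain N)) →
           (Ends M D × Unlinked C D) × Head (M ++ C) (N ++ D)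
    from M N C D (((f , n) , (cC , cD)) , (M<D , N<D) , (w , cM , cN)) =
      (≪⇒ends M (Opp.≪-swap M<D) , n) ,
      (facing-++⁺ w f ,
       chain-++⁺ cM cC (Opp.≪-swap (All.map (unlinked⇒≪ C D f n cD) M<D)) ,
       chain-++⁺ cN cD (Opp.≪-swap N<D))

    word : ∀ M N C D → length M ≡ length N → (Ends M D × Unlinked C D) × Head (M ++ C) (N ++ D) →
      Balanced (S ⇑ (N ++ D)) t * (col (M ++ C) * col (N ++ D)) ≈
      Balanced (S ⇑ D) t * (col C * col D) * (col M * col N)
    word M N C (d ∷ D) l h with to M N C (d ∷ D) l h
    ... | (_ , (cC , cD)) , (M<D , N<D) , (w , cM , cN) = begin
      Balanced (S ⇑ (N ++ d ∷ D)) t * (col (M ++ C) * col (N ++ d ∷ D))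
        ≈⟨ *-cong (reflexive (cong (λ S′ → Balanced S′ t) (⇑-++ S N d D (Opp.≪-swap N<D))))
             (*-cong (col-++ M C) (col-++ N (d ∷ D))) ⟩
      K * (col C * col M * (col (d ∷ D) * col N)) ≈⟨ regroup _ _ _ _ _ ⟩
      K * col C * (col M * col (d ∷ D) * col N)
        ≈⟨ *-congˡ (commute-columns M (d ∷ D) (weak⇒beside w) cN cD (Opp.≪-swap M<D) (Opp.≪-swap N<D)) ⟩
      K * col C * (col (d ∷ D) * col M * col N)   ≈⟨ regroup′ _ _ _ _ _ ⟩
      K * (col C * col (d ∷ D)) * (col M * col N) ∎
      where
      K : Carrier
      K = Balanced (S ⇑ (d ∷ D)) t
      regroup : ∀ k c m d n → k * (c * m * (d * n)) ≈ k * c * (m * d * n)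
      regroup k c m d n = solve *-monoid
      regroup′ : ∀ k c m d n → k * c * (d * m * n) ≈ k * (c * d) * (m * n)
      regroup′ k c m d n = solve *-monoid

  -- Beyond r = n the height is negative and h vanishes; up to there n ⊝ r is the complement t of r
  -- in n.
  ∑-indices-⊝ : ∀ n b (h : ℕ → ℤ → Carrier) → n ℕ.< b → (∀ r z → h r -[1+ z ] ≈ 0#) →
    (∑[ r ∈ indices b ] h r (+ n ⊝ r)) ≈ (∑[ (r , t) ∈ splits n ] h r (+ t))
  ∑-indices-⊝ zero (suc b) h _ neg = trans (∑-indices-suc b _)
      (+-congˡ (∑-zero (indices b) λ r → negative (suc r) 0 r))
    where
    negative : ∀ r′ z r → h r′ (-[1+ z ] ⊝ r) ≈ 0#
    negative r′ z zero    = neg r′ z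
    negative r′ z (suc r) = negative r′ (suc z) r
  ∑-indices-⊝ (suc n) (suc b) h (ℕ.s≤s n<b) neg = trans (∑-indices-suc b _)
    (trans (+-congˡ (∑-indices-⊝ n b (λ r → h (suc r)) n<b (λ r → neg (suc r)))) (sym (∑-splits-suc n _)))

  Balancedℤ : List A → ℤ → Carrier
  Balancedℤ S (+ k)    = Balanced S k
  Balancedℤ S -[1+ _ ] = 0#

  T-square-⊝ : ∀ b S n r → n ℕ.≤ b → T b S (+ n ⊝ r) (+ n ⊝ r) ≈ Balancedℤ S (+ n ⊝ r)
  T-square-⊝ b S n       zero    n≤b = T-square b S n n≤b
  T-square-⊝ b S zero    (suc r) n≤b = trans (∑-wordsℤ-negative S 0 r _) (sym (negative 0 r))
    where
    negative : ∀ z r → Balancedℤ S (-[1+ z ] ⊝ r) ≈ 0#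
    negative z zero    = ≈-refl
    negative z (suc r) = negative (suc z) r
  T-square-⊝ b S (suc n) (suc r) n<b = T-square-⊝ b S n r (ℕ.<⇒≤ n<b)

  Λ-balanced : ∀ b S n → n ℕ.< b → Λ b S (λ r S′ → T b S′ (+ n ⊝ r) (+ n ⊝ r)) ≈ V S n
  Λ-balanced b S n n<b = begin
    Λ b S (λ r S′ → T b S′ (+ n ⊝ r) (+ n ⊝ r))
      ≈⟨ Λ-cong b S (λ r S′ → T-square-⊝ b S′ n r (ℕ.<⇒≤ n<b)) ⟩
    Λ b S (λ r S′ → Balancedℤ S′ (+ n ⊝ r))
      ≈⟨ ∑-indices-⊝ n b (λ r z → ∑-∑ S r (suc r) λ M N → guard (head? M N) (Balancedℤ (S ⇑ N) z * (col M * col N)))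
           n<b
           (λ r z → ∑-zero (words S r) λ M → ∑-zero (words S (suc r)) λ N →
             trans (guard-congʳ (head? M N) λ _ → zeroˡ _) (guard-0 (head? M N))) ⟩
    (∑[ (r , t) ∈ splits n ] ∑-∑ S r (suc r) λ M N → guard (head? M N) (Balanced (S ⇑ N) t * (col M * col N)))
      ≈⟨ ∑-cong (splits n) (λ (r , t) → trans (∑-broken S r _) (∑-cong (splits r) λ (s , k) → ∑-path S t s k)) ⟩
    V S n ∎

  facing-∷ʳ⁺ : ∀ {C D d} → Weak C D → Facing C (D ∷ʳ d)
  facing-∷ʳ⁺ []      = tt
  facing-∷ʳ⁺ (n ∷ w) = n , facing-∷ʳ⁺ w

  facing-∷ʳ⁻ : ∀ C D {d} → Facing C (D ∷ʳ d) → Weak C D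
  facing-∷ʳ⁻ []      []          _       = []
  facing-∷ʳ⁻ []      (_ ∷ [])    ()
  facing-∷ʳ⁻ []      (_ ∷ _ ∷ _) ()
  facing-∷ʳ⁻ (c ∷ []) []         (_ , ())
  facing-∷ʳ⁻ (c ∷ _ ∷ _) []      (_ , ())
  facing-∷ʳ⁻ (c ∷ C) (d ∷ D)     (n , f) = n ∷ facing-∷ʳ⁻ C D f

  facing-[] : ∀ C → ¬ Facing C []
  facing-[] []      ()
  facing-[] (c ∷ C) ()

all-reverse : {B : Set} {U : B → Set} {X : List B} → All U X → All U (reverse X)
all-reverse {X = X} = All-resp-↭ (↭-sym (↭-reverse X))

all-reverse⁻ : {B : Set} {U : B → Set} {X : List B} → All U (reverse X) → All U X
all-reverse⁻ {X = X} = All-resp-↭ (↭-reverse X)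

-- Commutation of the elementary sums.

module Commutation (P : PlacticAlgebra) where
  open Paths P public
  module Op = Paths (op P)
  open import Relation.Binary.Reasoning.Setoid setoid

  -- `Unlinked` leaves out the first entry of D and `Facing` the last one; reversal moves the
  -- surplus entry to the other end. Hence it exchanges the two halves of the zigzag condition.
  facing-reverse⁺ : ∀ C D → Unlinked C D → Op.Facing (reverse C) (reverse D)
  facing-reverse⁺ C (d ∷ D) l = subst (Op.Facing (reverse C)) (≡.sym (List.unfold-reverse d D))
    (Op.facing-∷ʳ⁺ (Pointwise.reverse⁺ l))

  facing-reverse⁻ : ∀ C D → Op.Facing (reverse C) (reverse D) → Unlinked C D
  facing-reverse⁻ C []      f = Op.facing-[] (reverse C) f
  facing-reverse⁻ C (d ∷ D) f = pointwise-reverse⁻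
    (Op.facing-∷ʳ⁻ (reverse C) (reverse D) (subst (Op.Facing (reverse C)) (List.unfold-reverse d D) f))

  unlinked-reverse⁺ : ∀ C D → Facing C D → Op.Unlinked (reverse C) (reverse D)
  unlinked-reverse⁺ C D f with initLast D
  ... | []      = facing-[] C f
  ... | D′ ∷ʳ′ d = subst (Op.Unlinked (reverse C)) (≡.sym (List.reverse-++ D′ [ d ]))
    (Pointwise.reverse⁺ (facing-∷ʳ⁻ C D′ f))

  unlinked-reverse⁻ : ∀ C D → Op.Unlinked (reverse C) (reverse D) → Facing C D
  unlinked-reverse⁻ C D l with initLast D
  ... | []      = ⊥-elim l
  ... | D′ ∷ʳ′ d = facing-∷ʳ⁺ (pointwise-reverse⁻ (subst (Op.Unlinked (reverse C)) (List.reverse-++ D′ [ d ]) l))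

  path-reverse⁺ : ∀ C D → Path C D → Op.Path (reverse C) (reverse D)
  path-reverse⁺ C D ((f , l) , (cC , cD)) =
    (facing-reverse⁺ C D l , unlinked-reverse⁺ C D f) , (chain-reverse cC , chain-reverse cD)

  path-reverse⁻ : ∀ C D → Op.Path (reverse C) (reverse D) → Path C D
  path-reverse⁻ C D ((f , l) , (cC , cD)) =
    (unlinked-reverse⁻ C D l , facing-reverse⁻ C D f) , (chain-reverse⁻ cC , chain-reverse⁻ cD)

  ⇑-reverse : ∀ S D → S ⇑ reverse D ≡ S ⇑ D
  ⇑-reverse S D = List.filter-≐ (above? (reverse D)) (above? D) (all-reverse⁻ , all-reverse) S

  -- Duality keeps the balanced blocks, interchanges the upper with the lower one, and reads the
  -- zigzag as D C instead of C D; `commute-path` repairs the latter.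
  V-dual : ∀ S n → Op.V S n ≈ V S n
  V-dual S n = trans (∑-cong (splits n) λ (r , t) → ∑-cong (splits r) λ (s , k) → summand s k t)
    (sym (∑-splits-reverse n _))
    where
    summand : ∀ s k t →
      (∑-∑ S k (suc k) λ C D → guard (Op.path? C D)
        (Op.Balanced (S ⇑ D) s * (Op.col D * Op.col C * Op.Balanced (S Opp.⇑ D) t))) ≈
      (∑-∑ S k (suc k) λ C D → guard (path? C D)
        (Balanced (S ⇑ D) s * (col C * col D) * Balanced (S Opp.⇑ D) t))
    summand s k t = trans (∑-words-reverse S k _) (∑-cong (words S k) λ C →
      trans (∑-words-reverse S (suc k) _) (∑-cong (words S (suc k)) λ D →
        guard-cong (Op.path? (reverse C) (reverse D)) (path? C D) (path-reverse⁻ C D) (path-reverse⁺ C D)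
          λ p → begin
            Op.Balanced (S ⇑ reverse D) s * (Op.col (reverse D) * Op.col (reverse C) * Op.Balanced
                (S Opp.⇑ reverse D) t)
              ≈⟨ *-cong (trans (reflexive (cong (λ S′ → Op.Balanced S′ s) (⇑-reverse S D))) (Balanced-dual (S ⇑ D) s))
                   (*-cong (trans (*-cong (col-reverse D) (col-reverse C)) (commute-path C D (path-reverse⁻ C D p)))
                     (trans (reflexive (cong (λ S′ → Op.Balanced S′ t)
                        (List.filter-≐ (Opp.above? (reverse D)) (Opp.above? D) (all-reverse⁻ , all-reverse) S)))
                       (Balanced-dual (S Opp.⇑ D) t))) ⟩
            Balanced (S ⇑ D) s * (col C * col D * Balanced (S Opp.⇑ D) t)
              ≈⟨ *-assoc _ _ _ ⟨
            Balanced (S ⇑ D) s * (col C * col D) * Balanced (S Opp.⇑ D) t ∎))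

  T-dual : ∀ b S n r → n ℕ.≤ b → Op.T b S (+ n ⊝ r) (+ n ⊝ r) ≈ T b S (+ n ⊝ r) (+ n ⊝ r)
  T-dual b S n r n≤b = trans (Op.T-square-⊝ b S n r n≤b) (trans (dual (+ n ⊝ r)) (sym (T-square-⊝ b S n r n≤b)))
    where
    dual : ∀ z → Op.Balancedℤ S z ≈ Balancedℤ S z
    dual (+ k)    = Balanced-dual S k
    dual -[1+ _ ] = ≈-refl

  Λ-zero : ∀ b S h → (∀ r S′ → h r S′ ≈ 0#) → Λ b S h ≈ 0#
  Λ-zero b S h eq = ∑-zero (indices b) λ r → ∑-zero (words S r) λ M → ∑-zero (words S (suc r)) λ N →
    trans (guard-congʳ (head? M N) λ _ → trans (*-congʳ (eq r (S ⇑ N))) (zeroˡ _)) (guard-0 (head? M N))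

  -- For n < m the right column is too long in both algebras and everything vanishes. For n = m the
  -- flawless pairs are balanced, and both sides are evaluations of the self-dual sum `V`.
  Λ-T : ∀ b S n m → n ℕ.≤ m → m ℕ.< b →
    Op.Λ b S (λ r S′ → T b S′ (+ n ⊝ r) (+ m ⊝ r)) ≈ Λ b S (λ s S′ → Op.T b S′ (+ n ⊝ s) (+ m ⊝ s))
  Λ-T b S n m n≤m m<b with ℕ.m≤n⇒m<n∨m≡n n≤m
  ... | inj₁ n<m = trans
    (∑-zero (indices b) λ r → ∑-zero (words S r) λ M → ∑-zero (words S (suc r)) λ N →
      trans (guard-congʳ (Op.head? M N) λ _ → trans (*-congˡ (T-zero b (S Op.⇑ N) n m r n<m (ℕ.<⇒≤ m<b))) (zeroʳ _))
            (guard-0 (Op.head? M N)))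
    (sym (Λ-zero b S _ λ s S′ → Op.T-zero b S′ n m s n<m (ℕ.<⇒≤ m<b)))
  ... | inj₂ refl = begin
    Op.Λ b S (λ r S′ → T b S′ (+ n ⊝ r) (+ n ⊝ r))    ≈⟨ Op.Λ-cong b S (λ r S′ → T-dual b S′ n r (ℕ.<⇒≤ m<b)) ⟨
    Op.Λ b S (λ r S′ → Op.T b S′ (+ n ⊝ r) (+ n ⊝ r)) ≈⟨ Op.Λ-balanced b S n m<b ⟩
    Op.V S n                                          ≈⟨ V-dual S n ⟩
    V S n                                             ≈⟨ Λ-balanced b S n m<b ⟨
    Λ b S (λ s S′ → T b S′ (+ n ⊝ s) (+ n ⊝ s))       ≈⟨ Λ-cong b S (λ r S′ → T-dual b S′ n r (ℕ.<⇒≤ m<b)) ⟨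
    Λ b S (λ s S′ → Op.T b S′ (+ n ⊝ s) (+ n ⊝ s))    ∎

  Commutes : List A → ℤ → ℤ → Set
  Commutes S p q = e S p * e S q ≈ e S q * e S p

  commutes-negative : ∀ S z r q → Commutes S (-[1+ z ] ⊝ r) q
  commutes-negative S z zero    q = trans (zeroˡ _) (sym (zeroʳ _))
  commutes-negative S z (suc r) q = commutes-negative S (suc z) r q

  commutes-⊝ : ∀ S k → (∀ m n → m ℕ.+ n ℕ.< k → Commutes S (+ m) (+ n)) →
               ∀ m n r s → m ℕ.+ n ℕ.< k → Commutes S (+ m ⊝ r) (+ n ⊝ s)
  commutes-⊝ S k comm m       n       zero    zero    l = comm m n l
  commutes-⊝ S k comm zero    n       (suc r) s       l = commutes-negative S 0 r (+ n ⊝ s)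
  commutes-⊝ S k comm (suc m) n       (suc r) s       l = commutes-⊝ S k comm m n r s (ℕ.<-trans (ℕ.n<1+n _) l)
  commutes-⊝ S k comm m       zero    zero    (suc s) l = sym (commutes-negative S 0 s (+ m))
  commutes-⊝ S k comm m       (suc n) zero    (suc s) l =
    commutes-⊝ S k comm m n zero s (ℕ.<-trans (ℕ.+-monoʳ-< m (ℕ.n<1+n n)) l)

  -- After a cut with r good rows the tails have total height m + n - 2r, less than the original
  -- total by at least one. They live in smaller sub-posets, so the induction hypothesis has to
  -- cover every S.
  commutes-step : ∀ S m n → n ℕ.≤ m →
    (∀ S m′ n′ → m′ ℕ.+ n′ ℕ.< suc m ℕ.+ n → Commutes S (+ m′) (+ n′)) →
    Commutes S (+ suc m) (+ n)
  commutes-step S m n n≤m comm = begin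
    e S (+ suc m) * e S (+ n)
      ≈⟨ *-cong (e-dual S (+ suc m)) (e-dual S (+ n)) ⟨
    Op.e S (+ suc m) * Op.e S (+ n)
      ≈⟨ Op.e-* b S (+ n) (+ suc m) ⟩
    Op.T b S (+ n) (+ suc m) + Op.Λ b S (λ r S′ → Op.e S′ (+ m ⊝ r) * Op.e S′ (+ n ⊝ r))
      ≈⟨ trans (+-congʳ (Op.T-zero b S n (suc m) 0 (ℕ.s≤s n≤m) ℕ.≤-refl)) (+-identityˡ _) ⟩
    Op.Λ b S (λ r S′ → Op.e S′ (+ m ⊝ r) * Op.e S′ (+ n ⊝ r))
      ≈⟨ Op.Λ-cong b S (λ r S′ → trans (*-cong (e-dual S′ (+ m ⊝ r)) (e-dual S′ (+ n ⊝ r)))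
           (trans (smaller S′ r r) (e-* b S′ (+ n ⊝ r) (+ m ⊝ r)))) ⟩
    Op.Λ b S (λ r S′ → T b S′ (+ n ⊝ r) (+ m ⊝ r) + Λ b S′ (inner r))
      ≈⟨ Op.Λ-+ b S (λ r S′ → T b S′ (+ n ⊝ r) (+ m ⊝ r)) (λ r S′ → Λ b S′ (inner r)) ⟩
    Op.Λ b S (λ r S′ → T b S′ (+ n ⊝ r) (+ m ⊝ r)) + Op.Λ b S (λ r S′ → Λ b S′ (inner r))
      ≈⟨ +-cong (Λ-T b S n m n≤m ℕ.≤-refl) (Λ-exchange b S inner) ⟩
    Λ b S (λ s S′ → Op.T b S′ (+ n ⊝ s) (+ m ⊝ s)) + Λ b S (λ s S′ → Op.Λ b S′ λ r → inner r s)
      ≈⟨ Λ-+ b S (λ s S′ → Op.T b S′ (+ n ⊝ s) (+ m ⊝ s)) (λ s S′ → Op.Λ b S′ λ r → inner r s) ⟨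
    Λ b S (λ s S′ → Op.T b S′ (+ n ⊝ s) (+ m ⊝ s) + Op.Λ b S′ λ r → inner r s)
      ≈⟨ Λ-cong b S (λ s S′ → trans (+-congˡ (Op.Λ-cong b S′ λ r S″ → inner-swap r s S″))
           (trans (sym (Op.e-* b S′ (+ n ⊝ s) (+ m ⊝ s)))
             (trans (*-cong (e-dual S′ (+ m ⊝ s)) (e-dual S′ (+ n ⊝ s))) (smaller S′ s s)))) ⟩
    Λ b S (λ s S′ → e S′ (+ n ⊝ s) * e S′ (+ m ⊝ s))
      ≈⟨ trans (+-congʳ (T-zero b S n (suc m) 0 (ℕ.s≤s n≤m) ℕ.≤-refl)) (+-identityˡ _) ⟨
    T b S (+ n) (+ suc m) + Λ b S (λ s S′ → e S′ (+ n ⊝ s) * e S′ (+ m ⊝ s))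
      ≈⟨ e-* b S (+ n) (+ suc m) ⟨
    e S (+ n) * e S (+ suc m) ∎
    where
    -- The height of the longest column involved, so that no flaw is overlooked.
    b : ℕ
    b = suc m
    inner : ℕ → ℕ → List A → Carrier
    inner r s S″ = e S″ (+ n ⊝ r ⊝ s) * e S″ (+ m ⊝ r ⊝ suc s)
    smaller : ∀ S r s → Commutes S (+ m ⊝ r) (+ n ⊝ s)
    smaller S r s = commutes-⊝ S _ (comm S) m n r s ℕ.≤-refl
    -- Both heights depend on r + s alone, so the two cuts may trade places; the order of the two
    -- factors, which differs, is restored by the induction hypothesis.
    inner-swap : ∀ r s S″ → inner r s S″ ≈ Op.e S″ (+ m ⊝ s ⊝ suc r) * Op.e S″ (+ n ⊝ s ⊝ r)
    inner-swap r s S″ = begin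
      e S″ (+ n ⊝ r ⊝ s) * e S″ (+ m ⊝ r ⊝ suc s)
        ≡⟨ cong₂ (λ x y → e S″ x * e S″ y) (⊝-⊝ (+ n) r s) (⊝-⊝ (+ m) r (suc s)) ⟩
      e S″ (+ n ⊝ (r ℕ.+ s)) * e S″ (+ m ⊝ (r ℕ.+ suc s))
        ≈⟨ smaller S″ (r ℕ.+ suc s) (r ℕ.+ s) ⟨
      e S″ (+ m ⊝ (r ℕ.+ suc s)) * e S″ (+ n ⊝ (r ℕ.+ s))
        ≡⟨ cong₂ (λ x y → e S″ (+ m ⊝ x) * e S″ (+ n ⊝ y))
             (≡.trans (ℕ.+-suc r s) (≡.trans (cong suc (ℕ.+-comm r s)) (≡.sym (ℕ.+-suc s r)))) (ℕ.+-comm r s) ⟩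
      e S″ (+ m ⊝ (s ℕ.+ suc r)) * e S″ (+ n ⊝ (s ℕ.+ r))
        ≡⟨ cong₂ (λ x y → e S″ x * e S″ y) (⊝-⊝ (+ m) s (suc r)) (⊝-⊝ (+ n) s r) ⟨
      e S″ (+ m ⊝ s ⊝ suc r) * e S″ (+ n ⊝ s ⊝ r)
        ≈⟨ *-cong (e-dual S″ (+ m ⊝ s ⊝ suc r)) (e-dual S″ (+ n ⊝ s ⊝ r)) ⟨
      Op.e S″ (+ m ⊝ s ⊝ suc r) * Op.e S″ (+ n ⊝ s ⊝ r) ∎

  -- The induction runs over a bound for the sum, because a cut shortens both columns and the roles
  -- of m and n are interchanged on the way.
  commutes-bounded : ∀ k S m n → m ℕ.+ n ℕ.< k → Commutes S (+ m) (+ n)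
  commutes-bounded (suc k) S m n (ℕ.s≤s l) with ℕ.<-cmp m n
  commutes-bounded (suc k) S m n (ℕ.s≤s l) | tri≈ _ refl _ = ≈-refl
  commutes-bounded (suc k) S (suc m) n (ℕ.s≤s l) | tri> _ _ (ℕ.s≤s n≤m) =
    commutes-step S m n n≤m λ S′ m′ n′ l′ → commutes-bounded k S′ m′ n′ (ℕ.<-≤-trans l′ l)
  commutes-bounded (suc k) S m (suc n) (ℕ.s≤s l) | tri< (ℕ.s≤s m≤n) _ _ =
    sym (commutes-step S n m m≤n λ S′ m′ n′ l′ → commutes-bounded k S′ m′ n′
      (ℕ.<-≤-trans l′ (subst (ℕ._≤ k) (ℕ.+-comm m (suc n)) l)))

  e-comm : ∀ S p q → e S p * e S q ≈ e S q * e S p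
  e-comm S (+ m)    (+ n)    = commutes-bounded _ S m n ℕ.≤-refl
  e-comm S -[1+ z ] q        = commutes-negative S z 0 q
  e-comm S (+ m)    -[1+ z ] = sym (commutes-negative S z 0 (+ m))

-- Arrays of columns and their flaws.

module Arrays (P : PlacticAlgebra) where
  open Commutation P public
  open import Relation.Binary.Reasoning.Setoid setoid

  Array : Set
  Array = List (List A)

  arrays : List A → List ℤ → List Array
  arrays S []       = [ [] ]
  arrays S (z ∷ zs) = cartesianProductWith _∷_ (wordsℤ S z) (arrays S zs)

  columns : Array → Carrier
  columns []       = 1#
  columns (C ∷ Cs) = col C * columns Cs

  columns-++ : ∀ Cs Ds → columns (Cs ++ Ds) ≈ columns Cs * columns Ds
  columns-++ []       Ds = sym (*-identityˡ _)
  columns-++ (C ∷ Cs) Ds = trans (*-congˡ (columns-++ Cs Ds)) (sym (*-assoc _ _ _))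

  chains? : ∀ Cs → Dec (All Chain Cs)
  chains? = All.all? chain?

  term : Array → Carrier
  term Cs = guard (chains? Cs) (columns Cs)

  ∏e : List A → List ℤ → Carrier
  ∏e S []       = 1#
  ∏e S (z ∷ zs) = e S z * ∏e S zs

  ∑-arrays-∷ : ∀ S z zs f → ∑ (arrays S (z ∷ zs)) f ≈ (∑[ C ∈ wordsℤ S z ] ∑[ Cs ∈ arrays S zs ] f (C ∷ Cs))
  ∑-arrays-∷ S z zs f = ∑-cartesianProductWith _∷_ (wordsℤ S z) (arrays S zs) f

  ∑-arrays-++ : ∀ S ls zs f →
    ∑ (arrays S (ls ++ zs)) f ≈ (∑[ Ls ∈ arrays S ls ] ∑[ Cs ∈ arrays S zs ] f (Ls ++ Cs))
  ∑-arrays-++ S []       zs f = sym (+-identityʳ _)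
  ∑-arrays-++ S (l ∷ ls) zs f = begin
    ∑ (arrays S (l ∷ ls ++ zs)) f
      ≈⟨ ∑-arrays-∷ S l (ls ++ zs) f ⟩
    (∑[ C ∈ wordsℤ S l ] ∑[ Cs ∈ arrays S (ls ++ zs) ] f (C ∷ Cs))
      ≈⟨ ∑-cong (wordsℤ S l) (λ C → ∑-arrays-++ S ls zs _) ⟩
    (∑[ C ∈ wordsℤ S l ] ∑[ Ls ∈ arrays S ls ] ∑[ Cs ∈ arrays S zs ] f (C ∷ Ls ++ Cs))
      ≈⟨ ∑-arrays-∷ S l ls _ ⟨
    (∑[ Ls ∈ arrays S (l ∷ ls) ] ∑[ Cs ∈ arrays S zs ] f (Ls ++ Cs)) ∎

  HasShape : Array → List ℤ → Set
  HasShape = Pointwise λ C z → + length C ≡ z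

  ∑-wordsℤ-cong : ∀ S z {f g} → (∀ C → + length C ≡ z → f C ≈ g C) → ∑ (wordsℤ S z) f ≈ ∑ (wordsℤ S z) g
  ∑-wordsℤ-cong S (+ k)    eq = ∑-words-cong S k λ C l → eq C (cong +_ l)
  ∑-wordsℤ-cong S -[1+ _ ] eq = ≈-refl

  ∑-arrays-cong : ∀ S zs {f g} → (∀ Cs → HasShape Cs zs → f Cs ≈ g Cs) → ∑ (arrays S zs) f ≈ ∑ (arrays S zs) g
  ∑-arrays-cong S []       eq = +-congʳ (eq [] [])
  ∑-arrays-cong S (z ∷ zs) eq = trans (∑-arrays-∷ S z zs _) (trans
    (∑-wordsℤ-cong S z λ C l → ∑-arrays-cong S zs λ Cs ls → eq (C ∷ Cs) (l ∷ ls))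
    (sym (∑-arrays-∷ S z zs _)))

  ∏e-arrays : ∀ S zs → ∏e S zs ≈ (∑[ Cs ∈ arrays S zs ] term Cs)
  ∏e-arrays S []       = sym (+-identityʳ _)
  ∏e-arrays S (z ∷ zs) = begin
    e S z * ∏e S zs
      ≈⟨ *-congˡ (∏e-arrays S zs) ⟩
    e S z * (∑[ Cs ∈ arrays S zs ] term Cs)
      ≈⟨ ∑-* (wordsℤ S z) (arrays S zs) _ _ ⟩
    (∑[ C ∈ wordsℤ S z ] ∑[ Cs ∈ arrays S zs ] guard (chain? C) (col C) * term Cs)
      ≈⟨ (∑-cong (wordsℤ S z) λ C → ∑-cong (arrays S zs) λ Cs → trans (guard-* (chain? C) (chains? Cs) _ _)
           (guard-cong (chain? C ×-dec chains? Cs) (chains? (C ∷ Cs)) (λ (c , cs) → c ∷ cs) All.uncons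
               (λ _ → ≈-refl))) ⟩
    (∑[ C ∈ wordsℤ S z ] ∑[ Cs ∈ arrays S zs ] term (C ∷ Cs))
      ≈⟨ ∑-arrays-∷ S z zs _ ⟨
    (∑[ Cs ∈ arrays S (z ∷ zs) ] term Cs) ∎

  Agree : ℕ → Array → Set
  Agree r = Linked (Tab≤ r)

  agree? : ∀ r Cs → Dec (Agree r Cs)
  agree? r = linked? (tab≤? r)

  -- At r c Cs: the first flaw of Cs occurs in row r + 1, and the rightmost one in
  -- that row between the columns with indices c and c + 1.
  At : ℕ → ℕ → Array → Set
  At r c       []           = ⊥
  At r c       (C ∷ [])     = ⊥
  At r zero    (C ∷ D ∷ Cs) = Flawed r C D × Agree (suc r) (D ∷ Cs)
  At r (suc c) (C ∷ D ∷ Cs) = Tab≤ r C D × At r c (D ∷ Cs)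

  at? : ∀ r c Cs → Dec (At r c Cs)
  at? r c       []           = no id
  at? r c       (C ∷ [])     = no id
  at? r zero    (C ∷ D ∷ Cs) = flawed? r C D ×-dec agree? (suc r) (D ∷ Cs)
  at? r (suc c) (C ∷ D ∷ Cs) = tab≤? r C D ×-dec at? r c (D ∷ Cs)

  at⇒length : ∀ r c Cs → At r c Cs → suc (suc c) ℕ.≤ length Cs
  at⇒length r zero    (C ∷ D ∷ Cs) _       = ℕ.s≤s (ℕ.s≤s ℕ.z≤n)
  at⇒length r (suc c) (C ∷ D ∷ Cs) (_ , a) = ℕ.s≤s (at⇒length r c (D ∷ Cs) a)

  agree-pred : ∀ r {Cs} → Agree (suc r) Cs → Agree r Cs
  agree-pred r = Linked.map (tab≤-pred r _ _)

  -- If the columns from the second one on still agree in the flawed row, the flaw lies between the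
  -- first two; otherwise it is looked for further to the right. So exactly one c is counted.
  ∑-at : ∀ r Cs x → guard (agree? r Cs ×-dec ¬? (agree? (suc r) Cs)) x ≈
                    (∑[ c ∈ indices (length Cs) ] guard (at? r c Cs) x)
  ∑-at r []           x = guard-no (agree? r [] ×-dec ¬? (agree? (suc r) [])) {x} λ (_ , n) → n []
  ∑-at r (C ∷ [])     x = trans (guard-no (agree? r (C ∷ []) ×-dec ¬? (agree? (suc r) (C ∷ []))) {x} λ (_ , n) →
      n [-])
                                (sym (+-identityˡ _))
  ∑-at r (C ∷ D ∷ Cs) x = begin
    guard p? x
      ≈⟨ guard-split q? (guard p? x) ⟩
    guard q? (guard p? x) + guard (¬? q?) (guard p? x)
      ≈⟨ +-cong (trans (guard-× q? p? x) (guard-cong (q? ×-dec p?) (at? r 0 (C ∷ D ∷ Cs))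
                  (λ { (q , (t ∷ _) , n) → (t , λ t′ → n (t′ ∷ q)) , q })
                  (λ { ((t , n) , q) → q , (t ∷ agree-pred r q) , λ { (t′ ∷ _) → n t′ } }) (λ _ → ≈-refl)))
                (trans (guard-× (¬? q?) p? x) (trans (guard-cong (¬? q? ×-dec p?) (tab≤? r C D ×-dec p′?)
                  (λ { (n , (t ∷ l) , _) → t , l , n })
                  (λ { (t , l , n) → n , (t ∷ l) , λ { (_ ∷ l′) → n l′ } }) (λ _ → ≈-refl))
                  (sym (guard-× (tab≤? r C D) p′? x)))) ⟩
    guard (at? r 0 (C ∷ D ∷ Cs)) x + guard (tab≤? r C D) (guard p′? x)
      ≈⟨ +-congˡ (trans (guard-congʳ (tab≤? r C D) λ _ → ∑-at r (D ∷ Cs) x)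
           (trans (guard-∑ (tab≤? r C D) (indices (suc (length Cs))) _)
             (∑-cong (indices (suc (length Cs))) λ c → guard-× (tab≤? r C D) (at? r c (D ∷ Cs)) x))) ⟩
    guard (at? r 0 (C ∷ D ∷ Cs)) x + (∑[ c ∈ indices (length (D ∷ Cs)) ] guard (at? r (suc c) (C ∷ D ∷ Cs)) x)
      ≈⟨ ∑-indices-suc (length (D ∷ Cs)) _ ⟨
    (∑[ c ∈ indices (length (C ∷ D ∷ Cs)) ] guard (at? r c (C ∷ D ∷ Cs)) x) ∎
    where
    p? = agree? r (C ∷ D ∷ Cs) ×-dec ¬? (agree? (suc r) (C ∷ D ∷ Cs))
    p′? = agree? r (D ∷ Cs) ×-dec ¬? (agree? (suc r) (D ∷ Cs))
    q? = agree? (suc r) (D ∷ Cs)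

  flawless : ℕ → List A → List ℤ → Carrier
  flawless b S zs = ∑[ Cs ∈ arrays S zs ] guard (agree? b Cs) (term Cs)

  flawedAt : ℕ → ℕ → List A → List ℤ → Carrier
  flawedAt r c S zs = ∑[ Cs ∈ arrays S zs ] guard (at? r c Cs) (term Cs)

  agree-0 : ∀ Cs → Agree 0 Cs
  agree-0 []           = []
  agree-0 (C ∷ [])     = [-]
  agree-0 (C ∷ D ∷ Cs) = tt ∷ agree-0 (D ∷ Cs)

  ∏e-decomposition : ∀ b S zs → ∏e S zs ≈
    flawless b S zs + (∑[ r ∈ indices b ] ∑[ c ∈ indices (length zs) ] flawedAt r c S zs)
  ∏e-decomposition b S zs = begin
    ∏e S zs
      ≈⟨ ∏e-arrays S zs ⟩
    (∑[ Cs ∈ arrays S zs ] term Cs)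
      ≈⟨ (∑-arrays-cong S zs λ Cs sh → trans (sym (guard-yes (agree? 0 Cs) (agree-0 Cs)))
           (trans (telescope (λ r → agree? r Cs) (λ r → agree-pred r) b (term Cs))
             (+-congˡ (∑-cong (indices b) λ r → trans (∑-at r Cs (term Cs))
               (reflexive (cong (λ n → ∑ (indices n) λ c → guard (at? r c Cs) (term Cs))
                   (Pointwise.Pointwise-length sh))))))) ⟩
    (∑[ Cs ∈ arrays S zs ] (guard (agree? b Cs) (term Cs) +
      (∑[ r ∈ indices b ] ∑[ c ∈ indices (length zs) ] guard (at? r c Cs) (term Cs))))
      ≈⟨ ∑-+ (arrays S zs) _ _ ⟩
    flawless b S zs + (∑[ Cs ∈ arrays S zs ] ∑[ r ∈ indices b ] ∑[ c ∈ indices (length zs) ] guard (at? r c Cs)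
        (term Cs))
      ≈⟨ +-congˡ (trans (∑-swap (arrays S zs) (indices b) _)
           (∑-cong (indices b) λ r → ∑-swap (arrays S zs) (indices (length zs)) _)) ⟩
    flawless b S zs + (∑[ r ∈ indices b ] ∑[ c ∈ indices (length zs) ] flawedAt r c S zs) ∎

  at-split : ∀ r Ls {C D Cs} → At r (length Ls) (Ls ++ C ∷ D ∷ Cs) →
             Agree r (Ls ++ C ∷ []) × Flawed r C D × Agree (suc r) (D ∷ Cs)
  at-split r []            (f , l) = [-] , f , l
  at-split r (L ∷ [])      (t , a) with at-split r [] a
  ... | _ , f , l = (t ∷ [-]) , f , l
  at-split r (L ∷ L′ ∷ Ls) (t , a) with at-split r (L′ ∷ Ls) a
  ... | l′ , f , l = (t ∷ l′) , f , l

  at-join : ∀ r Ls {C D Cs} → Agree r (Ls ++ C ∷ []) → Flawed r C D → Agree (suc r) (D ∷ Cs) →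
            At r (length Ls) (Ls ++ C ∷ D ∷ Cs)
  at-join r []            _        f l = f , l
  at-join r (L ∷ [])      (t ∷ _)  f l = t , f , l
  at-join r (L ∷ L′ ∷ Ls) (t ∷ l′) f l = t , at-join r (L′ ∷ Ls) l′ f l

  tab≤-cutʳ⁺ : ∀ r C M {X} → length M ≡ r → Tab≤ r C M → Tab≤ r C (M ++ X)
  tab≤-cutʳ⁺ zero    C       M       l t       = tt
  tab≤-cutʳ⁺ (suc r) (c ∷ C) (m ∷ M) l (n , t) = n , tab≤-cutʳ⁺ r C M (ℕ.suc-injective l) t

  tab≤-cutʳ⁻ : ∀ r C M {X} → length M ≡ r → Tab≤ r C (M ++ X) → Tab≤ r C M
  tab≤-cutʳ⁻ zero    C       M       l t       = tt
  tab≤-cutʳ⁻ (suc r) (c ∷ C) (m ∷ M) l (n , t) = n , tab≤-cutʳ⁻ r C M (ℕ.suc-injective l) t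

  tab≤-cutˡ⁺ : ∀ r N C {Y} → length N ≡ r → Tab≤ r N C → Tab≤ r (N ++ Y) C
  tab≤-cutˡ⁺ zero    N       C       l t       = tt
  tab≤-cutˡ⁺ (suc r) N       []      l t       = tt
  tab≤-cutˡ⁺ (suc r) (m ∷ N) (c ∷ C) l (n , t) = n , tab≤-cutˡ⁺ r N C (ℕ.suc-injective l) t

  tab≤-cutˡ⁻ : ∀ r N C {Y} → length N ≡ r → Tab≤ r (N ++ Y) C → Tab≤ r N C
  tab≤-cutˡ⁻ zero    N       C       l t       = tt
  tab≤-cutˡ⁻ (suc r) N       []      l t       = tt
  tab≤-cutˡ⁻ (suc r) (m ∷ N) (c ∷ C) l (n , t) = n , tab≤-cutˡ⁻ r N C (ℕ.suc-injective l) t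

  linked-last : {B : Set} {_~_ : B → B → Set} (Ls : List B) {C D : B} →
                (∀ L → L ~ C → L ~ D) → Linked _~_ (Ls ++ C ∷ []) → Linked _~_ (Ls ++ D ∷ [])
  linked-last []            f l       = [-]
  linked-last (L ∷ [])      f (t ∷ _) = f L t ∷ [-]
  linked-last (L ∷ L′ ∷ Ls) f (t ∷ l) = t ∷ linked-last (L′ ∷ Ls) f l

  linked-first : {B : Set} {_~_ : B → B → Set} {C D : B} {Rs : List B} →
                 (∀ R → C ~ R → D ~ R) → Linked _~_ (C ∷ Rs) → Linked _~_ (D ∷ Rs)
  linked-first f [-]     = [-]
  linked-first f (t ∷ l) = f _ t ∷ l

  -- The neighbours only see the heads: columns on the left are compared with r entries of C, which
  -- are M, and columns on the right with r + 1 entries of D, which are N. This is the reason for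
  -- taking the rightmost flaw of the first flawed row: the tails can be summed without regard to
  -- the rest of the array.
  flawedAt-pair : ∀ r S ls rs p q → flawedAt r (length ls) S (ls ++ p ∷ q ∷ rs) ≈
    (∑[ Ls ∈ arrays S ls ] ∑[ Rs ∈ arrays S rs ] ∑[ M ∈ words S r ] ∑[ N ∈ words S (suc r) ]
      guard ((agree? r (Ls ++ M ∷ []) ×-dec agree? (suc r) (N ∷ Rs)) ×-dec (chains? Ls ×-dec chains? Rs))
        (columns Ls * guard (head? M N) (e (S ⇑ N) (p ⊝ r) * e (S ⇑ N) (q ⊝ suc r) * (col M * col N)) * columns Rs))
  flawedAt-pair r S ls rs p q = begin
    flawedAt r (length ls) S (ls ++ p ∷ q ∷ rs)
      ≈⟨ ∑-arrays-++ S ls (p ∷ q ∷ rs) _ ⟩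
    (∑[ Ls ∈ arrays S ls ] ∑[ Cs ∈ arrays S (p ∷ q ∷ rs) ] guard (at? r (length ls) (Ls ++ Cs)) (term (Ls ++ Cs)))
      ≈⟨ (∑-arrays-cong S ls λ Ls sh → trans (∑-arrays-∷ S p (q ∷ rs) _) (trans
           (∑-cong (wordsℤ S p) λ C → trans (∑-arrays-∷ S q rs _) (trans
             (∑-cong (wordsℤ S q) λ D → ∑-cong (arrays S rs) λ Rs → trans
               (reflexive (cong (λ n → guard (at? r n (Ls ++ C ∷ D ∷ Rs)) (term (Ls ++ C ∷ D ∷ Rs)))
                   (≡.sym (Pointwise.Pointwise-length sh))))
               (separate Ls C D Rs))
             (∑-swap (wordsℤ S q) (arrays S rs) _)))
           (∑-swap (wordsℤ S p) (arrays S rs) _))) ⟩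
    (∑[ Ls ∈ arrays S ls ] ∑[ Rs ∈ arrays S rs ] ∑[ C ∈ wordsℤ S p ] ∑[ D ∈ wordsℤ S q ]
      guard (flawed? r C D) (pair Ls Rs C D))
      ≈⟨ (∑-cong (arrays S ls) λ Ls → ∑-cong (arrays S rs) λ Rs → trans (∑-cut S r p q (pair Ls Rs))
           (∑-∑-cong S r (suc r) λ M N lM lN → trans
             (∑-cong (wordsℤ S (p ⊝ r)) λ X → ∑-cong (wordsℤ S (q ⊝ suc r)) λ Y → localise Ls Rs M N X Y lM lN)
             (trans (collect (wordsℤ S (p ⊝ r)) (wordsℤ S (q ⊝ suc r)) (context? Ls Rs M N) (columns Ls)
                 (columns Rs) _)
               (guard-congʳ (context? Ls Rs M N) λ _ → *-congʳ (*-congˡ (∑-block S M N (p ⊝ r) (q ⊝ suc r))))))) ⟩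
    (∑[ Ls ∈ arrays S ls ] ∑[ Rs ∈ arrays S rs ] ∑[ M ∈ words S r ] ∑[ N ∈ words S (suc r) ]
      guard (context? Ls Rs M N)
        (columns Ls * guard (head? M N) (e (S ⇑ N) (p ⊝ r) * e (S ⇑ N) (q ⊝ suc r) * (col M * col N)) * columns Rs)) ∎
    where
    context? : ∀ Ls Rs C D → Dec ((Agree r (Ls ++ C ∷ []) × Agree (suc r) (D ∷ Rs)) × (All Chain Ls × All Chain Rs))
    context? Ls Rs C D = (agree? r (Ls ++ C ∷ []) ×-dec agree? (suc r) (D ∷ Rs)) ×-dec (chains? Ls ×-dec chains? Rs)

    pair : Array → Array → List A → List A → Carrier
    pair Ls Rs C D = guard (context? Ls Rs C D)
        (guard (chain? C ×-dec chain? D) (columns Ls * (col C * col D) * columns Rs))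

    separate : ∀ Ls C D Rs → guard (at? r (length Ls) (Ls ++ C ∷ D ∷ Rs)) (term (Ls ++ C ∷ D ∷ Rs)) ≈
                             guard (flawed? r C D) (pair Ls Rs C D)
    separate Ls C D Rs = begin
      guard (at? r (length Ls) (Ls ++ C ∷ D ∷ Rs)) (term (Ls ++ C ∷ D ∷ Rs))
        ≈⟨ guard-× (at? r (length Ls) (Ls ++ C ∷ D ∷ Rs)) (chains? (Ls ++ C ∷ D ∷ Rs)) _ ⟩
      guard (at? r (length Ls) (Ls ++ C ∷ D ∷ Rs) ×-dec chains? (Ls ++ C ∷ D ∷ Rs)) (columns (Ls ++ C ∷ D ∷ Rs))
        ≈⟨ guard-cong (at? r (length Ls) (Ls ++ C ∷ D ∷ Rs) ×-dec chains? (Ls ++ C ∷ D ∷ Rs))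
             (flawed? r C D ×-dec (context? Ls Rs C D ×-dec (chain? C ×-dec chain? D)))
             (λ (a , c) → to (at-split r Ls a) (All.++⁻ Ls c))
             (λ { (f , ((l , l′) , (cL , cR)) , (cC , cD)) → at-join r Ls l f l′ , All.++⁺ cL (cC ∷ cD ∷ cR) })
             (λ _ → trans (columns-++ Ls (C ∷ D ∷ Rs)) (regroup (columns Ls) (col C) (col D) (columns Rs))) ⟩
      guard (flawed? r C D ×-dec (context? Ls Rs C D ×-dec (chain? C ×-dec chain? D)))
          (columns Ls * (col C * col D) * columns Rs)
        ≈⟨ trans (guard-congʳ (flawed? r C D) λ _ → guard-× (context? Ls Rs C D) (chain? C ×-dec chain? D) _)
             (guard-× (flawed? r C D) (context? Ls Rs C D ×-dec (chain? C ×-dec chain? D)) _) ⟨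
      guard (flawed? r C D) (pair Ls Rs C D) ∎
      where
      to : Agree r (Ls ++ C ∷ []) × Flawed r C D × Agree (suc r) (D ∷ Rs) → All Chain Ls × All Chain (C ∷ D ∷ Rs) →
           Flawed r C D × (((Agree r (Ls ++ C ∷ []) × Agree (suc r) (D ∷ Rs)) × (All Chain Ls × All Chain Rs)) ×
               (Chain C × Chain D))
      to (l , f , l′) (cL , cC ∷ cD ∷ cR) = f , ((l , l′) , (cL , cR)) , (cC , cD)
      regroup : ∀ l c d s → l * (c * (d * s)) ≈ l * (c * d) * s
      regroup l c d s = solve *-monoid

    localise : ∀ Ls Rs M N X Y → length M ≡ r → length N ≡ suc r →
      guard (flawAt? M N X) (pair Ls Rs (M ++ X) (N ++ Y)) ≈
      guard (context? Ls Rs M N) (columns Ls *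
        guard (flawAt? M N X ×-dec chain? (M ++ X) ×-dec chain? (N ++ Y)) (col (M ++ X) * col (N ++ Y)) * columns Rs)
    localise Ls Rs M N X Y lM lN = begin
      guard (flawAt? M N X) (pair Ls Rs (M ++ X) (N ++ Y))
        ≈⟨ guard-congʳ (flawAt? M N X) (λ _ → guard-cong (context? Ls Rs (M ++ X) (N ++ Y)) (context? Ls Rs M N)
             (λ ((l , l′) , c) → (linked-last Ls (λ L → tab≤-cutʳ⁻ r L M lM) l , linked-first
                 (λ R → tab≤-cutˡ⁻ (suc r) N R lN) l′) , c)
             (λ ((l , l′) , c) → (linked-last Ls (λ L → tab≤-cutʳ⁺ r L M lM) l , linked-first
                 (λ R → tab≤-cutˡ⁺ (suc r) N R lN) l′) , c)
             (λ _ → ≈-refl)) ⟩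
      guard (flawAt? M N X) (guard (context? Ls Rs M N) (guard cc? (columns Ls * w * columns Rs)))
        ≈⟨ guard-swap (flawAt? M N X) (context? Ls Rs M N) _ ⟩
      guard (context? Ls Rs M N) (guard (flawAt? M N X) (guard cc? (columns Ls * w * columns Rs)))
        ≈⟨ guard-congʳ (context? Ls Rs M N) (λ _ → trans (guard-× (flawAt? M N X) cc? _)
             (trans (sym (guard-*ʳ (flawAt? M N X ×-dec cc?) _ _))
                 (*-congʳ (sym (guard-*ˡ (flawAt? M N X ×-dec cc?) _ _))))) ⟩
      guard (context? Ls Rs M N) (columns Ls * guard (flawAt? M N X ×-dec cc?) w * columns Rs) ∎
      where
      cc? = chain? (M ++ X) ×-dec chain? (N ++ Y)
      w : Carrier
      w = col (M ++ X) * col (N ++ Y)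

    collect : {Q : Set} (Xs Ys : List (List A)) (q : Dec Q) (l s : Carrier) (f : List A → List A → Carrier) →
      (∑[ X ∈ Xs ] ∑[ Y ∈ Ys ] guard q (l * f X Y * s)) ≈ guard q (l * (∑[ X ∈ Xs ] ∑[ Y ∈ Ys ] f X Y) * s)
    collect Xs Ys q l s f = trans
      (trans (∑-cong Xs λ X → sym (guard-∑ q Ys _)) (sym (guard-∑ q Xs _)))
      (guard-congʳ q λ _ → trans (∑-cong Xs λ X → trans (sym (∑-*ʳ s Ys _)) (*-congʳ (sym (∑-*ˡ l Ys _))))
        (trans (sym (∑-*ʳ s Xs _)) (*-congʳ (sym (∑-*ˡ l Xs _)))))

  -- Over the same heads the two tail heights are interchanged, and `e-comm` holds in the sub-poset
  -- of the tails.
  flawedAt-exchange : ∀ r S ls rs p q →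
    flawedAt r (length ls) S (ls ++ p ∷ q ∷ rs) ≈ flawedAt r (length ls) S (ls ++ ℤ.pred q ∷ ℤ.suc p ∷ rs)
  flawedAt-exchange r S ls rs p q = begin
    flawedAt r (length ls) S (ls ++ p ∷ q ∷ rs)
      ≈⟨ flawedAt-pair r S ls rs p q ⟩
    -- `q ⊝ suc r` is `ℤ.pred q ⊝ r` by definition, so only the other height has to be rewritten.
    _ ≈⟨ (∑-cong (arrays S ls) λ Ls → ∑-cong (arrays S rs) λ Rs → ∑-∑-cong₁ S r (suc r) λ M N →
          guard-congʳ ((agree? r (Ls ++ M ∷ []) ×-dec agree? (suc r) (N ∷ Rs)) ×-dec (chains? Ls ×-dec chains? Rs))
              λ _ →
          *-congʳ (*-congˡ (guard-congʳ (head? M N) λ _ → *-congʳ (trans (e-comm (S ⇑ N) (p ⊝ r) (q ⊝ suc r))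
            (*-congˡ (reflexive (cong (λ z → e (S ⇑ N) (z ⊝ r)) (≡.sym (ℤ.pred-suc p))))))))) ⟩
    _ ≈⟨ flawedAt-pair r S ls rs (ℤ.pred q) (ℤ.suc p) ⟨
    flawedAt r (length ls) S (ls ++ ℤ.pred q ∷ ℤ.suc p ∷ rs) ∎

-- Signs of words and alternating sums.

inversionsᴸ : ∀ {k} → List (Fin k) → ℕ
inversionsᴸ []      = 0
inversionsᴸ (i ∷ w) = length (filter (Fin._<? i) w) ℕ.+ inversionsᴸ w

Distinct : {B : Set} → List B → Set
Distinct = AllPairs (λ i j → ¬ i ≡ j)

distinct? : ∀ {k} (w : List (Fin k)) → Dec (Distinct w)
distinct? = allPairs? λ i j → ¬? (i Fin.≟ j)

swap-↭ : {B : Set} (l : List B) {m : List B} {i j : B} → l ++ i ∷ j ∷ m ↭ l ++ j ∷ i ∷ m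
swap-↭ l = ++⁺ˡ l (_↭_.swap _ _ ↭-refl)

inversionsᴸ-swap : ∀ {k} l {m} {i j : Fin k} → i Fin.< j →
                   inversionsᴸ (l ++ j ∷ i ∷ m) ≡ suc (inversionsᴸ (l ++ i ∷ j ∷ m))
inversionsᴸ-swap [] {m} {i} {j} i<j = begin
  length (filter (Fin._<? j) (i ∷ m)) ℕ.+ (mᵢ ℕ.+ inversionsᴸ m)
    ≡⟨ cong (λ z → length z ℕ.+ (mᵢ ℕ.+ inversionsᴸ m)) (List.filter-accept (Fin._<? j) i<j) ⟩
  suc (mⱼ ℕ.+ (mᵢ ℕ.+ inversionsᴸ m))
    ≡⟨ cong suc (≡.trans (≡.sym (ℕ.+-assoc mⱼ mᵢ _)) (≡.trans (cong (ℕ._+ inversionsᴸ m) (ℕ.+-comm mⱼ mᵢ))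
         (ℕ.+-assoc mᵢ mⱼ _))) ⟩
  suc (mᵢ ℕ.+ (mⱼ ℕ.+ inversionsᴸ m))
    ≡⟨ cong (λ z → suc (length z ℕ.+ (mⱼ ℕ.+ inversionsᴸ m))) (List.filter-reject (Fin._<? i) (Fin.<-asym i<j)) ⟨
  suc (length (filter (Fin._<? i) (j ∷ m)) ℕ.+ (mⱼ ℕ.+ inversionsᴸ m)) ∎
  where
  open ≡.≡-Reasoning
  mᵢ = length (filter (Fin._<? i) m)
  mⱼ = length (filter (Fin._<? j) m)
inversionsᴸ-swap (h ∷ l) {m} {i} {j} i<j = ≡.trans
  (cong₂ ℕ._+_ (↭-length (filter-↭ (Fin._<? h) (swap-↭ l))) (inversionsᴸ-swap l i<j))
  (ℕ.+-suc _ _)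

distinct-swap : {B : Set} (l : List B) {m : List B} {i j : B} → Distinct (l ++ i ∷ j ∷ m) → Distinct (l ++ j ∷ i ∷ m)
distinct-swap []      ((i≢j ∷ i∉) ∷ j∉ ∷ d) = ((λ j≡i → i≢j (≡.sym j≡i)) ∷ j∉) ∷ i∉ ∷ d
distinct-swap (h ∷ l) (h∉ ∷ d)              = All-resp-↭ (swap-↭ l) h∉ ∷ distinct-swap l d

distinct-repeat : {B : Set} (l : List B) {m : List B} {i : B} → ¬ Distinct (l ++ i ∷ i ∷ m)
distinct-repeat []      ((i≢i ∷ _) ∷ _) = i≢i refl
distinct-repeat (h ∷ l) (_ ∷ d)         = distinct-repeat l d

module Alternation (R : Ring 0ℓ 0ℓ) where
  open Ring R hiding (zero) renaming (refl to ≈-refl)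
  open Sums R
  open import Algebra.Properties.Ring R using (-‿involutive; -‿+-comm)
  open import Relation.Binary.Reasoning.Setoid setoid

  sign : ℕ → Carrier → Carrier
  sign zero    x = x
  sign (suc n) x = - sign n x

  sign-cong : ∀ n {x y} → x ≈ y → sign n x ≈ sign n y
  sign-cong zero    eq = eq
  sign-cong (suc n) eq = -‿cong (sign-cong n eq)

  sign-+ : ∀ n x y → sign n (x + y) ≈ sign n x + sign n y
  sign-+ zero    x y = ≈-refl
  sign-+ (suc n) x y = trans (-‿cong (sign-+ n x y)) (sym (-‿+-comm _ _))

  sign-0 : ∀ n → sign n 0# ≈ 0#
  sign-0 zero    = ≈-refl
  sign-0 (suc n) = trans (-‿cong (sign-0 n)) -0#≈0# where open import Algebra.Properties.Ring R using (-0#≈0#)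

  -- The Levi-Civita symbol of w times x. Extending the sign by 0 to words with repetitions frees
  -- the letters of each other, so that any two neighbouring ones can be summed on their own.
  signed : ∀ {k} → List (Fin k) → Carrier → Carrier
  signed w x = guard (distinct? w) (sign (inversionsᴸ w) x)

  signed-cong : ∀ {k} (w : List (Fin k)) {x y} → x ≈ y → signed w x ≈ signed w y
  signed-cong w eq = guard-congʳ (distinct? w) λ _ → sign-cong (inversionsᴸ w) eq

  signed-0 : ∀ {k} (w : List (Fin k)) → signed w 0# ≈ 0#
  signed-0 w = trans (guard-congʳ (distinct? w) λ _ → sign-0 (inversionsᴸ w)) (guard-0 (distinct? w))

  signed-+ : ∀ {k} (w : List (Fin k)) x y → signed w (x + y) ≈ signed w x + signed w y
  signed-+ w x y = trans (guard-congʳ (distinct? w) λ _ → sign-+ (inversionsᴸ w) x y) (guard-+ (distinct? w) _ _)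

  signed-∑ : ∀ {k} (w : List (Fin k)) {B : Set} (xs : List B) f → signed w (∑ xs f) ≈ (∑[ x ∈ xs ] signed w (f x))
  signed-∑ w []       f = signed-0 w
  signed-∑ w (x ∷ xs) f = trans (signed-+ w _ _) (+-congˡ (signed-∑ w xs f))

  signed-swap : ∀ {k} l {m} {i j : Fin k} {x y} → ¬ i ≡ j → x ≈ y →
                signed (l ++ i ∷ j ∷ m) x ≈ - signed (l ++ j ∷ i ∷ m) y
  signed-swap l {m} {i} {j} {x} {y} i≢j x≈y = begin
    signed (l ++ i ∷ j ∷ m) x
      ≈⟨ guard-cong (distinct? (l ++ i ∷ j ∷ m)) (distinct? (l ++ j ∷ i ∷ m)) (distinct-swap l) (distinct-swap l)
           (λ _ → opposite) ⟩
    guard (distinct? (l ++ j ∷ i ∷ m)) (- sign (inversionsᴸ (l ++ j ∷ i ∷ m)) y)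
      ≈⟨ guard-neg (distinct? (l ++ j ∷ i ∷ m)) _ ⟩
    - signed (l ++ j ∷ i ∷ m) y ∎
    where
    guard-neg : {Q : Set} (q : Dec Q) (x : Carrier) → guard q (- x) ≈ - guard q x
    guard-neg (yes _) x = ≈-refl
    guard-neg (no _)  x = sym -0#≈0# where open import Algebra.Properties.Ring R using (-0#≈0#)
    opposite : sign (inversionsᴸ (l ++ i ∷ j ∷ m)) x ≈ - sign (inversionsᴸ (l ++ j ∷ i ∷ m)) y
    opposite with Fin.<-cmp i j
    ... | tri< i<j _ _ = trans (sign-cong (inversionsᴸ (l ++ i ∷ j ∷ m)) x≈y) (trans (sym (-‿involutive _))
                           (-‿cong (reflexive (cong (λ n → sign n y) (≡.sym (inversionsᴸ-swap l i<j))))))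
    ... | tri≈ _ i≡j _ = ⊥-elim (i≢j i≡j)
    ... | tri> _ _ j<i = trans (reflexive (cong (λ n → sign n x) (inversionsᴸ-swap l j<i)))
        (-‿cong (sign-cong (inversionsᴸ (l ++ j ∷ i ∷ m)) x≈y))

  -- The diagonal is a separate hypothesis because 2 may be a zero divisor in the ring.
  ∑-alternating : {B : Set} (xs : List B) (h : B → B → Carrier) →
    (∀ i → h i i ≈ 0#) → (∀ i j → h i j + h j i ≈ 0#) → (∑[ i ∈ xs ] ∑[ j ∈ xs ] h i j) ≈ 0#
  ∑-alternating []       h diag anti = ≈-refl
  ∑-alternating (x ∷ xs) h diag anti = begin
    (h x x + rowSum) + (∑[ i ∈ xs ] (h i x + (∑[ j ∈ xs ] h i j)))
      ≈⟨ +-cong (trans (+-congʳ (diag x)) (+-identityˡ _)) (∑-+ xs _ _) ⟩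
    rowSum + (columnSum + (∑[ i ∈ xs ] ∑[ j ∈ xs ] h i j))
      ≈⟨ +-congˡ (trans (+-congˡ (∑-alternating xs h diag anti)) (+-identityʳ _)) ⟩
    rowSum + columnSum
      ≈⟨ ∑-+ xs _ _ ⟨
    (∑[ j ∈ xs ] (h x j + h j x))
      ≈⟨ ∑-zero xs (anti x) ⟩
    0# ∎
    where
    rowSum columnSum : Carrier
    rowSum    = ∑[ j ∈ xs ] h x j
    columnSum = ∑[ i ∈ xs ] h i x

  ∑-words-split : {B : Set} (xs : List B) (c d : ℕ) (f : List B → Carrier) →
    ∑ (words xs (c ℕ.+ suc (suc d))) f ≈
    (∑[ l ∈ words xs c ] ∑[ m ∈ words xs d ] ∑[ i ∈ xs ] ∑[ j ∈ xs ] f (l ++ i ∷ j ∷ m))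
  ∑-words-split xs zero d f = trans (∑-words-suc xs (suc d) f)
    (trans (∑-cong xs λ i → trans (∑-words-suc xs d _) (∑-swap xs (words xs d) _))
      (trans (∑-swap xs (words xs d) _) (sym (+-identityʳ _))))
  ∑-words-split xs (suc c) d f = trans (∑-words-suc xs (c ℕ.+ suc (suc d)) f)
    (trans (∑-cong xs λ x → ∑-words-split xs c d _) (sym (∑-words-suc xs c _)))

  -- Takes the place of a sign-reversing involution: with all other letters fixed, the sum over the
  -- letters in positions c and c + 1 is alternating.
  ∑-signed-zero : ∀ {k} (xs : List (Fin k)) c d (f : List (Fin k) → Carrier) →
    (∀ l i j m → length l ≡ c → f (l ++ i ∷ j ∷ m) ≈ f (l ++ j ∷ i ∷ m)) →
    (∑[ w ∈ words xs (c ℕ.+ suc (suc d)) ] signed w (f w)) ≈ 0#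
  ∑-signed-zero xs c d f sym-f = trans (∑-words-split xs c d _) (trans
    (∑-words-cong xs c {g = λ _ → 0#} λ l ll → ∑-zero (words xs d) λ m → ∑-alternating xs _ (diagonal l m)
        (opposite l m ll))
    (∑-zero (words xs c) λ _ → ≈-refl))
    where
    diagonal : ∀ l m i → signed (l ++ i ∷ i ∷ m) (f (l ++ i ∷ i ∷ m)) ≈ 0#
    diagonal l m i = guard-no (distinct? (l ++ i ∷ i ∷ m)) (distinct-repeat l)
    opposite : ∀ l m → length l ≡ c → ∀ i j →
      signed (l ++ i ∷ j ∷ m) (f (l ++ i ∷ j ∷ m)) + signed (l ++ j ∷ i ∷ m) (f (l ++ j ∷ i ∷ m)) ≈ 0#
    opposite l m ll i j with i Fin.≟ j
    ... | yes refl = trans (+-cong (diagonal l m i) (diagonal l m i)) (+-identityˡ 0#)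
    ... | no  i≢j  = trans (+-congʳ (signed-swap l i≢j (sym-f l i j m ll))) (-‿inverseˡ _)

  ∑-pick : {B : Set} {U : B → Set} (U? : Decidable U) {xs : List B} {x : B} → Unique xs → x ∈ xs →
           U x → (∀ y → U y → y ≡ x) → (f : B → Carrier) → (∑[ y ∈ xs ] guard (U? y) (f y)) ≈ f x
  ∑-pick U? {y ∷ xs} (x∉ ∷ un) (here refl) Ux only f = trans
    (+-cong (guard-yes (U? y) {f y} Ux) (vanish x∉)) (+-identityʳ _)
    where
    vanish : ∀ {zs} → All (λ z → ¬ y ≡ z) zs → (∑[ z ∈ zs ] guard (U? z) (f z)) ≈ 0#
    vanish []          = ≈-refl
    vanish {z ∷ _} (n ∷ ns) = trans (+-cong (guard-no (U? z) {f z} λ Uz → n (≡.sym (only z Uz))) (vanish ns))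
        (+-identityˡ 0#)
  ∑-pick U? {y ∷ xs} {x} (y∉ ∷ un) (there x∈xs) Ux only f = trans
    (+-cong (guard-no (U? y) {f y} λ Uy → All.lookup y∉ x∈xs (only y Uy)) (∑-pick U? un x∈xs Ux only f))
        (+-identityˡ _)

words-unique : {B : Set} {S : List B} → Unique S → ∀ k → Unique (words S k)
words-unique un zero    = [] ∷ []
words-unique un (suc k) = Unique.cartesianProductWith⁺ _∷_ List.∷-injective un (words-unique un k)

∈-words : {B : Set} {S : List B} (w : List B) → All (_∈ S) w → w ∈ words S (length w)
∈-words []      []       = here refl
∈-words (x ∷ w) (p ∷ ps) = ∈-cartesianProductWith⁺ _∷_ p (∈-words w ps)

upFrom : ℕ → ℕ → List ℕ
upFrom m zero    = []
upFrom m (suc n) = m ∷ upFrom (suc m) n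

increasing⇒upFrom : ∀ m (ns : List ℕ) → AllPairs ℕ._<_ ns → All (m ℕ.≤_) ns → All (ℕ._< m ℕ.+ length ns) ns →
                    ns ≡ upFrom m (length ns)
increasing⇒upFrom m []       _         _          _          = refl
increasing⇒upFrom m (n ∷ ns) (n< ∷ inc) (m≤n ∷ lo) (n<m ∷ hi) =
  cong₂ _∷_ (head-≡ ns n< ns≡ n<m) ns≡
  where
  ns≡ : ns ≡ upFrom (suc m) (length ns)
  ns≡ = increasing⇒upFrom (suc m) ns inc (All.map (ℕ.≤-<-trans m≤n) n<)
      (All.map (λ {x} → subst (x ℕ.<_) (ℕ.+-suc m (length ns))) hi)
  head-≡ : ∀ ns → All (n ℕ.<_) ns → ns ≡ upFrom (suc m) (length ns) → n ℕ.< m ℕ.+ suc (length ns) → n ≡ m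
  head-≡ []       _          _  n<m = ℕ.≤-antisym (ℕ.s≤s⁻¹ (subst (n ℕ.<_) (ℕ.+-comm m 1) n<m)) m≤n
  head-≡ (_ ∷ ns) (n<x ∷ _) eq _   = ℕ.≤-antisym (ℕ.s≤s⁻¹ (subst (n ℕ.<_) (List.∷-injectiveˡ eq) n<x)) m≤n

-- The values of such a word are k different numbers below k in increasing order. This identifies
-- the one permutation that survives the cancellation.
increasing-unique : ∀ {k} (v w : List (Fin k)) → AllPairs Fin._<_ v → AllPairs Fin._<_ w →
                    length v ≡ k → length w ≡ k → v ≡ w
increasing-unique {k} v w iv iw lv lw = List.map-injective Fin.toℕ-injective
    (≡.trans (standard v iv lv) (≡.sym (standard w iw lw)))
  where
  standard : ∀ v → AllPairs Fin._<_ v → length v ≡ k → map toℕ v ≡ upFrom 0 k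
  standard v iv lv = subst (λ n → map toℕ v ≡ upFrom 0 n) lm
    (increasing⇒upFrom 0 (map toℕ v) (AllPairs.map⁺ iv) (All.universal (λ _ → ℕ.z≤n) _)
      (subst (λ n → All (ℕ._< n) (map toℕ v)) (≡.sym lm) (All.map⁺ (All.universal Fin.toℕ<n v))))
    where
    lm : length (map toℕ v) ≡ k
    lm = ≡.trans (List.length-map toℕ v) lv

increasing⇒noInversions : ∀ {k} (w : List (Fin k)) → AllPairs Fin._<_ w → inversionsᴸ w ≡ 0
increasing⇒noInversions []      []        = refl
increasing⇒noInversions (i ∷ w) (i< ∷ iw) =
  cong₂ ℕ._+_ (cong length (List.filter-none (Fin._<? i) (All.map (λ i<j j<i → Fin.<-asym i<j j<i) i<)))
      (increasing⇒noInversions w iw)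

-- Cancellation of flawed arrays in the alternating sum.

module Shapes (P : PlacticAlgebra) {k : ℕ} (L : Fin k → ℤ)
              (antitone : ∀ {i j} → i Fin.≤ j → L j ℤ.≤ L i) where
  open Arrays P
  open Alternation R
  open import Relation.Binary.Reasoning.Setoid setoid

  -- n is the position of the first letter. Exchanging neighbouring letters i and j changes the
  -- heights p = L i + c and q = L j + c + 1 into q - 1 and p + 1, as `flawedAt-exchange` requires.
  shape : ℕ → List (Fin k) → List ℤ
  shape n []      = []
  shape n (i ∷ w) = L i ℤ.+ + n ∷ shape (suc n) w

  length-shape : ∀ n w → length (shape n w) ≡ length w
  length-shape n []      = refl
  length-shape n (i ∷ w) = cong suc (length-shape (suc n) w)

  shape-++ : ∀ n l w → shape n (l ++ w) ≡ shape n l ++ shape (n ℕ.+ length l) w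
  shape-++ n []      w = cong (λ m → shape m w) (≡.sym (ℕ.+-identityʳ n))
  shape-++ n (i ∷ l) w = cong (L i ℤ.+ + n ∷_) (≡.trans (shape-++ (suc n) l w)
    (cong (λ m → shape (suc n) l ++ shape m w) (≡.sym (ℕ.+-suc n (length l)))))

  +-suc : ∀ z n → z ℤ.+ + suc n ≡ ℤ.suc (z ℤ.+ + n)
  +-suc z n = ≡.trans (≡.sym (ℤ.+-assoc z ℤ.1ℤ (+ n)))
      (≡.trans (cong (ℤ._+ + n) (ℤ.+-comm z ℤ.1ℤ)) (ℤ.+-assoc ℤ.1ℤ z (+ n)))

  flawedAt-symmetric : ∀ r c S l i j m → length l ≡ c →
    flawedAt r c S (shape 0 (l ++ i ∷ j ∷ m)) ≈ flawedAt r c S (shape 0 (l ++ j ∷ i ∷ m))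
  flawedAt-symmetric r c S l i j m refl = begin
    flawedAt r c S (shape 0 (l ++ i ∷ j ∷ m))
      ≡⟨ cong (flawedAt r c S) (shape-++ 0 l (i ∷ j ∷ m)) ⟩
    flawedAt r c S (shape 0 l ++ L i ℤ.+ + c ∷ L j ℤ.+ + suc c ∷ shape (suc (suc c)) m)
      ≡⟨ cong (λ n → flawedAt r n S (shape 0 l ++ L i ℤ.+ + c ∷ L j ℤ.+ + suc c ∷ shape (suc (suc c)) m))
           (length-shape 0 l) ⟨
    flawedAt r (length (shape 0 l)) S (shape 0 l ++ L i ℤ.+ + c ∷ L j ℤ.+ + suc c ∷ shape (suc (suc c)) m)
      ≈⟨ flawedAt-exchange r S (shape 0 l) (shape (suc (suc c)) m) (L i ℤ.+ + c) (L j ℤ.+ + suc c) ⟩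
    flawedAt r (length (shape 0 l)) S (shape 0 l ++ ℤ.pred (L j ℤ.+ + suc c) ∷ ℤ.suc (L i ℤ.+ + c) ∷ shape
        (suc (suc c)) m)
      ≡⟨ cong₂ (λ p q → flawedAt r (length (shape 0 l)) S (shape 0 l ++ p ∷ q ∷ shape (suc (suc c)) m))
           (≡.trans (cong ℤ.pred (+-suc (L j) c)) (ℤ.pred-suc (L j ℤ.+ + c))) (≡.sym (+-suc (L i) c)) ⟩
    flawedAt r (length (shape 0 l)) S (shape 0 l ++ L j ℤ.+ + c ∷ L i ℤ.+ + suc c ∷ shape (suc (suc c)) m)
      ≡⟨ cong (λ n → flawedAt r n S (shape 0 l ++ L j ℤ.+ + c ∷ L i ℤ.+ + suc c ∷ shape (suc (suc c)) m))
           (length-shape 0 l) ⟩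
    flawedAt r c S (shape 0 l ++ L j ℤ.+ + c ∷ L i ℤ.+ + suc c ∷ shape (suc (suc c)) m)
      ≡⟨ cong (flawedAt r c S) (shape-++ 0 l (j ∷ i ∷ m)) ⟨
    flawedAt r c S (shape 0 (l ++ j ∷ i ∷ m)) ∎

  flawedAt-short : ∀ r c S zs → ¬ (suc (suc c) ℕ.≤ length zs) → flawedAt r c S zs ≈ 0#
  flawedAt-short r c S zs c≮ = trans (∑-arrays-cong S zs {g = λ _ → 0#} λ Cs sh →
      guard-no (at? r c Cs) λ a → c≮ (subst (suc (suc c) ℕ.≤_) (Pointwise.Pointwise-length sh) (at⇒length r c Cs a)))
    (∑-zero (arrays S zs) λ _ → ≈-refl)

  Fs : List (Fin k)
  Fs = allFin k

  ∑-flawedAt : ∀ r c S → (∑[ w ∈ words Fs k ] signed w (flawedAt r c S (shape 0 w))) ≈ 0#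
  ∑-flawedAt r c S with suc (suc c) ℕ.≤? k
  -- k is written as c + (2 + d), which singles out the two letters at the flaw.
  ... | yes c<k = subst (λ n → (∑[ w ∈ words Fs n ] signed w (flawedAt r c S (shape 0 w))) ≈ 0#)
                    (≡.trans (ℕ.+-suc c _) (≡.trans (cong suc (ℕ.+-suc c _)) (ℕ.m+[n∸m]≡n c<k)))
                    (∑-signed-zero Fs c (k ℕ.∸ suc (suc c)) (λ w → flawedAt r c S (shape 0 w))
                        (flawedAt-symmetric r c S))
  ... | no  c≮k = trans (∑-words-cong Fs k {g = λ _ → 0#} λ w lw → trans
      (signed-cong w (flawedAt-short r c S (shape 0 w) λ c< →
          c≮k (subst (suc (suc c) ℕ.≤_) (≡.trans (length-shape 0 w) lw) c<)))
      (signed-0 w))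
    (∑-zero (words Fs k) λ _ → ≈-refl)

  agree⇒decreasing : ∀ b {Cs zs} → HasShape Cs zs → All (ℤ._≤ + b) zs → Agree b Cs → Linked (λ x y → y ℤ.≤ x) zs
  agree⇒decreasing b []              _             _       = []
  agree⇒decreasing b (_ ∷ [])        _             _       = [-]
  agree⇒decreasing b {C ∷ D ∷ _} (refl ∷ refl ∷ sh) (_ ∷ d≤b ∷ bd) (t ∷ l) =
    ℤ.+≤+ (tab≤⇒length b C D (ℤ.drop‿+≤+ d≤b) t) ∷ agree⇒decreasing b (refl ∷ sh) (d≤b ∷ bd) l

  -- If j ≤ i, then L i + n < L j + n + 1 since L is antitone, and the heights would increase.
  decreasing⇒increasing : ∀ n w → Linked (λ x y → y ℤ.≤ x) (shape n w) → Linked Fin._<_ w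
  decreasing⇒increasing n []          _       = []
  decreasing⇒increasing n (i ∷ [])    _       = [-]
  decreasing⇒increasing n (i ∷ j ∷ w) (d ∷ l) = i<j ∷ decreasing⇒increasing (suc n) (j ∷ w) l
    where
    i<j : i Fin.< j
    i<j with i Fin.<? j
    ... | yes i<j = i<j
    ... | no  i≮j = ⊥-elim (ℤ.<⇒≱ (ℤ.+-mono-≤-< (antitone (ℕ.≮⇒≥ i≮j)) (ℤ.+<+ (ℕ.n<1+n n))) d)

  shape-bounded : ∀ b n w → (∀ i m → m ℕ.< n ℕ.+ length w → L i ℤ.+ + m ℤ.≤ + b) → All (ℤ._≤ + b) (shape n w)
  shape-bounded b n []      bd = []
  shape-bounded b n (i ∷ w) bd = bd i n (ℕ.m<m+n n ℕ.z<s) ∷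
    shape-bounded b (suc n) w (λ j m m< → bd j m (subst (m ℕ.<_) (≡.sym (ℕ.+-suc n (length w))) m<))

  -- The bound makes b exceed or equal every height, so that an array flawless in b rows has weakly
  -- decreasing heights; only the identity permutation produces such heights.
  ∑-signed-∏e : ∀ b S → (∀ i m → m ℕ.< k → L i ℤ.+ + m ℤ.≤ + b) →
    (∑[ w ∈ words Fs k ] signed w (∏e S (shape 0 w))) ≈ flawless b S (shape 0 Fs)
  ∑-signed-∏e b S bd = begin
    (∑[ w ∈ words Fs k ] signed w (∏e S (shape 0 w)))
      ≈⟨ (∑-words-cong Fs k λ w lw → trans (signed-cong w (trans (∏e-decomposition b S (shape 0 w))
            (+-congˡ (reflexive (cong (λ n → ∑[ r ∈ indices b ] ∑[ c ∈ indices n ] flawedAt r c S (shape 0 w))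
                (≡.trans (length-shape 0 w) lw))))))
          (trans (signed-+ w _ _)
              (+-congˡ (trans (signed-∑ w (indices b) _) (∑-cong (indices b) λ r → signed-∑ w (indices k) _))))) ⟩
    (∑[ w ∈ words Fs k ] (signed w (flawless b S (shape 0 w)) +
      (∑[ r ∈ indices b ] ∑[ c ∈ indices k ] signed w (flawedAt r c S (shape 0 w)))))
      ≈⟨ trans (∑-+ (words Fs k) _ _) (trans (+-congˡ (trans (∑-swap (words Fs k) (indices b) _)
           (∑-zero (indices b) λ r → trans (∑-swap (words Fs k) (indices k) _) (∑-zero (indices k) λ c →
               ∑-flawedAt r c S))))
           (+-identityʳ _)) ⟩
    (∑[ w ∈ words Fs k ] signed w (flawless b S (shape 0 w)))
      ≈⟨ (∑-words-cong Fs k λ w lw → only w lw) ⟩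
    (∑[ w ∈ words Fs k ] guard (increasing? w ×-dec (length w ℕ.≟ k)) (signed w (flawless b S (shape 0 w))))
      ≈⟨ ∑-pick (λ w → increasing? w ×-dec (length w ℕ.≟ k)) (words-unique (Unique.allFin⁺ k) k) Fs∈
           (Fs-increasing , length-Fs)
           (λ w (iw , lw) → increasing-unique w Fs iw Fs-increasing lw length-Fs) _ ⟩
    signed Fs (flawless b S (shape 0 Fs))
      ≈⟨ guard-yes (distinct? Fs) (Unique.allFin⁺ k) ⟩
    sign (inversionsᴸ Fs) (flawless b S (shape 0 Fs))
      ≡⟨ cong (λ n → sign n (flawless b S (shape 0 Fs))) (increasing⇒noInversions Fs Fs-increasing) ⟩
    flawless b S (shape 0 Fs) ∎
    where
    increasing? : ∀ w → Dec (AllPairs Fin._<_ w)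
    increasing? = allPairs? Fin._<?_
    length-Fs : length Fs ≡ k
    length-Fs = List.length-tabulate id
    Fs-increasing : AllPairs Fin._<_ Fs
    Fs-increasing = AllPairs.tabulate⁺-< id
    Fs∈ : Fs ∈ words Fs k
    Fs∈ = subst (λ n → Fs ∈ words Fs n) length-Fs (∈-words Fs (All.tabulate λ {i} _ → ∈-allFin i))
    only : ∀ w → length w ≡ k → signed w (flawless b S (shape 0 w)) ≈
           guard (increasing? w ×-dec (length w ℕ.≟ k)) (signed w (flawless b S (shape 0 w)))
    only w lw with increasing? w
    ... | yes iw = sym (guard-yes (yes iw ×-dec (length w ℕ.≟ k)) (iw , lw))
    ... | no ¬iw = trans (trans (signed-cong w (trans (∑-arrays-cong S (shape 0 w) {g = λ _ → 0#} λ Cs sh →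
        guard-no (agree? b Cs) λ a → ¬iw (Linked.Linked⇒AllPairs Fin.<-trans
          (decreasing⇒increasing 0 w (agree⇒decreasing b sh
            (shape-bounded b 0 w (λ i m m< → bd i m (subst (m ℕ.<_) lw m<))) a))))
        (∑-zero (arrays S (shape 0 w)) λ _ → ≈-refl))) (signed-0 w))
        (sym (guard-no (no ¬iw ×-dec (length w ℕ.≟ k)) {signed w (flawless b S (shape 0 w))} λ (iw , _) → ¬iw iw))

-- Inverse permutations and the transpose of a determinant.

injective⇒surjective : ∀ {k} {f : Fin k → Fin k} → Injective _≡_ _≡_ f → ∀ j → ∃ λ i → f i ≡ j
injective⇒surjective {suc k} {f} inj j with Fin.any? (λ i → f i Fin.≟ j)
... | yes found = found
-- Removing a missed value from the codomain would leave an injection into a smaller set.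
... | no  none  = ⊥-elim (ℕ.1+n≰n (Fin.injective⇒≤ {f = λ i → Fin.punchOut (missed i)}
                    (λ eq → inj (Fin.punchOut-injective (missed _) (missed _) eq))))
  where
  missed : ∀ i → ¬ j ≡ f i
  missed i j≡ = none (i , ≡.sym j≡)

map-allFin-↭ : ∀ {k} {f : Fin k → Fin k} → Injective _≡_ _≡_ f → map f (allFin k) ↭ allFin k
map-allFin-↭ {k} {f} inj = ∼bag⇒↭ (unique∧set⇒bag (Unique.map⁺ inj (Unique.allFin⁺ k)) (Unique.allFin⁺ k)
  (mk⇔ (λ _ → ∈-allFin _) (λ _ → reach _)))
  where
  reach : ∀ j → j ∈ map f (allFin k)
  reach j with injective⇒surjective inj j
  ... | i , refl = ∈-map⁺ f (∈-allFin i)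

∈-vectors : {B : Set} {xs : List B} {n : ℕ} (v : Vec B n) → (∀ i → lookup v i ∈ xs) → v ∈ vectors xs n
∈-vectors []      _ = here refl
∈-vectors (x ∷ v) p = ∈-cartesianProductWith⁺ _∷_ (p Fin.zero) (∈-vectors v λ i → p (Fin.suc i))

vectors-unique : {B : Set} {xs : List B} → Unique xs → ∀ n → Unique (vectors xs n)
vectors-unique un zero    = [] ∷ []
vectors-unique un (suc n) = Unique.cartesianProductWith⁺ _∷_ Vec.∷-injective un (vectors-unique un n)

permutations-unique : ∀ k → Unique (permutations k)
permutations-unique k = Unique.filter⁺ _ (vectors-unique (Unique.allFin⁺ k) k)

permutation⇒injective : ∀ {k} {π : Vec (Fin k) k} → π ∈ permutations k → Injective _≡_ _≡_ (lookup π)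
permutation⇒injective {k} p = Vecᵁ.lookup-injective
    (proj₂ (∈-filter⁻ (Vecᴾ.allPairs? λ i j → ¬? (i Fin.≟ j)) {xs = vectors (allFin k) k} p)) _ _

∈-permutations : ∀ {k} {f : Fin k → Fin k} → Injective _≡_ _≡_ f → Vec.tabulate f ∈ permutations k
∈-permutations inj = ∈-filter⁺ _ (∈-vectors _ λ _ → ∈-allFin _) (Vecᵁ.tabulate⁺ inj)

-- A one-sided condition is enough: among permutations it determines either of π and σ from the
-- other, so it is a perfect matching for `∑-matching`.
Inverse : ∀ {k} → Vec (Fin k) k → Vec (Fin k) k → Set
Inverse π σ = ∀ i → lookup σ (lookup π i) ≡ i

inverse? : ∀ {k} (π σ : Vec (Fin k) k) → Dec (Inverse π σ)
inverse? π σ = Fin.all? λ i → lookup σ (lookup π i) Fin.≟ i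

lookup-ext : ∀ {k n} {v w : Vec (Fin k) n} → (∀ i → lookup v i ≡ lookup w i) → v ≡ w
lookup-ext {v = v} {w} eq = ≡.trans (≡.sym (Vec.tabulate∘lookup v))
    (≡.trans (Vec.tabulate-cong eq) (Vec.tabulate∘lookup w))

right-inverse : ∀ {k} {π : Vec (Fin k) k} → π ∈ permutations k → ∃ λ σ → σ ∈ permutations k × Inverse π σ
right-inverse {k} {π} p = Vec.tabulate f , ∈-permutations f-injective , λ i →
    ≡.trans (Vec.lookup∘tabulate f (lookup π i)) (inj (proj₂ (surj (lookup π i))))
  where
  inj = permutation⇒injective p
  surj = injective⇒surjective inj
  f : Fin k → Fin k
  f j = proj₁ (surj j)
  f-injective : Injective _≡_ _≡_ f
  f-injective {x} {y} eq = ≡.trans (≡.sym (proj₂ (surj x))) (≡.trans (cong (lookup π) eq) (proj₂ (surj y)))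

left-inverse : ∀ {k} {σ : Vec (Fin k) k} → σ ∈ permutations k → ∃ λ π → π ∈ permutations k × Inverse π σ
left-inverse {k} {σ} p = Vec.tabulate f , ∈-permutations f-injective , λ i →
    ≡.trans (cong (lookup σ) (Vec.lookup∘tabulate f i)) (proj₂ (surj i))
  where
  surj = injective⇒surjective (permutation⇒injective p)
  f : Fin k → Fin k
  f j = proj₁ (surj j)
  f-injective : Injective _≡_ _≡_ f
  f-injective {x} {y} eq = ≡.trans (≡.sym (proj₂ (surj x))) (≡.trans (cong (lookup σ) eq) (proj₂ (surj y)))

module Finite (R : Ring 0ℓ 0ℓ) where
  open Ring R hiding (zero) renaming (refl to ≈-refl)
  open Sums R public
  open Alternation R public
  open import Relation.Binary.Reasoning.Setoid setoid

  ∏ : {B : Set} → List B → (B → Carrier) → Carrier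
  ∏ xs f = foldr _*_ 1# (map f xs)

  ∏-cong : {B : Set} (xs : List B) {f g : B → Carrier} → (∀ x → f x ≈ g x) → ∏ xs f ≈ ∏ xs g
  ∏-cong []       eq = ≈-refl
  ∏-cong (x ∷ xs) eq = *-cong (eq x) (∏-cong xs eq)

  ∏-↭ : {B : Set} {xs ys : List B} (f : B → Carrier) → (∀ x y → f x * f y ≈ f y * f x) →
        xs ↭ ys → ∏ xs f ≈ ∏ ys f
  ∏-↭ f comm _↭_.refl          = ≈-refl
  ∏-↭ f comm (_↭_.prep x p)    = *-congˡ (∏-↭ f comm p)
  ∏-↭ f comm (_↭_.swap x y p)  = trans (sym (*-assoc _ _ _))
      (trans (*-cong (comm x y) (∏-↭ f comm p)) (*-assoc _ _ _))
  ∏-↭ f comm (_↭_.trans p q)   = trans (∏-↭ f comm p) (∏-↭ f comm q)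

  ∑-↭ : {B : Set} {xs ys : List B} (f : B → Carrier) → xs ↭ ys → ∑ xs f ≈ ∑ ys f
  ∑-↭ f _↭_.refl          = ≈-refl
  ∑-↭ f (_↭_.prep x p)    = +-congˡ (∑-↭ f p)
  ∑-↭ f (_↭_.swap x y p)  = trans (sym (+-assoc _ _ _)) (trans (+-cong (+-comm _ _) (∑-↭ f p)) (+-assoc _ _ _))
  ∑-↭ f (_↭_.trans p q)   = trans (∑-↭ f p) (∑-↭ f q)

  ∑-reindex : ∀ {k} {f : Fin k → Fin k} → Injective _≡_ _≡_ f → (g : Fin k → Carrier) →
              (∑[ i ∈ allFin k ] g (f i)) ≈ ∑ (allFin k) g
  ∑-reindex {k} {f} inj g = trans (sym (∑-map f (allFin k) g)) (∑-↭ g (map-allFin-↭ inj))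

  ∏-reindex : ∀ {k} {f : Fin k → Fin k} → Injective _≡_ _≡_ f → (g : Fin k → Carrier) →
              (∀ i j → g i * g j ≈ g j * g i) → ∏ (allFin k) (λ i → g (f i)) ≈ ∏ (allFin k) g
  ∏-reindex {k} {f} inj g comm =
    trans (reflexive (cong (foldr _*_ 1#) (List.map-∘ (allFin k)))) (∏-↭ g comm (map-allFin-↭ inj))

  ∑-allFin-suc : ∀ n (f : Fin (suc n) → Carrier) → ∑ (allFin (suc n)) f ≈ f Fin.zero +
      (∑[ i ∈ allFin n ] f (Fin.suc i))
  ∑-allFin-suc n f = +-congˡ (trans (reflexive (cong (λ xs → ∑ xs f) (≡.sym (List.map-tabulate id Fin.suc))))
      (∑-map Fin.suc (allFin n) f))

  ∑-toList : ∀ {B : Set} {n} (v : Vec B n) (f : B → Carrier) → ∑ (toList v) f ≈ (∑[ i ∈ allFin n ] f (lookup v i))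
  ∑-toList []      f = ≈-refl
  ∑-toList {n = suc n} (x ∷ v) f = trans (+-congˡ (∑-toList v f)) (sym (∑-allFin-suc n (λ i → f (lookup (x ∷ v) i))))

  -- Double counting: both sums equal the sum over all related pairs, since everyone has exactly one
  -- partner.
  ∑-matching : {B C : Set} {_~_ : B → C → Set} (_~?_ : ∀ x y → Dec (x ~ y)) {xs : List B} {ys : List C}
      (f : B → Carrier) (g : C → Carrier) →
    Unique xs → Unique ys →
    (∀ {x} → x ∈ xs → ∃ λ y → y ∈ ys × x ~ y × (∀ z → x ~ z → z ≡ y)) →
    (∀ {y} → y ∈ ys → ∃ λ x → x ∈ xs × x ~ y × (∀ z → z ~ y → z ≡ x)) →
    (∀ {x y} → x ∈ xs → y ∈ ys → x ~ y → f x ≈ g y) → ∑ xs f ≈ ∑ ys g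
  ∑-matching _~?_ {xs} {ys} f g uxs uys right left eq = begin
    ∑ xs f
      ≈⟨ ∑-∈-cong xs (λ {x} x∈ → let (y , y∈ , x~y , only) = right x∈ in
           sym (∑-pick (x ~?_) uys y∈ x~y only (λ _ → f x))) ⟩
    (∑[ x ∈ xs ] ∑[ y ∈ ys ] guard (x ~? y) (f x))
      ≈⟨ ∑-∈-cong xs (λ {x} x∈ → ∑-∈-cong ys λ {y} y∈ → guard-congʳ (x ~? y) (eq x∈ y∈)) ⟩
    (∑[ x ∈ xs ] ∑[ y ∈ ys ] guard (x ~? y) (g y))
      ≈⟨ ∑-swap xs ys _ ⟩
    (∑[ y ∈ ys ] ∑[ x ∈ xs ] guard (x ~? y) (g y))
      ≈⟨ ∑-∈-cong ys (λ {y} y∈ → let (x , x∈ , x~y , only) = left y∈ in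
           ∑-pick (_~? y) uxs x∈ x~y only (λ _ → g y)) ⟩
    ∑ ys g ∎
    where
    ∑-∈-cong : {B : Set} (zs : List B) {f g : B → Carrier} → (∀ {z} → z ∈ zs → f z ≈ g z) → ∑ zs f ≈ ∑ zs g
    ∑-∈-cong []       eq = ≈-refl
    ∑-∈-cong (z ∷ zs) eq = +-cong (eq (here refl)) (∑-∈-cong zs λ z∈ → eq (there z∈))

module _ where
  open Finite ℤ.+-*-ring
  open ≡.≡-Reasoning

  count : {B : Set} {U : B → Set} (U? : Decidable U) (ys : List B) →
          + length (filter U? ys) ≡ (∑[ y ∈ ys ] guard (U? y) 1ℤ)
  count U? []       = refl
  count U? (y ∷ ys) with U? y
  ... | yes _ = cong (λ z → 1ℤ ℤ.+ z) (count U? ys)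
  ... | no  _ = ≡.trans (count U? ys) (≡.sym (ℤ.+-identityˡ _))

  inversions-∑ : ∀ {k n} (v : Vec (Fin k) n) → + inversions v ≡
    (∑[ i ∈ allFin n ] ∑[ j ∈ allFin n ] guard ((i Fin.<? j) ×-dec (lookup v j Fin.<? lookup v i)) 1ℤ)
  inversions-∑ []      = refl
  inversions-∑ {k} {suc n} (x ∷ v) = begin
    + (length (filter (Fin._<? x) (toList v)) ℕ.+ inversions v)
      ≡⟨ cong₂ ℤ._+_ (count (Fin._<? x) (toList v)) (inversions-∑ v) ⟩
    (∑[ y ∈ toList v ] guard (y Fin.<? x) 1ℤ) ℤ.+
    (∑[ i ∈ allFin n ] ∑[ j ∈ allFin n ] guard ((i Fin.<? j) ×-dec (lookup v j Fin.<? lookup v i)) 1ℤ)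
      ≡⟨ cong₂ ℤ._+_
           (≡.trans (∑-toList v (λ y → guard (y Fin.<? x) 1ℤ))
               (≡.sym (≡.trans (∑-allFin-suc n (f Fin.zero)) (≡.trans (ℤ.+-identityˡ _)
             (∑-cong (allFin n) λ j → guard-cong ((Fin.zero {n} Fin.<? Fin.suc j) ×-dec (lookup v j Fin.<? x))
                 (lookup v j Fin.<? x) proj₂ (ℕ.z<s ,_) (λ _ → refl))))))
           (∑-cong (allFin n) λ i → ≡.sym (≡.trans (∑-allFin-suc n (f (Fin.suc i))) (≡.trans (ℤ.+-identityˡ _)
             (∑-cong (allFin n) λ j → guard-cong ((Fin.suc i Fin.<? Fin.suc j) ×-dec (lookup v j Fin.<? lookup v i))
                 ((i Fin.<? j) ×-dec (lookup v j Fin.<? lookup v i))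
               (λ (p , q) → ℕ.s<s⁻¹ p , q) (λ (p , q) → ℕ.s<s p , q) (λ _ → refl))))) ⟩
    (∑[ j ∈ allFin (suc n) ] f Fin.zero j) ℤ.+ (∑[ i ∈ allFin n ] ∑[ j ∈ allFin (suc n) ] f (Fin.suc i) j)
      ≡⟨ ∑-allFin-suc n (λ i → ∑ (allFin (suc n)) (f i)) ⟨
    (∑[ i ∈ allFin (suc n) ] ∑[ j ∈ allFin (suc n) ] f i j) ∎
    where
    f : Fin (suc n) → Fin (suc n) → ℤ
    f i j = guard ((i Fin.<? j) ×-dec (lookup (x ∷ v) j Fin.<? lookup (x ∷ v) i)) 1ℤ

  -- An inversion of π at positions i < j is an inversion of σ at positions π(j) < π(i); reindexing
  -- both sums along π does the rest.
  inversions-inverse : ∀ {k} {π σ : Vec (Fin k) k} → π ∈ permutations k → Inverse π σ → inversions π ≡ inversions σ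
  inversions-inverse {k} {π} {σ} p inv = ℤ.+-injective (begin
    + inversions π
      ≡⟨ inversions-∑ π ⟩
    (∑[ i ∈ allFin k ] ∑[ j ∈ allFin k ] guard ((i Fin.<? j) ×-dec (lookup π j Fin.<? lookup π i)) 1ℤ)
      ≡⟨ (∑-cong (allFin k) λ i → ∑-cong (allFin k) λ j →
           guard-cong ((i Fin.<? j) ×-dec (lookup π j Fin.<? lookup π i))
                      ((lookup π j Fin.<? lookup π i) ×-dec (lookup σ (lookup π i) Fin.<? lookup σ (lookup π j)))
             (λ (a , b) → b , ≡.subst₂ Fin._<_ (≡.sym (inv i)) (≡.sym (inv j)) a)
             (λ (b , a) → ≡.subst₂ Fin._<_ (inv i) (inv j) a , b) (λ _ → refl)) ⟩
    (∑[ i ∈ allFin k ] ∑[ j ∈ allFin k ] h (lookup π i) (lookup π j))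
      ≡⟨ (∑-cong (allFin k) λ i → ∑-reindex inj (h (lookup π i))) ⟩
    (∑[ i ∈ allFin k ] ∑[ b ∈ allFin k ] h (lookup π i) b)
      ≡⟨ ∑-reindex inj (λ a → ∑[ b ∈ allFin k ] h a b) ⟩
    (∑[ a ∈ allFin k ] ∑[ b ∈ allFin k ] h a b)
      ≡⟨ ∑-swap (allFin k) (allFin k) h ⟩
    (∑[ b ∈ allFin k ] ∑[ a ∈ allFin k ] h a b)
      ≡⟨ inversions-∑ σ ⟨
    + inversions σ ∎)
    where
    inj = permutation⇒injective p
    h : Fin k → Fin k → ℤ
    h a b = guard ((b Fin.<? a) ×-dec (lookup σ a Fin.<? lookup σ b)) 1ℤ

module Transposition (R : Ring 0ℓ 0ℓ) where
  open Ring R hiding (zero) renaming (refl to ≈-refl)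
  open Finite R
  open import Relation.Binary.Reasoning.Setoid setoid

  -- π is matched with its inverse σ. The two products then have the same factors, sorted by row and
  -- by column respectively, so their equality rests on the commuting entries.
  ∑-transpose : ∀ {k} (m : Fin k → Fin k → Carrier) → (∀ i j i′ j′ → m i j * m i′ j′ ≈ m i′ j′ * m i j) →
    (∑[ π ∈ permutations k ] sign (inversions π) (∏ (allFin k) λ i → m i (lookup π i))) ≈
    (∑[ σ ∈ permutations k ] sign (inversions σ) (∏ (allFin k) λ j → m (lookup σ j) j))
  ∑-transpose {k} m comm = ∑-matching inverse? _ _ (permutations-unique k) (permutations-unique k)
    (λ {π} π∈ → let (σ , σ∈ , inv) = right-inverse π∈ in σ , σ∈ , inv , λ τ inv′ → lookup-ext λ j →
      let (i , πi≡j) = injective⇒surjective (permutation⇒injective π∈) j in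
      ≡.trans (cong (lookup τ) (≡.sym πi≡j)) (≡.trans (inv′ i) (≡.trans (≡.sym (inv i)) (cong (lookup σ) πi≡j))))
    (λ {σ} σ∈ → let (π , π∈ , inv) = left-inverse σ∈ in π , π∈ , inv , λ τ inv′ → lookup-ext λ i →
      permutation⇒injective σ∈ (≡.trans (inv′ i) (≡.sym (inv i))))
    (λ {π} {σ} π∈ σ∈ inv → trans
      (reflexive (cong (λ n → sign n (∏ (allFin k) λ i → m i (lookup π i))) (inversions-inverse {π = π} {σ} π∈ inv)))
      (sign-cong (inversions σ) (trans
        (∏-cong (allFin k) λ i → reflexive (cong (λ j → m j (lookup π i)) (≡.sym (inv i))))
        (∏-reindex (permutation⇒injective π∈) (λ j → m (lookup σ j) j) λ i j → comm _ _ _ _))))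

-- From fillings given by rows to arrays given by columns.

columnsFrom : {B : Set} {ℓs : List ℕ} → ℕ → ℕ → Filling B ℓs → List (List B)
columnsFrom n zero    T = []
columnsFrom n (suc k) T = column n T ∷ columnsFrom (suc n) k T

heightsFrom : ℕ → ℕ → List ℕ → List ℕ
heightsFrom n zero    ℓs = []
heightsFrom n (suc k) ℓs = length (filter (suc n ℕ.≤?_) ℓs) ∷ heightsFrom (suc n) k ℓs

addRow : {B : Set} → List B → List (List B) → List (List B)
addRow []      Cs       = Cs
addRow (x ∷ v) []       = []
addRow (x ∷ v) (C ∷ Cs) = (x ∷ C) ∷ addRow v Cs

raise : ℕ → List ℕ → List ℕ
raise zero    hs       = hs
raise (suc ℓ) []       = []
raise (suc ℓ) (h ∷ hs) = suc h ∷ raise ℓ hs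

head-drop : {B : Set} (n : ℕ) (v : List B) {x : B} {w : List B} → drop n v ≡ x ∷ w → drop (suc n) v ≡ w
head-drop zero    (x ∷ v) refl = refl
head-drop (suc n) (x ∷ v) eq   = head-drop n v eq

drop-[] : {B : Set} (n : ℕ) (v : List B) → drop n v ≡ [] → drop (suc n) v ≡ []
drop-[] zero    []      eq = refl
drop-[] (suc n) []      eq = refl
drop-[] (suc n) (x ∷ v) eq = drop-[] n v eq

column-short : {B : Set} {ℓ : ℕ} {ℓs : List ℕ} (n : ℕ) (v : Vec B ℓ) (T : Filling B ℓs) →
               drop n (toList v) ≡ [] → column n (v ∷ T) ≡ column n T
column-short n v T eq rewrite eq = refl

column-long : {B : Set} {ℓ : ℕ} {ℓs : List ℕ} (n : ℕ) (v : Vec B ℓ) (T : Filling B ℓs) {x : B} {w : List B} →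
              drop n (toList v) ≡ x ∷ w → column n (v ∷ T) ≡ x ∷ column n T
column-long n v T eq rewrite eq = refl

columnsFrom-∷ : {B : Set} {ℓ : ℕ} {ℓs : List ℕ} (n k : ℕ) (v : Vec B ℓ) (T : Filling B ℓs) →
                columnsFrom n k (v ∷ T) ≡ addRow (drop n (toList v)) (columnsFrom n k T)
columnsFrom-∷ n zero v T with drop n (toList v)
... | []    = refl
... | _ ∷ _ = refl
columnsFrom-∷ n (suc k) v T = go (drop n (toList v)) refl
  where
  go : ∀ w → drop n (toList v) ≡ w → columnsFrom n (suc k) (v ∷ T) ≡ addRow w (columnsFrom n (suc k) T)
  go []      eq = cong₂ _∷_ (column-short n v T eq)
    (≡.trans (columnsFrom-∷ (suc n) k v T) (cong (λ w → addRow w (columnsFrom (suc n) k T))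
        (drop-[] n (toList v) eq)))
  go (x ∷ w) eq = cong₂ _∷_ (column-long n v T eq)
    (≡.trans (columnsFrom-∷ (suc n) k v T) (cong (λ w → addRow w (columnsFrom (suc n) k T))
        (head-drop n (toList v) eq)))

heightsFrom-∷ : ∀ n k ℓ ℓs → heightsFrom n k (ℓ ∷ ℓs) ≡ raise (ℓ ℕ.∸ n) (heightsFrom n k ℓs)
heightsFrom-∷ n zero ℓ ℓs with ℓ ℕ.∸ n
... | zero  = refl
... | suc _ = refl
heightsFrom-∷ n (suc k) ℓ ℓs with suc n ℕ.≤? ℓ
... | yes n<ℓ = ≡.trans
  (cong₂ _∷_ (cong length (List.filter-accept (suc n ℕ.≤?_) n<ℓ)) (heightsFrom-∷ (suc n) k ℓ ℓs))
  (cong (λ m → raise m (heightsFrom n (suc k) ℓs)) (≡.sym (ℕ.+-∸-assoc 1 n<ℓ)))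
... | no n≮ℓ = ≡.trans
  (cong₂ _∷_ (cong length (List.filter-reject (suc n ℕ.≤?_) n≮ℓ))
             (≡.trans (heightsFrom-∷ (suc n) k ℓ ℓs) (cong (λ m → raise m (heightsFrom (suc n) k ℓs))
                 (ℕ.m≤n⇒m∸n≡0 (ℕ.m≤n⇒m≤1+n (ℕ.≮⇒≥ n≮ℓ))))))
  (cong (λ m → raise m (heightsFrom n (suc k) ℓs)) (≡.sym (ℕ.m≤n⇒m∸n≡0 (ℕ.≮⇒≥ n≮ℓ))))

length-heightsFrom : ∀ n k ℓs → length (heightsFrom n k ℓs) ≡ k
length-heightsFrom n zero    ℓs = refl
length-heightsFrom n (suc k) ℓs = cong suc (length-heightsFrom (suc n) k ℓs)

-- The row v meets all nonempty columns of Cs, and none beyond Cs.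
Covers : {B : Set} → List B → List (List B) → Set
Covers []      Cs       = All (_≡ []) Cs
Covers (x ∷ v) []       = ⊥
Covers (x ∷ v) (C ∷ Cs) = Covers v Cs

column-empty : {B : Set} {ℓs : List ℕ} (n : ℕ) (T : Filling B ℓs) → All (ℕ._≤ n) ℓs → column n T ≡ []
column-empty n []      []       = refl
column-empty n (v ∷ T) (p ∷ ps) = ≡.trans
  (column-short n v T (List.drop-all n (toList v) (subst (ℕ._≤ n) (≡.sym (Vec.length-toList v)) p)))
  (column-empty n T ps)

columnsFrom-empty : {B : Set} {ℓs : List ℕ} (n k : ℕ) (T : Filling B ℓs) → All (ℕ._≤ n) ℓs → All (_≡ [])
    (columnsFrom n k T)
columnsFrom-empty n zero    T p = []
columnsFrom-empty n (suc k) T p = column-empty n T p ∷ columnsFrom-empty (suc n) k T (All.map ℕ.m≤n⇒m≤1+n p)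

drop-[]⇒≤ : {B : Set} (n : ℕ) (v : List B) → drop n v ≡ [] → length v ℕ.≤ n
drop-[]⇒≤ n       []      _  = ℕ.z≤n
drop-[]⇒≤ (suc n) (x ∷ v) eq = ℕ.s≤s (drop-[]⇒≤ n v eq)

-- The rows below v are not longer than v, so the columns beyond its end are empty; and v does not
-- reach beyond the last column considered.
covers-columnsFrom : {B : Set} {ℓ : ℕ} {ℓs : List ℕ} (n k : ℕ) (v : Vec B ℓ) (T : Filling B ℓs) →
  ℓ ℕ.≤ n ℕ.+ k → All (ℕ._≤ ℓ) ℓs → Covers (drop n (toList v)) (columnsFrom n k T)
covers-columnsFrom {ℓ = ℓ} n k v T ℓ≤ p with drop n (toList v) in eq
covers-columnsFrom {ℓ = ℓ} n k v T ℓ≤ p | [] =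
  columnsFrom-empty n k T
      (All.map (λ q → ℕ.≤-trans q (subst (ℕ._≤ n) (Vec.length-toList v) (drop-[]⇒≤ n (toList v) eq))) p)
covers-columnsFrom {ℓ = ℓ} n zero v T ℓ≤ p | x ∷ w
  with () ← ≡.trans (≡.sym eq)
      (List.drop-all n (toList v)
      (subst (ℕ._≤ n) (≡.sym (Vec.length-toList v)) (subst (ℓ ℕ.≤_) (ℕ.+-identityʳ n) ℓ≤)))
covers-columnsFrom {ℓ = ℓ} n (suc k) v T ℓ≤ p | x ∷ w =
  subst (λ z → Covers z (columnsFrom (suc n) k T)) (head-drop n (toList v) eq)
    (covers-columnsFrom (suc n) k v T (subst (ℓ ℕ.≤_) (ℕ.+-suc n k) ℓ≤) p)

module Tableaux (P : PlacticAlgebra) where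
  open Arrays P
  open import Relation.Binary.Reasoning.Setoid setoid

  ∑-vectors : {B : Set} (xs : List B) (n : ℕ) (f : List B → Carrier) →
              (∑[ v ∈ vectors xs n ] f (toList v)) ≈ ∑ (words xs n) f
  ∑-vectors xs zero    f = ≈-refl
  ∑-vectors xs (suc n) f = trans (∑-cartesianProductWith _∷_ xs (vectors xs n) _)
    (trans (∑-cong xs λ x → ∑-vectors xs n λ w → f (x ∷ w)) (sym (∑-words-suc xs n f)))

  ∑-raise : ∀ S ℓ hs F → ℓ ℕ.≤ length hs →
    ∑ (arrays S (map +_ (raise ℓ hs))) F ≈ (∑[ v ∈ words S ℓ ] ∑[ Cs ∈ arrays S (map +_ hs) ] F (addRow v Cs))
  ∑-raise S zero    hs       F _          = sym (+-identityʳ _)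
  ∑-raise S (suc ℓ) (h ∷ hs) F (ℕ.s≤s ℓ≤) = begin
    ∑ (arrays S (+ suc h ∷ map +_ (raise ℓ hs))) F
      ≈⟨ trans (∑-arrays-∷ S (+ suc h) (map +_ (raise ℓ hs)) F) (∑-words-suc S h _) ⟩
    (∑[ x ∈ S ] ∑[ C ∈ words S h ] ∑[ Cs ∈ arrays S (map +_ (raise ℓ hs)) ] F ((x ∷ C) ∷ Cs))
      ≈⟨ (∑-cong S λ x → trans (∑-cong (words S h) λ C → ∑-raise S ℓ hs (λ Cs → F ((x ∷ C) ∷ Cs)) ℓ≤)
           (trans (∑-swap (words S h) (words S ℓ) _)
               (∑-cong (words S ℓ) λ v → sym (∑-arrays-∷ S (+ h) (map +_ hs) _)))) ⟩
    (∑[ x ∈ S ] ∑[ v ∈ words S ℓ ] ∑[ Cs ∈ arrays S (map +_ (h ∷ hs)) ] F (addRow (x ∷ v) Cs))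
      ≈⟨ ∑-words-suc S ℓ _ ⟨
    (∑[ v ∈ words S (suc ℓ) ] ∑[ Cs ∈ arrays S (map +_ (h ∷ hs)) ] F (addRow v Cs)) ∎

  -- Row by row: putting a row of length ℓ on top raises the first ℓ columns by one, and this is
  -- reversible because the new heights tell how many tops to remove.
  ∑-fillings : ∀ S k ℓs F → All (ℕ._≤ k) ℓs →
    (∑[ T ∈ fillings S ℓs ] F (columnsFrom 0 k T)) ≈ ∑ (arrays S (map +_ (heightsFrom 0 k ℓs))) F
  ∑-fillings S k []       F []       = trans (+-identityʳ _) (sym (empty 0 k F))
    where
    empty : ∀ n k F → ∑ (arrays S (map +_ (heightsFrom n k []))) F ≈ F (columnsFrom n k [])
    empty n zero    F = +-identityʳ _
    empty n (suc k) F = trans (∑-arrays-∷ S (+ 0) (map +_ (heightsFrom (suc n) k [])) F)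
        (trans (+-identityʳ _) (empty (suc n) k λ Cs → F ([] ∷ Cs)))
  ∑-fillings S k (ℓ ∷ ℓs) F (p ∷ ps) = begin
    (∑[ T ∈ fillings S (ℓ ∷ ℓs) ] F (columnsFrom 0 k T))
      ≈⟨ ∑-cartesianProductWith _∷_ (vectors S ℓ) (fillings S ℓs) _ ⟩
    (∑[ v ∈ vectors S ℓ ] ∑[ T ∈ fillings S ℓs ] F (columnsFrom 0 k (v ∷ T)))
      ≈⟨ (∑-cong (vectors S ℓ) λ v → trans
           (∑-cong (fillings S ℓs) λ T → reflexive (cong F (columnsFrom-∷ 0 k v T)))
           (∑-fillings S k ℓs (λ Cs → F (addRow (toList v) Cs)) ps)) ⟩
    (∑[ v ∈ vectors S ℓ ] ∑[ Cs ∈ arrays S (map +_ (heightsFrom 0 k ℓs)) ] F (addRow (toList v) Cs))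
      ≈⟨ ∑-vectors S ℓ (λ v → ∑[ Cs ∈ arrays S (map +_ (heightsFrom 0 k ℓs)) ] F (addRow v Cs)) ⟩
    (∑[ v ∈ words S ℓ ] ∑[ Cs ∈ arrays S (map +_ (heightsFrom 0 k ℓs)) ] F (addRow v Cs))
      ≈⟨ ∑-raise S ℓ (heightsFrom 0 k ℓs) F (subst (ℓ ℕ.≤_) (≡.sym (length-heightsFrom 0 k ℓs)) p) ⟨
    ∑ (arrays S (map +_ (raise ℓ (heightsFrom 0 k ℓs)))) F
      ≡⟨ cong (λ hs → ∑ (arrays S (map +_ hs)) F) (heightsFrom-∷ 0 k ℓ ℓs) ⟨
    ∑ (arrays S (map +_ (heightsFrom 0 k (ℓ ∷ ℓs)))) F ∎

  WeakRow : List A → Set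
  WeakRow = Linked λ x y → ¬ (y < x)

  tab≤-[] : ∀ b C → Tab≤ b C []
  tab≤-[] zero    C = tt
  tab≤-[] (suc b) C = tt

  agree-∷-empty : ∀ b C {Cs} → All (_≡ []) Cs → Agree b (C ∷ Cs)
  agree-∷-empty b C []          = [-]
  agree-∷-empty b C (refl ∷ ps) = tab≤-[] b C ∷ agree-∷-empty b [] ps

  agree-empty : ∀ b {Cs} → All (_≡ []) Cs → Agree b Cs
  agree-empty b []          = []
  agree-empty b (refl ∷ ps) = agree-∷-empty b [] ps

  -- Where v ends, the covering condition makes all further columns empty, and an empty right column
  -- is never in conflict with its neighbour.
  agree-addRow⁺ : ∀ b v Cs → Covers v Cs → WeakRow v → Agree b Cs → Agree (suc b) (addRow v Cs)
  agree-addRow⁺ b []          Cs           c w       l       = agree-empty (suc b) c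
  agree-addRow⁺ b (x ∷ [])    (C ∷ Cs)     c w       l       = agree-∷-empty (suc b) (x ∷ C) c
  agree-addRow⁺ b (x ∷ y ∷ v) (C ∷ D ∷ Cs) c (n ∷ w) (t ∷ l) = (n , t) ∷ agree-addRow⁺ b (y ∷ v) (D ∷ Cs) c w l

  agree-addRow⁻ : ∀ b v Cs → Covers v Cs → Agree (suc b) (addRow v Cs) → WeakRow v × Agree b Cs
  agree-addRow⁻ b []          Cs           c l             = [] , agree-empty b c
  agree-addRow⁻ b (x ∷ [])    (C ∷ Cs)     c l             = [-] , agree-∷-empty b C c
  agree-addRow⁻ b (x ∷ y ∷ v) (C ∷ D ∷ Cs) c ((n , t) ∷ l) with agree-addRow⁻ b (y ∷ v) (D ∷ Cs) c l
  ... | w , l′ = n ∷ w , t ∷ l′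

  -- Each row of the filling accounts for one unit of the bound; the slack b is left for columns
  -- that are already empty.
  rows⇒agree : ∀ b k {ℓs} (T : Filling A ℓs) → All (ℕ._≤ k) ℓs → AllPairs ℕ._≥_ ℓs →
               All WeakRow (rows T) → Agree (length ℓs ℕ.+ b) (columnsFrom 0 k T)
  rows⇒agree b k []      []       []       []       = agree-empty b (columnsFrom-empty 0 k [] [])
  rows⇒agree b k (v ∷ T) (p ∷ ps) (d ∷ ds) (w ∷ ws) = subst (Agree _) (≡.sym (columnsFrom-∷ 0 k v T))
    (agree-addRow⁺ _ (toList v) (columnsFrom 0 k T) (covers-columnsFrom 0 k v T p d) w (rows⇒agree b k T ps ds ws))

  agree⇒rows : ∀ b k {ℓs} (T : Filling A ℓs) → All (ℕ._≤ k) ℓs → AllPairs ℕ._≥_ ℓs →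
               Agree (length ℓs ℕ.+ b) (columnsFrom 0 k T) → All WeakRow (rows T)
  agree⇒rows b k []      []       []       l = []
  agree⇒rows b k (v ∷ T) (p ∷ ps) (d ∷ ds) l
    with agree-addRow⁻ _ (toList v) (columnsFrom 0 k T) (covers-columnsFrom 0 k v T p d)
        (subst (Agree _) (columnsFrom-∷ 0 k v T) l)
  ... | w , l′ = w ∷ agree⇒rows b k T ps ds l′

-- The quotient of a ring by a generated ideal.

module _ (R : Ring 0ℓ 0ℓ) (G : Pred (Ring.Carrier R) 0ℓ) where
  open Ring R renaming (refl to ≈-refl)
  open Algebra.Properties.Ring R
  open import Relation.Binary.Reasoning.Setoid setoid

  private
    I : Pred Carrier 0ℓ
    I = IdealGeneratedBy R G

    x-y+y-z : ∀ x y z → (x - y) + (y - z) ≈ x - z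
    x-y+y-z x y z = begin
      (x - y) + (y - z)     ≈⟨ +-assoc x (- y) (y - z) ⟩
      x + (- y + (y - z))   ≈⟨ +-congˡ (trans (sym (+-assoc (- y) y (- z))) (+-congʳ (-‿inverseˡ y))) ⟩
      x + (0# - z)          ≈⟨ +-congˡ (+-identityˡ (- z)) ⟩
      x - z                 ∎

    negate : ∀ {x} → I x → I (- x)
    negate {x} i = resp (-1*x≈-x x) (timesˡ (- 1#) i)

  -- A record, so that Agda can infer both sides from the type.
  record _≡ᴵ_ (x y : Carrier) : Set where
    constructor congruent
    field congruence : CongruentMod R I x y
  open _≡ᴵ_ public

  ≈⇒≡ᴵ : ∀ {x y} → x ≈ y → x ≡ᴵ y
  ≈⇒≡ᴵ eq = congruent (resp (sym (x≈y⇒x∙y⁻¹≈ε eq)) zeroᴵ)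

  -- The carrier stays the same and congruence becomes the equality, so identities proved in an
  -- abstract ring are congruences between the given polynomials.
  quotientRing : Ring 0ℓ 0ℓ
  quotientRing = record
    { Carrier = Carrier ; _≈_ = _≡ᴵ_ ; _+_ = _+_ ; _*_ = _*_ ; -_ = -_ ; 0# = 0# ; 1# = 1#
    ; isRing = record
      { +-isAbelianGroup = record
        { isGroup = record
          { isMonoid = record
            { isSemigroup = record
              { isMagma = record
                { isEquivalence = record
                  { refl  = ≈⇒≡ᴵ ≈-refl
                  ; sym   = λ {x} {y} (congruent i) → congruent
                      (resp (trans (-‿anti-homo-+ x (- y)) (+-congʳ (-‿involutive y))) (negate i))
                  ; trans = λ {x} {y} {z} (congruent i) (congruent j) → congruent (resp (x-y+y-z x y z) (plus i j))
                  }
                ; ∙-cong = λ {x} {y} {u} {v} (congruent i) (congruent j) → congruent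
                    (resp (trans (Sums.+-interchange R x (- y) u (- v)) (+-congˡ (-‿+-comm y v))) (plus i j))
                }
              ; assoc = λ x y z → ≈⇒≡ᴵ (+-assoc x y z)
              }
            ; identity = (λ x → ≈⇒≡ᴵ (+-identityˡ x)) , (λ x → ≈⇒≡ᴵ (+-identityʳ x))
            }
          ; inverse = (λ x → ≈⇒≡ᴵ (-‿inverseˡ x)) , (λ x → ≈⇒≡ᴵ (-‿inverseʳ x))
          ; ⁻¹-cong = λ {x} {y} (congruent i) → congruent (resp (sym (-‿+-comm x (- y))) (negate i))
          }
        ; comm = λ x y → ≈⇒≡ᴵ (+-comm x y)
        }
      ; *-cong = λ {x} {y} {u} {v} (congruent i) (congruent j) → congruent
          (resp (trans (+-cong ([y-z]x≈yx-zx u x y) (x[y-z]≈xy-xz y u v)) (x-y+y-z (x * u) (y * u) (y * v)))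
                (plus (timesʳ u i) (timesˡ y j)))
      ; *-assoc = λ x y z → ≈⇒≡ᴵ (*-assoc x y z)
      ; *-identity = (λ x → ≈⇒≡ᴵ (*-identityˡ x)) , (λ x → ≈⇒≡ᴵ (*-identityʳ x))
      ; distrib = (λ x y z → ≈⇒≡ᴵ (distribˡ x y z)) , (λ x y z → ≈⇒≡ᴵ (distribʳ x y z))
      }
    }

-- The plactic algebra of a (3+1)-free poset.

module FreePoset (P : FinitePoset) (3+1-free : ThreePlusOneFree P) where
  open FinitePoset P
  open Sumᴾ using (inj₁; inj₂)
  private
    module ≤ = IsDecPartialOrder isDecPartialOrder
    module < = IsDecStrictPartialOrder <-isDecStrictPartialOrder

  -- Any comparison of w with a member of the chain would yield x ≤ w or w ≤ z by transitivity. If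
  -- both are impossible, the chain and w form a forbidden induced subposet.
  comparable : ∀ {x y z} w → x < y → y < z → (w < z) ⊎ (x < w)
  comparable {x} {y} {z} w x<y y<z with w <? z | x <? w
  ... | yes w<z | _       = inj₁ w<z
  ... | no _    | yes x<w = inj₂ x<w
  ... | no w≮z  | no x≮w  = ⊥-elim (3+1-free (f , record
      { isOrderHomomorphism = record { cong = cong f ; mono = mono } ; injective = injective ; cancel = cancel }))
    where
    x<z : x < z
    x<z = <.trans x<y y<z

    f : Fin 3 ⊎ Fin 1 → Carrier
    f (inj₁ Fin.zero)                     = x
    f (inj₁ (Fin.suc Fin.zero))           = y
    f (inj₁ (Fin.suc (Fin.suc Fin.zero))) = z
    f (inj₂ _)                            = w

    ≤⇒<⊎≡ : ∀ {a b} → a ≤ b → a < b ⊎ a ≡ b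
    ≤⇒<⊎≡ {a} {b} a≤b with a ≟ b
    ... | yes a≡b = inj₂ a≡b
    ... | no  a≢b = inj₁ (a≤b , a≢b)

    chain-< : ∀ {i j} → i Fin.< j → f (inj₁ i) < f (inj₁ j)
    chain-< {Fin.zero}         {Fin.suc Fin.zero}           _ = x<y
    chain-< {Fin.zero}         {Fin.suc (Fin.suc Fin.zero)} _ = x<z
    chain-< {Fin.suc Fin.zero} {Fin.suc (Fin.suc Fin.zero)} _ = y<z
    chain-< {Fin.suc Fin.zero} {Fin.suc Fin.zero} (ℕ.s≤s ())
    chain-< {Fin.suc (Fin.suc Fin.zero)} {Fin.suc Fin.zero} (ℕ.s≤s ())
    chain-< {Fin.suc (Fin.suc Fin.zero)} {Fin.suc (Fin.suc Fin.zero)} (ℕ.s≤s (ℕ.s≤s ()))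

    mono : ∀ {i j} → Sumᴾ.Pointwise Fin._≤_ Fin._≤_ i j → f i ≤ f j
    mono {inj₁ i} {inj₁ j} (inj₁ i≤j) with i Fin.≟ j
    ... | yes refl = ≤.refl
    ... | no  i≢j  = proj₁ (chain-< (Fin.≤∧≢⇒< i≤j i≢j))
    mono (inj₂ _) = ≤.refl

    x≤ : ∀ i → x ≤ f (inj₁ i)
    x≤ i = mono {inj₁ Fin.zero} {inj₁ i} (inj₁ ℕ.z≤n)

    ≤z : ∀ i → f (inj₁ i) ≤ z
    ≤z i = mono {inj₁ i} {inj₁ (Fin.suc (Fin.suc Fin.zero))} (inj₁ (ℕ.s≤s⁻¹ (Fin.toℕ<n i)))

    -- Equality of w and x is excluded too, because then w < z.
    x≰w : ¬ (x ≤ w)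
    x≰w x≤w with ≤⇒<⊎≡ x≤w
    ... | inj₁ x<w  = x≮w x<w
    ... | inj₂ refl = w≮z x<z

    w≰z : ¬ (w ≤ z)
    w≰z w≤z with ≤⇒<⊎≡ w≤z
    ... | inj₁ w<z  = w≮z w<z
    ... | inj₂ refl = x≮w x<z

    cancel : ∀ {i j} → f i ≤ f j → Sumᴾ.Pointwise Fin._≤_ Fin._≤_ i j
    cancel {inj₁ i} {inj₁ j} le with i Fin.≤? j
    ... | yes i≤j = inj₁ i≤j
    ... | no  i≰j = ⊥-elim (proj₂ (chain-< (ℕ.≰⇒> i≰j)) (≤.antisym (proj₁ (chain-< (ℕ.≰⇒> i≰j))) le))
    cancel {inj₁ i} {inj₂ j} le = ⊥-elim (x≰w (≤.trans (x≤ i) le))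
    cancel {inj₂ i} {inj₁ j} le = ⊥-elim (w≰z (≤.trans le (≤z j)))
    cancel {inj₂ Fin.zero} {inj₂ Fin.zero} le = inj₂ ℕ.z≤n

    injective : ∀ {i j} → f i ≡ f j → i ≡ j
    injective {i} {j} eq = antisym (cancel (≤.reflexive eq)) (cancel (≤.reflexive (≡.sym eq)))
      where
      antisym : ∀ {i j} → Sumᴾ.Pointwise Fin._≤_ Fin._≤_ i j → Sumᴾ.Pointwise Fin._≤_ Fin._≤_ j i → i ≡ j
      antisym (inj₁ p) (inj₁ q) = cong inj₁ (Fin.≤-antisym p q)
      antisym {inj₂ Fin.zero} {inj₂ Fin.zero} _ _ = refl

  open PSchur P using (𝐮; ring; PlacticRelation; rel₁; rel₂; rel₃)

  incomparable : ∀ {a b} → ¬ (a < b) → ¬ (b < a) → a ∼ b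
  incomparable {a} {b} a≮b b≮a with a ≟ b
  ... | yes a≡b = inj₂ a≡b
  ... | no  a≢b = inj₁ ((λ a≤b → a≮b (a≤b , a≢b)) , (λ b≤a → b≮a (b≤a , a≢b ∘ ≡.sym)))

  placticAlgebra : PlacticAlgebra
  placticAlgebra = record
    { A = Carrier ; _<_ = _<_ ; _<?_ = _<?_ ; <-irrefl = <.irrefl refl ; <-trans = <.trans ; free = comparable
    ; R = quotientRing ring PlacticRelation
    ; u = λ a → 𝐮 (a ∷ [])
    ; rel₁ = λ a<b c≮b a<c → congruent (generator (rel₁ a<b c≮b a<c))
    ; rel₂ = λ b≮a b<c a<c → congruent (generator (rel₂ b≮a b<c a<c))
    ; rel₃ = λ a≮b b≮a b≮c c≮b a<c → congruent (generator (rel₃ (incomparable a≮b b≮a) (incomparable b≮c c≮b) a<c))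
    }

columnsFrom-applyUpTo : {B : Set} {ℓs : List ℕ} (n k : ℕ) (T : Filling B ℓs) →
                        columnsFrom n k T ≡ applyUpTo (λ c → column (n ℕ.+ c) T) k
columnsFrom-applyUpTo n zero    T = refl
columnsFrom-applyUpTo n (suc k) T = cong₂ _∷_ (cong (λ m → column m T) (≡.sym (ℕ.+-identityʳ n)))
  (≡.trans (columnsFrom-applyUpTo (suc n) k T) (applyUpTo-cong k λ c → cong (λ m → column m T) (≡.sym (ℕ.+-suc n c))))
  where
  applyUpTo-cong : {C : Set} {f g : ℕ → C} (k : ℕ) → (∀ c → f c ≡ g c) → applyUpTo f k ≡ applyUpTo g k
  applyUpTo-cong zero    eq = refl
  applyUpTo-cong (suc k) eq = cong₂ _∷_ (eq 0) (applyUpTo-cong k (eq ∘ suc))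

columnsFrom-upTo : {B : Set} {ℓs : List ℕ} (k : ℕ) (T : Filling B ℓs) →
                   columnsFrom 0 k T ≡ map (λ c → column c T) (upTo k)
columnsFrom-upTo k T = ≡.trans (columnsFrom-applyUpTo 0 k T) (≡.sym (List.map-applyUpTo id (λ c → column c T) k))

length-filter-mono : {B : Set} {U V : B → Set} (U? : Decidable U) (V? : Decidable V) → (∀ {x} → U x → V x) →
                     ∀ xs → length (filter U? xs) ℕ.≤ length (filter V? xs)
length-filter-mono U? V? imp []       = ℕ.z≤n
length-filter-mono U? V? imp (x ∷ xs) with U? x | V? x
... | yes _ | yes _ = ℕ.s≤s (length-filter-mono U? V? imp xs)
... | yes u | no ¬v = ⊥-elim (¬v (imp u))
... | no _  | yes _ = ℕ.m≤n⇒m≤1+n (length-filter-mono U? V? imp xs)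
... | no _  | no _  = length-filter-mono U? V? imp xs

toList-distinct : ∀ {k n} (v : Vec (Fin k) n) → Vecᴾ.AllPairs (λ i j → ¬ i ≡ j) v → Distinct (toList v)
toList-distinct []      Vecᴾ.[]       = []
toList-distinct (x ∷ v) (p Vecᴾ.∷ ps) = all p ∷ toList-distinct v ps
  where
  all : ∀ {n} {w : Vec _ n} → Vecᴬ.All (λ j → ¬ x ≡ j) w → All (λ j → ¬ x ≡ j) (toList w)
  all Vecᴬ.[]       = []
  all (q Vecᴬ.∷ qs) = q ∷ all qs

distinct-toList : ∀ {k n} (v : Vec (Fin k) n) → Distinct (toList v) → Vecᴾ.AllPairs (λ i j → ¬ i ≡ j) v
distinct-toList []      []       = Vecᴾ.[]
distinct-toList (x ∷ v) (p ∷ ps) = all v p Vecᴾ.∷ distinct-toList v ps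
  where
  all : ∀ {n} (w : Vec _ n) → All (λ j → ¬ x ≡ j) (toList w) → Vecᴬ.All (λ j → ¬ x ≡ j) w
  all []      []       = Vecᴬ.[]
  all (y ∷ w) (q ∷ qs) = q Vecᴬ.∷ all w qs

inversions-toList : ∀ {k n} (v : Vec (Fin k) n) → inversions v ≡ inversionsᴸ (toList v)
inversions-toList []      = refl
inversions-toList (x ∷ v) = cong (length (filter (Fin._<? x) (toList v)) ℕ.+_) (inversions-toList v)

-- The alternating sum for a partition and its tableaux.

module Main (P : FinitePoset) (3+1-free : ThreePlusOneFree P) (Λ : Partition) where
  open FinitePoset P using (elements)
  open Partition Λ renaming (first to k)
  open FreePoset P 3+1-free using (placticAlgebra)
  private
    module Poset = PSchur P
  open PSchur P using (𝐮; _·_; 𝔍; SSYT; colword; isTableau?)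
  open Arrays placticAlgebra hiding (Λ)
  open Tableaux placticAlgebra
  open Finite R using (sign; signed; sign-cong; ∏; ∏-cong)
  open Transposition R using (∑-transpose)
  open import Relation.Binary.Reasoning.Setoid setoid

  col-reverse-word : ∀ X → col X ≡ 𝐮 (reverse X)
  col-reverse-word []      = refl
  col-reverse-word (a ∷ X) = ≡.trans (cong (_* u a) (col-reverse-word X)) (cong 𝐮 (≡.sym (List.unfold-reverse a X)))

  columns-word : ∀ Cs → columns Cs ≡ 𝐮 (concatMap reverse Cs)
  columns-word []       = refl
  columns-word (C ∷ Cs) = cong₂ _*_ (col-reverse-word C) (columns-word Cs)

  e-poset : ∀ z → Poset.e z ≈ e elements z
  e-poset -[1+ n ] = ≈-refl
  e-poset (+ n)    = begin
    ∑ (filter falling? (map toList (vectors elements n))) 𝐮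
      ≈⟨ ∑-filter falling? (map toList (vectors elements n)) 𝐮 ⟩
    (∑[ w ∈ map toList (vectors elements n) ] guard (falling? w) (𝐮 w))
      ≈⟨ ∑-map toList (vectors elements n) _ ⟩
    (∑[ v ∈ vectors elements n ] guard (falling? (toList v)) (𝐮 (toList v)))
      ≈⟨ ∑-vectors elements n (λ w → guard (falling? w) (𝐮 w)) ⟩
    (∑[ w ∈ words elements n ] guard (falling? w) (𝐮 w))
      ≈⟨ ∑-words-reverse elements n _ ⟩
    (∑[ w ∈ words elements n ] guard (falling? (reverse w)) (𝐮 (reverse w)))
      ≈⟨ ∑-cong (words elements n) (λ w → guard-cong (falling? (reverse w)) (chain? w)
           (λ l → subst Chain (List.reverse-involutive w)
               (allPairs-reverse (Linked.Linked⇒AllPairs (flip <-trans) l)))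
           (λ c → Linked.AllPairs⇒Linked (allPairs-reverse c))
           (λ _ → reflexive (≡.sym (col-reverse-word w)))) ⟩
    (∑[ w ∈ words elements n ] guard (chain? w) (col w)) ∎
    where
    falling? : ∀ w → Dec (Linked (flip _<_) w)
    falling? = linked? (flip _<?_)

  sgn-· : ∀ {n} (π : Vec (Fin n) n) f → sgn π · f ≡ sign (inversions π) f
  sgn-· π f = power (inversions π)
    where
    power : ∀ n → (-1ℤ ℤ.^ n) · f ≡ sign n f
    power zero    = ≡.trans (List.map-cong (λ (c , w) → cong (_, w) (ℤ.*-identityˡ c)) f) (List.map-id f)
    power (suc n) = ≡.trans (List.map-cong (λ (c , w) → cong (_, w)
        (≡.trans (ℤ.*-assoc -1ℤ (-1ℤ ℤ.^ n) c) (ℤ.-1*i≡-i _))) f)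
      (≡.trans (List.map-∘ f) (cong -_ (power n)))

  conj : ℕ → ℕ
  conj n = conjugatePart (suc n)

  -- The part of the index λ'ᵢ + π(i) - i that belongs to row i of the determinant.
  L : Fin k → ℤ
  L i = + conj (toℕ i) ℤ.- + toℕ i

  antitone : ∀ {i j} → i Fin.≤ j → L j ℤ.≤ L i
  antitone {i} {j} i≤j = ℤ.+-mono-≤
    (ℤ.+≤+ (length-filter-mono (suc (toℕ j) ℕ.≤?_) (suc (toℕ i) ℕ.≤?_) (ℕ.≤-trans (ℕ.s≤s i≤j)) parts))
    (ℤ.neg-mono-≤ (ℤ.+≤+ i≤j))

  open Shapes placticAlgebra L antitone

  -- The first summand bounds every L i and the second every position, so b bounds all heights; it
  -- also has the form number of rows plus slack of `rows⇒agree`.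
  b : ℕ
  b = length parts ℕ.+ k

  L-bounded : ∀ i m → m ℕ.< k → L i ℤ.+ + m ℤ.≤ + b
  L-bounded i m m<k = ℤ.+-mono-≤
    (ℤ.≤-trans (ℤ.i-j≤i (+ conj (toℕ i)) (+ toℕ i)) (ℤ.+≤+ (List.length-filter (suc (toℕ i) ℕ.≤?_) parts)))
    (ℤ.+≤+ (ℕ.<⇒≤ m<k))

  m : Fin k → Fin k → Carrier
  m i j = e elements (L i ℤ.+ + toℕ j)

  -- Now the factor in position j has index L (σ j) + j, which is an entry of `shape` for the word
  -- σ.
  𝔍-transposed : 𝔍 Λ ≈ (∑[ σ ∈ permutations k ] sign (inversions σ) (∏ (allFin k) λ j → m (lookup σ j) j))
  𝔍-transposed = trans
    (∑-cong (permutations k) λ π → trans (reflexive (sgn-· π _)) (sign-cong (inversions π)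
      (∏-cong (allFin k) λ i → trans (e-poset (+ conj (toℕ i) ℤ.+ + toℕ (lookup π i) ℤ.- + toℕ i))
        (reflexive (cong (e elements) (rearrange (+ conj (toℕ i)) (+ toℕ i) (+ toℕ (lookup π i))))))))
    (∑-transpose m λ i j i′ j′ → e-comm elements (L i ℤ.+ + toℕ j) (L i′ ℤ.+ + toℕ j′))
    where
    rearrange : ∀ c i p → c ℤ.+ p ℤ.- i ≡ c ℤ.- i ℤ.+ p
    rearrange = solve-∀

  ∏-shape : ∀ {n} o (v : Vec (Fin k) n) →
            ∏ (allFin n) (λ j → e elements (L (lookup v j) ℤ.+ + (o ℕ.+ toℕ j))) ≈ ∏e elements (shape o (toList v))
  ∏-shape o []      = ≈-refl
  ∏-shape {suc n} o (i ∷ v) = *-cong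
    (reflexive (cong (λ x → e elements (L i ℤ.+ + x)) (ℕ.+-identityʳ o)))
    (trans (reflexive (cong (foldr _*_ 1#)
        (≡.trans (List.map-tabulate Fin.suc f) (≡.sym (List.map-tabulate id (f ∘ Fin.suc))))))
      (trans (∏-cong (allFin n) λ j → reflexive (cong (λ x → e elements (L (lookup v j) ℤ.+ + x))
          (ℕ.+-suc o (toℕ j))))
        (∏-shape (suc o) v)))
    where
    f : Fin (suc n) → Carrier
    f j = e elements (L (lookup (i ∷ v) j) ℤ.+ + (o ℕ.+ toℕ j))

  permutations⇒words :
    (∑[ σ ∈ permutations k ] sign (inversions σ) (∏ (allFin k) λ j → m (lookup σ j) j)) ≈
    (∑[ w ∈ words (allFin k) k ] signed w (∏e elements (shape 0 w)))
  permutations⇒words = begin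
    (∑[ σ ∈ permutations k ] sign (inversions σ) (∏ (allFin k) λ j → m (lookup σ j) j))
      ≈⟨ ∑-filter permutation? (vectors (allFin k) k) _ ⟩
    (∑[ σ ∈ vectors (allFin k) k ] guard (permutation? σ) (sign (inversions σ) (∏ (allFin k) λ j → m (lookup σ j) j)))
      ≈⟨ (∑-cong (vectors (allFin k) k) λ σ → guard-cong (permutation? σ) (distinct? (toList σ)) (toList-distinct σ)
           (distinct-toList σ)
           λ _ → trans (reflexive (cong (λ n → sign n (∏ (allFin k) λ j → m (lookup σ j) j)) (inversions-toList σ)))
                       (sign-cong (inversionsᴸ (toList σ)) (∏-shape 0 σ))) ⟩
    (∑[ σ ∈ vectors (allFin k) k ] signed (toList σ) (∏e elements (shape 0 (toList σ))))
      ≈⟨ ∑-vectors (allFin k) k (λ w → signed w (∏e elements (shape 0 w))) ⟩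
    (∑[ w ∈ words (allFin k) k ] signed w (∏e elements (shape 0 w))) ∎
    where
    permutation? : ∀ (σ : Vec (Fin k) k) → Dec (Vecᴾ.AllPairs (λ i j → ¬ i ≡ j) σ)
    permutation? = Vecᴾ.allPairs? λ i j → ¬? (i Fin.≟ j)

  shape-conjugate : shape 0 (allFin k) ≡ map +_ (heightsFrom 0 k parts)
  shape-conjugate = go 0 k id (λ _ → refl)
    where
    cancel : ∀ c o → c ℤ.- o ℤ.+ o ≡ c
    cancel = solve-∀
    go : ∀ o n (g : Fin n → Fin k) → (∀ i → toℕ (g i) ≡ o ℕ.+ toℕ i) → shape o (tabulate g) ≡ map +_
        (heightsFrom o n parts)
    go o zero    g eq = refl
    go o (suc n) g eq = cong₂ _∷_
      (≡.trans (cong (λ x → + conj x ℤ.- + x ℤ.+ + o) (≡.trans (eq Fin.zero) (ℕ.+-identityʳ o)))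
          (cancel (+ conj o) (+ o)))
      (go (suc o) n (g ∘ Fin.suc) λ i → ≡.trans (eq (Fin.suc i)) (ℕ.+-suc o (toℕ i)))

  parts-decreasing : AllPairs ℕ._≥_ parts
  parts-decreasing = Linked.Linked⇒AllPairs (flip ℕ.≤-trans) decreasing

  parts≤k : All (ℕ._≤ k) parts
  parts≤k = bounded parts parts-decreasing
    where
    bounded : ∀ ps → AllPairs ℕ._≥_ ps → All (ℕ._≤ fromMaybe 0 (head ps)) ps
    bounded []       []      = []
    bounded (p ∷ ps) (d ∷ _) = ℕ.≤-refl ∷ d

  tableau-word : ∀ T → guard (agree? b (columnsFrom 0 k T)) (term (columnsFrom 0 k T)) ≈
                       guard (isTableau? Λ T) (𝐮 (colword Λ T))
  tableau-word T = trans (guard-× (agree? b (columnsFrom 0 k T)) (chains? (columnsFrom 0 k T)) _)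
    (guard-cong (agree? b (columnsFrom 0 k T) ×-dec chains? (columnsFrom 0 k T)) (isTableau? Λ T)
      (λ (a , c) → All.map (Linked.AllPairs⇒Linked) (All.map⁻ (subst (All Chain) (columnsFrom-upTo k T) c)) ,
                   -- The first k is the slack contained in b, the second the number of columns.
                   agree⇒rows k k T parts≤k parts-decreasing a)
      (λ (c , r) → rows⇒agree k k T parts≤k parts-decreasing r ,
                   subst (All Chain) (≡.sym (columnsFrom-upTo k T))
                       (All.map⁺ (All.map (Linked.Linked⇒AllPairs <-trans) c)))
      (λ _ → reflexive (≡.trans (columns-word (columnsFrom 0 k T)) (cong 𝐮
        (≡.trans (cong (concatMap reverse) (columnsFrom-upTo k T))
            (List.concatMap-map reverse (λ c → column c T) (upTo k)))))))

  𝔍≈tableaux : 𝔍 Λ ≈ (∑[ T ∈ SSYT Λ ] 𝐮 (colword Λ T))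
  𝔍≈tableaux = begin
    𝔍 Λ
      ≈⟨ 𝔍-transposed ⟩
    (∑[ σ ∈ permutations k ] sign (inversions σ) (∏ (allFin k) λ j → m (lookup σ j) j))
      ≈⟨ permutations⇒words ⟩
    (∑[ w ∈ words (allFin k) k ] signed w (∏e elements (shape 0 w)))
      ≈⟨ ∑-signed-∏e b elements L-bounded ⟩
    flawless b elements (shape 0 (allFin k))
      ≡⟨ cong (flawless b elements) shape-conjugate ⟩
    flawless b elements (map +_ (heightsFrom 0 k parts))
      ≈⟨ ∑-fillings elements k parts (λ Cs → guard (agree? b Cs) (term Cs)) parts≤k ⟨
    (∑[ T ∈ fillings elements parts ] guard (agree? b (columnsFrom 0 k T)) (term (columnsFrom 0 k T)))
      ≈⟨ ∑-cong (fillings elements parts) tableau-word ⟩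
    (∑[ T ∈ fillings elements parts ] guard (isTableau? Λ T) (𝐮 (colword Λ T)))
      ≈⟨ ∑-filter (isTableau? Λ) (fillings elements parts) _ ⟨
    (∑[ T ∈ SSYT Λ ] 𝐮 (colword Λ T)) ∎

mainTheorem2 : (P : FinitePoset) → ThreePlusOneFree P → (Λ : Partition) →
    let open PSchur P in
    𝔍 Λ ≡ ∑[ T ∈ SSYT Λ ] 𝐮 (colword Λ T) mod-I-plac
mainTheorem2 P 3+1-free Λ = congruence (Main.𝔍≈tableaux P 3+1-free Λ)
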